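{- Let $F$ be a nonarchimedean local field, $B$ the quaternion division $F$-algebra, and $O_B$ its maximal $O_F$-order. Every $O_F$-algebra embedding $O_B\hookrightarrow\mathrm{Mat}_n(O_B)$ is $\mathrm{GL}_n(O_B)$-conjugate to $$\mathrm{id}^{\oplus r_1}\oplus\tau^{\oplus r_2}\oplus\varphi_1^{\oplus t_1}\oplus\varphi_2^{\oplus t_2}$$ for a unique quadruple $(r_1,r_2,t_1,t_2)\in\mathbb{Z}_{\ge0}^4$. Equivalently, in terms of lattices, $\{\mathbb{O},\mathbb{P},\mathbb{L}_1,\mathbb{L}_2\}$ forms a complete list of indecomposable $(O_B,O_B)$-bilattices up to isomorphism, and every $(O_B,O_B)$-bilattice $L$ is isomorphic to a direct sum $$\mathbb{O}^{\oplus r_1}\oplus\mathbb{P}^{\oplus r_2}\oplus\mathbb{L}_1^{\oplus t_1}\oplus\mathbb{L}_2^{\oplus t_2}\simeq O_B^{\oplus r_1}\oplus\mathfrak{P}^{\oplus r_2}\oplus\mathbb{L}_1^{\oplus t_1}\oplus\mathbb{L}_2^{\oplus t_2}$$ for some $(r_1,r_2,t_1,t_2)\in\mathbb{Z}_{\ge0}^4$ uniquely determined by $L$.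
   Context: An $(O_B,O_B)$-bilattice is a finitely generated $O_F$-torsion-free $(O_B,O_B)$-bimodule on which the left and right actions of $O_F$ agree; equivalently, a left $O_B\otimes_{O_F}O_B^{\mathrm{opp}}$-lattice. An $O_F$-algebra embedding $\varphi:O_B\hookrightarrow\mathrm{Mat}_n(O_B)$ turns the free right $O_B$-module $O_B^{\oplus n}$ of column vectors into a bilattice $(O_B^{\oplus n},\varphi)$ via $\alpha\cdot x=\varphi(\alpha)x$. For $\psi_i:O_B\hookrightarrow\mathrm{Mat}_{n_i}(O_B)$, $\psi_1\oplus\psi_2$ is the block diagonal embedding into $\mathrm{Mat}_{n_1+n_2}(O_B)$. Let $K$ be the unramified quadratic extension of $F$ with ring of integers $O_K$ and nontrivial automorphism $\sigma$, embedded in $B$; $\pi$ is a fixed uniformizer of $F$ and $\Pi\in O_B$ is chosen so that $O_B=O_K\oplus O_K\Pi$, $\Pi^2=\pi$, $\Pi a=a^\sigma\Pi$ for all $a\in O_K$. Put $\mathfrak{P}=\Pi O_B$. Define $\mathrm{id},\tau:O_B\to O_B$ by $\mathrm{id}(\alpha)=\alpha$, $\tau(\alpha)=\Pi^{ -1}\alpha\Pi$, and $\varphi_1,\varphi_2:O_B\hookrightarrow\mathrm{Mat}_2(O_B)$ by $$\varphi_1(\Pi)=\varphi_2(\Pi)=\begin{bmatrix}0&\pi\\1&0\end{bmatrix},\quad \varphi_1(a)=\begin{bmatrix}a&0\\0&a^\sigma\end{bmatrix},\quad\varphi_2(a)=\begin{bmatrix}a^\sigma&0\\0&a\end{bmatrix}\quad(a\in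 O_K).$$ Then $\mathbb{O}=(O_B,\mathrm{id})$, $\mathbb{P}=(O_B,\tau)$, $\mathbb{L}_1=(O_B^{\oplus2},\varphi_1)$, $\mathbb{L}_2=(O_B^{\oplus2},\varphi_2)$. In the second displayed sum, $O_B$ and $\mathfrak{P}$ carry the natural left and right multiplications. -}

module Defs where

open import Algebra.Bundles using (AbelianGroup; CommutativeRing; RawRing; Ring)
open import Algebra.Module.Bundles using (Bimodule; RawBimodule)
import Algebra.Module.Construct.DirectProduct as DirectProduct
import Algebra.Module.Construct.TensorUnit as TensorUnit
import Algebra.Module.Construct.Zero as Zero
import Algebra.Module.Morphism.BimoduleMonomorphism as BimoduleMonomorphism
open import Algebra.Module.Morphism.Structures using (IsBimoduleIsomorphism; IsBimoduleMonomorphism)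
import Algebra.Morphism.Construct.Composition as Composition
import Algebra.Morphism.Construct.Identity as Identity
import Algebra.Morphism.RingMonomorphism as RingMonomorphism
open import Algebra.Morphism.Structures using (IsRingHomomorphism; IsRingMonomorphism; IsRingIsomorphism)
import Algebra.Properties.CommutativeSemigroup as CommutativeSemigroupProperties
import Algebra.Properties.Group as GroupProperties
import Algebra.Properties.Ring as RingProperties
import Algebra.Properties.Semiring.Sum as SemiringSum
import Algebra.Solver.Ring.NaturalCoefficients.Default as Solver
open import Data.Fin.Base using (Fin; zero; suc; splitAt)
open import Data.Fin.Patterns using (0F; 1F; 2F; 3F)
open import Data.Integer.Base as ℤ using (ℤ; +_; -[1+_])
import Data.Integer.Properties as ℤₚ
open import Data.Nat.Base as ℕ using (ℕ; zero; suc)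
open import Data.Product.Base using (Σ; ∃; ∃-syntax; Σ-syntax; _×_; _,_; proj₁; proj₂)
open import Data.Product using (∃!)
open import Data.Sum.Base using (_⊎_; inj₁; inj₂)
open import Function.Base using (_∘_)
open import Level using (Level; _⊔_) renaming (suc to lsuc)
open import Relation.Binary.Construct.Add.Supremum.NonStrict ℤ._≤_ using (_≤⁺_; [_]; _≤⊤⁺; ≤⁺-dec)
open import Relation.Binary.PropositionalEquality as ≡ using (_≡_)
import Relation.Binary.Reasoning.Setoid as SetoidReasoning
open import Relation.Nullary.Construct.Add.Supremum using (_⁺; [_]; ⊤⁺)
open import Relation.Nullary.Decidable.Core using (yes; no)
open import Relation.Nullary.Negation using (¬_; contradiction)
open import Relation.Unary using (Pred; _∈_; _⊆_)

private
  variable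
    c ℓ p : Level

record IsSubring (R : Ring c ℓ) (P : Pred (Ring.Carrier R) p) : Set (c ⊔ ℓ ⊔ p) where
  open Ring R
  field
    resp : ∀ {x y} → x ≈ y → x ∈ P → y ∈ P
    0∈   : 0# ∈ P
    1∈   : 1# ∈ P
    +∈   : ∀ {x y} → x ∈ P → y ∈ P → x + y ∈ P
    *∈   : ∀ {x y} → x ∈ P → y ∈ P → x * y ∈ P
    -∈   : ∀ {x} → x ∈ P → - x ∈ P

module _ {R : Ring c ℓ} {P : Pred (Ring.Carrier R) p} (P-sub : IsSubring R P) where
  open Ring R
  open IsSubring P-sub

  subringRaw : RawRing (c ⊔ p) ℓ
  subringRaw = record
    { Carrier = Σ Carrier P
    ; _≈_     = λ x y → proj₁ x ≈ proj₁ y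
    ; _+_     = λ (x , x∈) (y , y∈) → x + y , +∈ x∈ y∈
    ; _*_     = λ (x , x∈) (y , y∈) → x * y , *∈ x∈ y∈
    ; -_      = λ (x , x∈) → - x , -∈ x∈
    ; 0#      = 0# , 0∈
    ; 1#      = 1# , 1∈
    }

  subring-inclusion : IsRingMonomorphism subringRaw rawRing proj₁
  subring-inclusion = record
    { isRingHomomorphism = record
      { isSemiringHomomorphism = record
        { isNearSemiringHomomorphism = record
          { +-isMonoidHomomorphism = record
            { isMagmaHomomorphism = record
              { isRelHomomorphism = record { cong = λ eq → eq }
              ; homo = λ _ _ → refl
              }
            ; ε-homo = refl
            }
          ; *-homo = λ _ _ → refl
          }
        ; 1#-homo = refl
        }
      ; -‿homo = λ _ → refl
      }
    ; injective = λ eq → eq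
    }

  subring : Ring (c ⊔ p) ℓ
  subring = record { isRing = RingMonomorphism.isRing subring-inclusion isRing }

infixl 6 _+⁺_

_+⁺_ : ℤ ⁺ → ℤ ⁺ → ℤ ⁺
[ m ] +⁺ [ n ] = [ m ℤ.+ n ]
[ _ ] +⁺ ⊤⁺    = ⊤⁺
⊤⁺    +⁺ _     = ⊤⁺

-- A field complete with respect to a normalised discrete valuation, with
-- finite residue field (of any characteristic).
record LocalField ℓ : Set (lsuc ℓ) where
  field
    commutativeRing : CommutativeRing ℓ ℓ
  open CommutativeRing commutativeRing public
  field
    1≉0     : ¬ 1# ≈ 0#
    inverse : ∀ x → ¬ x ≈ 0# → ∃[ y ] x * y ≈ 1#

    v         : Carrier → ℤ ⁺
    v-cong    : ∀ {x y} → x ≈ y → v x ≡ v y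
    v-0       : v 0# ≡ ⊤⁺
    v-⊤       : ∀ x → v x ≡ ⊤⁺ → x ≈ 0#
    v-*       : ∀ x y → v (x * y) ≡ v x +⁺ v y
    v-+       : ∀ n x y → n ≤⁺ v x → n ≤⁺ v y → n ≤⁺ v (x + y)
    v-normal  : ∃[ x ] v x ≡ [ + 1 ]

    complete  : (s : ℕ → Carrier) →
                (∀ n → ∃[ N ] (∀ i j → N ℕ.≤ i → N ℕ.≤ j → [ n ] ≤⁺ v (s i - s j))) →
                ∃[ x ] (∀ n → ∃[ N ] (∀ i → N ℕ.≤ i → [ n ] ≤⁺ v (s i - x)))

  O : Pred Carrier _
  O x = [ + 0 ] ≤⁺ v x

  field
    finiteResidueField :
      ∃[ q ] Σ[ r ∈ (Fin q → Carrier) ]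
        (∀ i → r i ∈ O) × (∀ x → x ∈ O → ∃[ i ] [ + 1 ] ≤⁺ v (x - r i))

private
  n+n≡n⇒n≡0 : ∀ n → n ℤ.+ n ≡ n → n ≡ + 0
  n+n≡n⇒n≡0 n eq = GroupProperties.identityʳ-unique (AbelianGroup.group ℤₚ.+-0-abelianGroup) n n eq

  n+n≡0⇒n≡0 : ∀ n → n ℤ.+ n ≡ + 0 → n ≡ + 0
  n+n≡0⇒n≡0 (+ zero)   _  = ≡.refl
  n+n≡0⇒n≡0 (+ suc _)  ()
  n+n≡0⇒n≡0 (-[1+ _ ]) ()

  []-injective : ∀ {m n : ℤ} → _≡_ {A = ℤ ⁺} [ m ] [ n ] → m ≡ n
  []-injective ≡.refl = ≡.refl

  0≤⁺-+⁺ : ∀ m n → [ + 0 ] ≤⁺ m → [ + 0 ] ≤⁺ n → [ + 0 ] ≤⁺ m +⁺ n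
  0≤⁺-+⁺ _ _ [ p ]      [ q ]      = [ ℤₚ.+-mono-≤ p q ]
  0≤⁺-+⁺ _ _ [ _ ]      (_ ≤⊤⁺)    = _ ≤⊤⁺
  0≤⁺-+⁺ _ _ (_ ≤⊤⁺)    _          = _ ≤⊤⁺

module _ (F : LocalField ℓ) where
  open LocalField F
  open RingProperties ring using (-1*x≈-x; -‿involutive; -‿distribˡ-*)

  private
    v-1 : v 1# ≡ [ + 0 ]
    v-1 = helper (v 1#) ≡.refl (≡.trans (≡.sym (v-* 1# 1#)) (v-cong (*-identityˡ 1#)))
      where
      helper : ∀ n → v 1# ≡ n → v 1# +⁺ v 1# ≡ v 1# → v 1# ≡ [ + 0 ]
      helper ⊤⁺ eq _ = contradiction (v-⊤ 1# eq) 1≉0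
      helper [ n ] eq dbl with v 1# | eq
      ... | _ | ≡.refl = ≡.cong [_] (n+n≡n⇒n≡0 n ([]-injective dbl))

    v[-1] : v (- 1#) ≡ [ + 0 ]
    v[-1] = helper (v (- 1#)) ≡.refl
      (≡.trans (≡.sym (v-* (- 1#) (- 1#)))
        (≡.trans (v-cong (trans (-1*x≈-x (- 1#)) (-‿involutive 1#))) v-1))
      where
      helper : ∀ n → v (- 1#) ≡ n → v (- 1#) +⁺ v (- 1#) ≡ [ + 0 ] → v (- 1#) ≡ [ + 0 ]
      helper n eq dbl with v (- 1#) | eq
      helper ⊤⁺    eq () | _ | ≡.refl
      helper [ n ] eq dbl | _ | ≡.refl = ≡.cong [_] (n+n≡0⇒n≡0 n ([]-injective dbl))

  O-isSubring : IsSubring ring O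
  O-isSubring = record
    { resp = λ x≈y → ≡.subst ([ + 0 ] ≤⁺_) (v-cong x≈y)
    ; 0∈   = ≡.subst ([ + 0 ] ≤⁺_) (≡.sym v-0) (_ ≤⊤⁺)
    ; 1∈   = ≡.subst ([ + 0 ] ≤⁺_) (≡.sym v-1) [ ℤₚ.≤-refl ]
    ; +∈   = v-+ [ + 0 ] _ _
    ; *∈   = λ {x} {y} x∈ y∈ →
               ≡.subst ([ + 0 ] ≤⁺_) (≡.sym (v-* x y)) (0≤⁺-+⁺ (v x) (v y) x∈ y∈)
    ; -∈   = λ {x} x∈ →
               ≡.subst ([ + 0 ] ≤⁺_)
                 (≡.trans (≡.sym (v-* (- 1#) x)) (v-cong (-1*x≈-x x)))
                 (0≤⁺-+⁺ (v (- 1#)) (v x) (≡.subst ([ + 0 ] ≤⁺_) (≡.sym v[-1]) [ ℤₚ.≤-refl ]) x∈)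
    }

  integers : CommutativeRing ℓ ℓ
  integers = record
    { isCommutativeRing =
        RingMonomorphism.isCommutativeRing (subring-inclusion O-isSubring) isCommutativeRing
    }

  inverse-in-O : ∀ x y → x * y ≈ 1# → ¬ x ∈ O → y ∈ O
  inverse-in-O x y xy≈1 x∉O =
    helper (v x) (v y) (≡.trans (≡.sym (v-* x y)) (≡.trans (v-cong xy≈1) v-1)) x∉O
    where
    helper : ∀ m n → m +⁺ n ≡ [ + 0 ] → ¬ [ + 0 ] ≤⁺ m → [ + 0 ] ≤⁺ n
    helper m ⊤⁺ _ _ = _ ≤⊤⁺
    helper ⊤⁺ [ _ ] ()
    helper [ + m ] [ n ] _ m<0 = contradiction [ ℤ.+≤+ ℕ.z≤n ] m<0
    helper [ -[1+ m ] ] [ + n ] _ _ = [ ℤ.+≤+ ℕ.z≤n ]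
    helper [ -[1+ m ] ] [ -[1+ n ] ] () _

-- An associative unital algebra over F, given by its structure map.
record AlgebraOver (F : LocalField ℓ) : Set (lsuc ℓ) where
  private
    module F = LocalField F
  field
    ring : Ring ℓ ℓ
  open Ring ring public
  field
    ι                   : F.Carrier → Carrier
    ι-isRingHomomorphism : IsRingHomomorphism F.rawRing rawRing ι
    ι-central           : ∀ a x → ι a * x ≈ x * ι a

  open SemiringSum semiring using (sum)

  HasDimension : ℕ → Set ℓ
  HasDimension n = Σ[ e ∈ (Fin n → Carrier) ]
    (∀ x → ∃! (λ (a b : Fin n → F.Carrier) → ∀ i → a i F.≈ b i) λ a → x ≈ sum λ i → ι (a i) * e i)

record QuaternionDivisionAlgebra (F : LocalField ℓ) : Set (lsuc ℓ) where
  private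
    module F = LocalField F
  field
    algebra : AlgebraOver F
  open AlgebraOver algebra public
  field
    dimension : HasDimension 4
    central   : ∀ x → (∀ y → x * y ≈ y * x) → ∃[ a ] x ≈ ι a
    1≉0       : ¬ 1# ≈ 0#
    division  : ∀ x → ¬ x ≈ 0# → ∃[ y ] (x * y ≈ 1# × y * x ≈ 1#)

record IsOrder {F : LocalField ℓ} (B : QuaternionDivisionAlgebra F)
               (R : Pred (QuaternionDivisionAlgebra.Carrier B) ℓ) : Set ℓ where
  private
    module F = LocalField F
  open QuaternionDivisionAlgebra B
  open SemiringSum semiring using (sum)
  field
    isSubring         : IsSubring ring R
    O⊆R               : ∀ a → a ∈ F.O → ι a ∈ R
    finitelyGenerated :
      ∃[ n ] Σ[ g ∈ (Fin n → Carrier) ]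
        (∀ i → g i ∈ R) ×
        (∀ x → x ∈ R → Σ[ a ∈ (Fin n → F.Carrier) ]
           (∀ i → a i ∈ F.O) × x ≈ sum λ i → ι (a i) * g i)
    spanning          : ∀ x → ∃[ a ] (¬ a F.≈ F.0# × ι a * x ∈ R)

IsMaximalOrder : {F : LocalField ℓ} (B : QuaternionDivisionAlgebra F) →
                 Pred (QuaternionDivisionAlgebra.Carrier B) ℓ → Set (lsuc ℓ)
IsMaximalOrder {ℓ} B R = IsOrder B R × (∀ (R′ : Pred _ ℓ) → IsOrder B R′ → R ⊆ R′ → R′ ⊆ R)

-- Both valuations are normalised, so v-ι says that the ramification index is 1.
record UnramifiedQuadraticExtension (F : LocalField ℓ) : Set (lsuc ℓ) where
  private
    module F = LocalField F
  field
    localField : LocalField ℓ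
  open LocalField localField public
  field
    ι                    : F.Carrier → Carrier
    ι-isRingHomomorphism : IsRingHomomorphism F.rawRing rawRing ι

  algebra : AlgebraOver F
  algebra = record
    { ring                 = ring
    ; ι                    = ι
    ; ι-isRingHomomorphism = ι-isRingHomomorphism
    ; ι-central            = λ _ _ → *-comm _ _
    }

  field
    quadratic : AlgebraOver.HasDimension algebra 2
    v-ι       : ∀ a → v (ι a) ≡ F.v a

    σ                   : Carrier → Carrier
    σ-isRingIsomorphism : IsRingIsomorphism rawRing rawRing σ
    σ-ι                 : ∀ a → σ (ι a) ≈ ι a
    σ-nontrivial        : ¬ (∀ x → σ x ≈ x)

record Presentation {F : LocalField ℓ} (B : QuaternionDivisionAlgebra F)
                    (O_B : Pred (QuaternionDivisionAlgebra.Carrier B) ℓ)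
                    (K : UnramifiedQuadraticExtension F) : Set ℓ where
  private
    module F = LocalField F
    module K = UnramifiedQuadraticExtension K
  open QuaternionDivisionAlgebra B
  field
    j                    : K.Carrier → Carrier
    j-isRingMonomorphism : IsRingMonomorphism K.rawRing rawRing j
    j-ι                  : ∀ a → j (K.ι a) ≈ ι a

    π             : F.Carrier
    π-uniformizer : F.v π ≡ [ + 1 ]

    Π           : Carrier
    Π∈O_B       : Π ∈ O_B
    O_K⊆O_B     : ∀ a → a ∈ K.O → j a ∈ O_B
    spanning    : ∀ x → x ∈ O_B →
                  ∃[ a ] ∃[ b ] (a ∈ K.O × b ∈ K.O × x ≈ j a + j b * Π)
    independent : ∀ a b → a ∈ K.O → b ∈ K.O → j a + j b * Π ≈ 0# →
                  a K.≈ K.0# × b K.≈ K.0#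
    Π²≈π        : Π * Π ≈ ι π
    Πa≈σaΠ      : ∀ a → a ∈ K.O → Π * j a ≈ j (K.σ a) * Π

module Matrices (R : Ring c ℓ) where
  open Ring R
  open SemiringSum semiring

  Matrix : ℕ → Set c
  Matrix n = Fin n → Fin n → Carrier

  scalar : ∀ {n} → Carrier → Matrix n
  scalar a zero    zero    = a
  scalar a zero    (suc _) = 0#
  scalar a (suc _) zero    = 0#
  scalar a (suc i) (suc k) = scalar a i k

  matrixRawRing : ℕ → RawRing c ℓ
  matrixRawRing n = record
    { Carrier = Matrix n
    ; _≈_     = λ A B → ∀ i k → A i k ≈ B i k
    ; _+_     = λ A B i k → A i k + B i k
    ; _*_     = λ A B i k → ∑[ m < n ] (A i m * B m k)
    ; -_      = λ A i k → - A i k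
    ; 0#      = λ _ _ → 0#
    ; 1#      = scalar 1#
    }

  matrix₂ : (a b c d : Carrier) → Matrix 2
  matrix₂ a b c d 0F 0F = a
  matrix₂ a b c d 0F 1F = b
  matrix₂ a b c d 1F 0F = c
  matrix₂ a b c d 1F 1F = d

  blockDiagonal : ∀ {m n} → Matrix m → Matrix n → Matrix (m ℕ.+ n)
  blockDiagonal {m} A B i k with splitAt m i | splitAt m k
  ... | inj₁ i′ | inj₁ k′ = A i′ k′
  ... | inj₂ i′ | inj₂ k′ = B i′ k′
  ... | inj₁ _  | inj₂ _  = 0#
  ... | inj₂ _  | inj₁ _  = 0#

  sum-scalar : ∀ {n} a (x : Fin n → Carrier) i → ∑[ k < n ] (scalar a i k * x k) ≈ a * x i
  sum-scalar {suc n} a x zero = trans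
    (+-congˡ (trans (sum-cong-≋ λ k → zeroˡ (x (suc k))) (sum-replicate-zero n)))
    (+-identityʳ _)
  sum-scalar {suc n} a x (suc i) =
    trans (+-cong (zeroˡ _) (sum-scalar a (x ∘ suc) i)) (+-identityˡ _)

module MatrixMap {c ℓ c′ ℓ′} (R : Ring c ℓ) (S : Ring c′ ℓ′)
                 {f : Ring.Carrier R → Ring.Carrier S}
                 (f-hom : IsRingHomomorphism (Ring.rawRing R) (Ring.rawRing S) f) where
  private
    module R = Ring R
    module S = Ring S
    module MR = Matrices R
    module MS = Matrices S
    module f = IsRingHomomorphism f-hom
    module ΣR = SemiringSum R.semiring
    module ΣS = SemiringSum S.semiring

  mapMatrix : ∀ {n} → MR.Matrix n → MS.Matrix n
  mapMatrix A i k = f (A i k)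

  private
    f-sum : ∀ {n} (x : Fin n → R.Carrier) → f (ΣR.sum x) S.≈ ΣS.sum (f ∘ x)
    f-sum {zero}  x = f.0#-homo
    f-sum {suc n} x = S.trans (f.+-homo _ _) (S.+-congˡ (f-sum (x ∘ suc)))

    f-scalar : ∀ {n} (i k : Fin n) → f (MR.scalar R.1# i k) S.≈ MS.scalar S.1# i k
    f-scalar zero    zero    = f.1#-homo
    f-scalar zero    (suc _) = f.0#-homo
    f-scalar (suc _) zero    = f.0#-homo
    f-scalar (suc i) (suc k) = f-scalar i k

  mapMatrix-isRingHomomorphism :
    ∀ n → IsRingHomomorphism (MR.matrixRawRing n) (MS.matrixRawRing n) mapMatrix
  mapMatrix-isRingHomomorphism n = record
    { isSemiringHomomorphism = record
      { isNearSemiringHomomorphism = record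
        { +-isMonoidHomomorphism = record
          { isMagmaHomomorphism = record
            { isRelHomomorphism = record { cong = λ eq i k → f.⟦⟧-cong (eq i k) }
            ; homo = λ _ _ _ _ → f.+-homo _ _
            }
          ; ε-homo = λ _ _ → f.0#-homo
          }
        ; *-homo = λ A B i k → S.trans (f-sum λ m → A i m R.* B m k)
                                       (ΣS.sum-cong-≋ λ m → f.*-homo (A i m) (B m k))
        }
      ; 1#-homo = f-scalar
      }
    ; -‿homo = λ _ _ _ → f.-‿homo _
    }

-- The free right R-module of column vectors, on which α acts from the left
-- through the matrix φ α.
module Columns (R : Ring c ℓ) {n : ℕ}
  (φ : Ring.Carrier R → Matrices.Matrix R n)
  (φ-hom : IsRingHomomorphism (Ring.rawRing R) (Matrices.matrixRawRing R n) φ) where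
  open Ring R
  open Matrices R
  open SemiringSum semiring
  open SetoidReasoning setoid
  private
    module φ = IsRingHomomorphism φ-hom

  columns : Bimodule R R c ℓ
  columns = record
    { Carrierᴹ = Fin n → Carrier
    ; _≈ᴹ_ = λ x y → ∀ i → x i ≈ y i
    ; _+ᴹ_ = λ x y i → x i + y i
    ; _*ₗ_ = λ α x i → ∑[ k < n ] (φ α i k * x k)
    ; _*ᵣ_ = λ x α i → x i * α
    ; 0ᴹ = λ _ → 0#
    ; -ᴹ_ = λ x i → - x i
    ; isBimodule = record
      { isBisemimodule = record
        { +ᴹ-isCommutativeMonoid = record
          { isMonoid = record
            { isSemigroup = record
              { isMagma = record
                { isEquivalence = record
                  { refl  = λ _ → refl
                  ; sym   = λ eq i → sym (eq i)
                  ; trans = λ eq eq′ i → trans (eq i) (eq′ i)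
                  }
                ; ∙-cong = λ eq eq′ i → +-cong (eq i) (eq′ i)
                }
              ; assoc = λ _ _ _ _ → +-assoc _ _ _
              }
            ; identity = (λ _ _ → +-identityˡ _) , (λ _ _ → +-identityʳ _)
            }
          ; comm = λ _ _ _ → +-comm _ _
          }
        ; isPreleftSemimodule = record
          { *ₗ-cong = λ eq eq′ i → sum-cong-≋ λ k → *-cong (φ.⟦⟧-cong eq i k) (eq′ k)
          ; *ₗ-zeroˡ = λ x i → trans
              (sum-cong-≋ λ k → trans (*-congʳ (φ.0#-homo i k)) (zeroˡ (x k)))
              (sum-replicate-zero n)
          ; *ₗ-distribʳ = λ x α β i → trans
              (sum-cong-≋ λ k → trans (*-congʳ (φ.+-homo α β i k)) (distribʳ (x k) _ _))
              (∑-distrib-+ (λ k → φ α i k * x k) (λ k → φ β i k * x k))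
          ; *ₗ-identityˡ = λ x i → trans
              (sum-cong-≋ λ k → *-congʳ (φ.1#-homo i k))
              (trans (sum-scalar 1# x i) (*-identityˡ (x i)))
          ; *ₗ-assoc = assoc
          ; *ₗ-zeroʳ = λ α i → trans
              (sum-cong-≋ λ k → zeroʳ (φ α i k))
              (sum-replicate-zero n)
          ; *ₗ-distribˡ = λ α x y i → trans
              (sum-cong-≋ λ k → distribˡ (φ α i k) (x k) (y k))
              (∑-distrib-+ (λ k → φ α i k * x k) (λ k → φ α i k * y k))
          }
        ; isPrerightSemimodule = record
          { *ᵣ-cong      = λ eq eq′ i → *-cong (eq i) eq′
          ; *ᵣ-zeroʳ     = λ _ _ → zeroʳ _
          ; *ᵣ-distribˡ  = λ _ _ _ _ → distribˡ _ _ _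
          ; *ᵣ-identityʳ = λ _ _ → *-identityʳ _
          ; *ᵣ-assoc     = λ _ _ _ _ → *-assoc _ _ _
          ; *ᵣ-zeroˡ     = λ _ _ → zeroˡ _
          ; *ᵣ-distribʳ  = λ _ _ _ _ → distribʳ _ _ _
          }
        ; *ₗ-*ᵣ-assoc = λ α x β i → trans
            (*-distribʳ-sum β (λ k → φ α i k * x k))
            (sum-cong-≋ λ k → *-assoc (φ α i k) (x k) β)
        }
      ; -ᴹ‿cong = λ eq i → -‿cong (eq i)
      ; -ᴹ‿inverse = (λ _ _ → -‿inverseˡ _) , (λ _ _ → -‿inverseʳ _)
      }
    }
    where
    assoc : ∀ α β (x : Fin n → Carrier) i →
            ∑[ k < n ] (φ (α * β) i k * x k) ≈
            ∑[ m < n ] (φ α i m * ∑[ k < n ] (φ β m k * x k))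
    assoc α β x i = begin
      ∑[ k < n ] (φ (α * β) i k * x k)
        ≈⟨ (sum-cong-≋ λ k → trans (*-congʳ (φ.*-homo α β i k))
                                   (*-distribʳ-sum (x k) (λ m → φ α i m * φ β m k))) ⟩
      ∑[ k < n ] ∑[ m < n ] (φ α i m * φ β m k * x k)
        ≈⟨ ∑-comm (λ k m → φ α i m * φ β m k * x k) ⟩
      ∑[ m < n ] ∑[ k < n ] (φ α i m * φ β m k * x k)
        ≈⟨ (sum-cong-≋ λ m → trans
              (sum-cong-≋ λ k → *-assoc (φ α i m) (φ β m k) (x k))
              (sym (*-distribˡ-sum (φ α i m) (λ k → φ β m k * x k)))) ⟩
      ∑[ m < n ] (φ α i m * ∑[ k < n ] (φ β m k * x k)) ∎

module _ {c ℓ c′ ℓ′} (A : CommutativeRing c ℓ) (R : Ring c′ ℓ′) where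
  private
    module A = CommutativeRing A
    module R = Ring R

  -- A ring R = A ⊕ AΠ with Π² = π and Πa = σ(a)Π, where A is commutative.
  module CyclicRing
    {e : A.Carrier → R.Carrier} (e-hom : IsRingHomomorphism A.rawRing R.rawRing e)
    {σ : A.Carrier → A.Carrier} (σ-hom : IsRingHomomorphism A.rawRing A.rawRing σ)
    (π : A.Carrier) (Π : R.Carrier)
    (spanning : ∀ α → ∃[ a ] ∃[ b ] α R.≈ e a R.+ e b R.* Π)
    (independent : ∀ a b → e a R.+ e b R.* Π R.≈ R.0# → a A.≈ A.0# × b A.≈ A.0#)
    (Π² : Π R.* Π R.≈ e π)
    (Πa : ∀ a → Π R.* e a R.≈ e (σ a) R.* Π)
    (π-cancel : ∀ a b → π A.* a A.≈ π A.* b → a A.≈ b) where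

    private
      module e = IsRingHomomorphism e-hom
      module σ = IsRingHomomorphism σ-hom
      module Aₚ = RingProperties A.ring
      module Rₚ = RingProperties R
      module M = Matrices A.ring
      open CommutativeSemigroupProperties R.+-commutativeSemigroup using (interchange)

    fst snd : R.Carrier → A.Carrier
    fst α = proj₁ (spanning α)
    snd α = proj₁ (proj₂ (spanning α))

    combine : A.Carrier → A.Carrier → R.Carrier
    combine a b = e a R.+ e b R.* Π

    split : ∀ α → α R.≈ combine (fst α) (snd α)
    split α = proj₂ (proj₂ (spanning α))

    combine-cong : ∀ {a b a′ b′} → a A.≈ a′ → b A.≈ b′ → combine a b R.≈ combine a′ b′
    combine-cong p q = R.+-cong (e.⟦⟧-cong p) (R.*-congʳ (e.⟦⟧-cong q))

    combine-+ : ∀ a b a′ b′ →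
      combine a b R.+ combine a′ b′ R.≈ combine (a A.+ a′) (b A.+ b′)
    combine-+ a b a′ b′ = begin
      (e a R.+ e b R.* Π) R.+ (e a′ R.+ e b′ R.* Π) ≈⟨ interchange _ _ _ _ ⟩
      (e a R.+ e a′) R.+ (e b R.* Π R.+ e b′ R.* Π) ≈⟨ R.+-congˡ (R.distribʳ Π _ _) ⟨
      (e a R.+ e a′) R.+ (e b R.+ e b′) R.* Π
        ≈⟨ R.+-cong (e.+-homo a a′) (R.*-congʳ (e.+-homo b b′)) ⟨
      combine (a A.+ a′) (b A.+ b′) ∎
      where open SetoidReasoning R.setoid

    combine-neg : ∀ a b → R.- combine a b R.≈ combine (A.- a) (A.- b)
    combine-neg a b = begin
      R.- (e a R.+ e b R.* Π)         ≈⟨ Rₚ.-‿+-comm _ _ ⟨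
      R.- e a R.+ R.- (e b R.* Π)     ≈⟨ R.+-congˡ (Rₚ.-‿distribˡ-* _ _) ⟩
      R.- e a R.+ R.- e b R.* Π       ≈⟨ R.+-cong (e.-‿homo a) (R.*-congʳ (e.-‿homo b)) ⟨
      combine (A.- a) (A.- b)         ∎
      where open SetoidReasoning R.setoid

    bΠc : ∀ b d → e b R.* Π R.* e d R.≈ e (b A.* σ d) R.* Π
    bΠc b d = begin
      e b R.* Π R.* e d       ≈⟨ R.*-assoc _ _ _ ⟩
      e b R.* (Π R.* e d)     ≈⟨ R.*-congˡ (Πa d) ⟩
      e b R.* (e (σ d) R.* Π) ≈⟨ R.*-assoc _ _ _ ⟨
      e b R.* e (σ d) R.* Π   ≈⟨ R.*-congʳ (e.*-homo b (σ d)) ⟨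
      e (b A.* σ d) R.* Π     ∎
      where open SetoidReasoning R.setoid

    aΠ² : ∀ a → e a R.* Π R.* Π R.≈ e (a A.* π)
    aΠ² a = R.trans (R.*-assoc _ _ _) (R.trans (R.*-congˡ Π²) (R.sym (e.*-homo a π)))

    combine-* : ∀ a b a′ b′ →
      combine a b R.* combine a′ b′ R.≈
      combine (a A.* a′ A.+ b A.* σ b′ A.* π) (a A.* b′ A.+ b A.* σ a′)
    combine-* a b a′ b′ = begin
      (e a R.+ e b R.* Π) R.* (e a′ R.+ e b′ R.* Π)
        ≈⟨ R.distribʳ _ _ _ ⟩
      e a R.* (e a′ R.+ e b′ R.* Π) R.+ e b R.* Π R.* (e a′ R.+ e b′ R.* Π)
        ≈⟨ R.+-cong (R.distribˡ _ _ _) (R.distribˡ _ _ _) ⟩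
      (e a R.* e a′ R.+ e a R.* (e b′ R.* Π)) R.+
        (e b R.* Π R.* e a′ R.+ e b R.* Π R.* (e b′ R.* Π))
        ≈⟨ R.+-cong
             (R.+-cong (R.sym (e.*-homo a a′))
                       (R.trans (R.sym (R.*-assoc _ _ _)) (R.*-congʳ (R.sym (e.*-homo a b′)))))
             (R.trans (R.+-comm _ _)
               (R.+-cong
                 (R.trans (R.sym (R.*-assoc _ _ _)) (R.trans (R.*-congʳ (bΠc b b′)) (aΠ² _)))
                 (bΠc b a′))) ⟩
      combine (a A.* a′) (a A.* b′) R.+ combine (b A.* σ b′ A.* π) (b A.* σ a′)
        ≈⟨ combine-+ _ _ _ _ ⟩
      combine (a A.* a′ A.+ b A.* σ b′ A.* π) (a A.* b′ A.+ b A.* σ a′) ∎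
      where open SetoidReasoning R.setoid

    combine-injective : ∀ {a b a′ b′} → combine a b R.≈ combine a′ b′ → a A.≈ a′ × b A.≈ b′
    combine-injective {a} {b} {a′} {b′} eq =
      let p , q = independent (a A.- a′) (b A.- b′) (begin
            combine (a A.- a′) (b A.- b′)                   ≈⟨ combine-+ _ _ _ _ ⟨
            combine a b R.+ combine (A.- a′) (A.- b′)       ≈⟨ R.+-cong eq (R.sym (combine-neg a′ b′)) ⟩
            combine a′ b′ R.- combine a′ b′                 ≈⟨ R.-‿inverseʳ _ ⟩
            R.0#                                            ∎)
      in Aₚ.x∙y⁻¹≈ε⇒x≈y a a′ p , Aₚ.x∙y⁻¹≈ε⇒x≈y b b′ q
      where open SetoidReasoning R.setoid

    coordinates : ∀ {α a b} → α R.≈ combine a b → fst α A.≈ a × snd α A.≈ b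
    coordinates {α} eq = combine-injective (R.trans (R.sym (split α)) eq)

    combine-a-0 : ∀ a → combine a A.0# R.≈ e a
    combine-a-0 a = R.trans
      (R.+-congˡ (R.trans (R.*-congʳ e.0#-homo) (R.zeroˡ Π))) (R.+-identityʳ (e a))

    e-injective : ∀ {a b} → e a R.≈ e b → a A.≈ b
    e-injective {a} {b} eq = proj₁ (combine-injective {b = A.0#} {b′ = A.0#}
      (R.trans (combine-a-0 a) (R.trans eq (R.sym (combine-a-0 b)))))

    σ-involutive : ∀ a → σ (σ a) A.≈ a
    σ-involutive a = π-cancel _ _ (e-injective (begin
      e (π A.* σ (σ a))          ≈⟨ e.⟦⟧-cong (A.*-comm _ _) ⟩
      e (σ (σ a) A.* π)          ≈⟨ aΠ² _ ⟨
      e (σ (σ a)) R.* Π R.* Π    ≈⟨ R.*-congʳ (Πa (σ a)) ⟨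
      Π R.* e (σ a) R.* Π        ≈⟨ R.*-assoc _ _ _ ⟩
      Π R.* (e (σ a) R.* Π)      ≈⟨ R.*-congˡ (Πa a) ⟨
      Π R.* (Π R.* e a)          ≈⟨ R.*-assoc _ _ _ ⟨
      Π R.* Π R.* e a            ≈⟨ R.*-congʳ Π² ⟩
      e π R.* e a                ≈⟨ e.*-homo π a ⟨
      e (π A.* a)                ∎))
      where open SetoidReasoning R.setoid

    conjugate : R.Carrier → R.Carrier
    conjugate α = combine (σ (fst α)) (σ (snd α))

    Π*conjugate : ∀ α → Π R.* conjugate α R.≈ α R.* Π
    Π*conjugate α = begin
      Π R.* (e (σ a) R.+ e (σ b) R.* Π)               ≈⟨ R.distribˡ _ _ _ ⟩
      Π R.* e (σ a) R.+ Π R.* (e (σ b) R.* Π)         ≈⟨ R.+-congˡ (R.*-assoc _ _ _) ⟨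
      Π R.* e (σ a) R.+ Π R.* e (σ b) R.* Π           ≈⟨ R.+-cong (step a) (R.*-congʳ (step b)) ⟩
      e a R.* Π R.+ e b R.* Π R.* Π                   ≈⟨ R.distribʳ _ _ _ ⟨
      combine a b R.* Π                               ≈⟨ R.*-congʳ (split α) ⟨
      α R.* Π                                         ∎
      where
      open SetoidReasoning R.setoid
      a = fst α
      b = snd α
      step : ∀ x → Π R.* e (σ x) R.≈ e x R.* Π
      step x = R.trans (Πa (σ x)) (R.*-congʳ (e.⟦⟧-cong (σ-involutive x)))

    module Block (ρ ρ′ : A.Carrier → A.Carrier)
      (ρ-hom : IsRingHomomorphism A.rawRing A.rawRing ρ)
      (ρ′-hom : IsRingHomomorphism A.rawRing A.rawRing ρ′)
      (ρσ : ∀ a → ρ (σ a) A.≈ ρ′ a) (ρ′σ : ∀ a → ρ′ (σ a) A.≈ ρ a)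
      (ρπ : ρ π A.≈ π) (ρ′π : ρ′ π A.≈ π) where
      private
        module ρ = IsRingHomomorphism ρ-hom
        module ρ′ = IsRingHomomorphism ρ′-hom
        open RawRing (M.matrixRawRing 2) using (_+_; _*_)

      -- the map with a ↦ diag(ρ a, ρ′ a) for a ∈ A, and Π ↦ [0 π; 1 0]
      block : R.Carrier → M.Matrix 2
      block α = diag (fst α) + diag (snd α) * M.matrix₂ A.0# π A.1# A.0#
        where
        diag : A.Carrier → M.Matrix 2
        diag a = M.matrix₂ (ρ a) A.0# A.0# (ρ′ a)

      open Solver A.commutativeSemiring using (solve; _:+_; _:*_; con; _:=_)

      entries : A.Carrier → A.Carrier → M.Matrix 2
      entries a b = M.matrix₂ (ρ a) (ρ b A.* π) (ρ′ b) (ρ′ a)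

      block≈ : ∀ {α a b} → α R.≈ combine a b → ∀ i k → block α i k A.≈ entries a b i k
      block≈ {α} {a} {b} eq i k = A.trans (computed i k) (entries-cong i k)
        where
        x = ρ (fst α)
        y = ρ (snd α)
        x′ = ρ′ (fst α)
        y′ = ρ′ (snd α)
        computed : ∀ i k → block α i k A.≈ entries (fst α) (snd α) i k
        computed 0F 0F = solve 2 (λ x y → x :+ (y :* con 0 :+ (con 0 :* con 1 :+ con 0)) := x) A.refl x y
        computed 0F 1F = solve 2 (λ y π → con 0 :+ (y :* π :+ (con 0 :* con 0 :+ con 0)) := y :* π) A.refl y π
        computed 1F 0F = solve 1 (λ y′ → con 0 :+ (con 0 :* con 0 :+ (y′ :* con 1 :+ con 0)) := y′) A.refl y′
        computed 1F 1F = solve 3 (λ x′ y′ π → x′ :+ (con 0 :* π :+ (y′ :* con 0 :+ con 0)) := x′) A.refl x′ y′ π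
        coords = coordinates eq
        entries-cong : ∀ i k → entries (fst α) (snd α) i k A.≈ entries a b i k
        entries-cong 0F 0F = ρ.⟦⟧-cong (proj₁ coords)
        entries-cong 0F 1F = A.*-congʳ (ρ.⟦⟧-cong (proj₂ coords))
        entries-cong 1F 0F = ρ′.⟦⟧-cong (proj₂ coords)
        entries-cong 1F 1F = ρ′.⟦⟧-cong (proj₁ coords)

      block-+ : ∀ α β i k → block (α R.+ β) i k A.≈ block α i k A.+ block β i k
      block-+ α β i k = A.trans
        (block≈ (R.trans (R.+-cong (split α) (split β)) (combine-+ _ _ _ _)) i k)
        (A.trans (hom i k) (A.sym (A.+-cong (block≈ (split α) i k) (block≈ (split β) i k))))
        where
        hom : ∀ i k → entries (fst α A.+ fst β) (snd α A.+ snd β) i k A.≈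
                      entries (fst α) (snd α) i k A.+ entries (fst β) (snd β) i k
        hom 0F 0F = ρ.+-homo _ _
        hom 0F 1F = A.trans (A.*-congʳ (ρ.+-homo _ _)) (A.distribʳ _ _ _)
        hom 1F 0F = ρ′.+-homo _ _
        hom 1F 1F = ρ′.+-homo _ _

      block-neg : ∀ α i k → block (R.- α) i k A.≈ A.- block α i k
      block-neg α i k = A.trans
        (block≈ (R.trans (R.-‿cong (split α)) (combine-neg _ _)) i k)
        (A.trans (hom i k) (A.sym (A.-‿cong (block≈ (split α) i k))))
        where
        hom : ∀ i k → entries (A.- fst α) (A.- snd α) i k A.≈ A.- entries (fst α) (snd α) i k
        hom 0F 0F = ρ.-‿homo _
        hom 0F 1F = A.trans (A.*-congʳ (ρ.-‿homo _)) (A.sym (Aₚ.-‿distribˡ-* _ _))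
        hom 1F 0F = ρ′.-‿homo _
        hom 1F 1F = ρ′.-‿homo _

      block-0 : ∀ i k → block R.0# i k A.≈ A.0#
      block-0 i k = A.trans
        (block≈ (R.sym (R.trans (combine-a-0 A.0#) e.0#-homo)) i k) (zeros i k)
        where
        zeros : ∀ i k → entries A.0# A.0# i k A.≈ A.0#
        zeros 0F 0F = ρ.0#-homo
        zeros 0F 1F = A.trans (A.*-congʳ ρ.0#-homo) (A.zeroˡ π)
        zeros 1F 0F = ρ′.0#-homo
        zeros 1F 1F = ρ′.0#-homo

      block-1 : ∀ i k → block R.1# i k A.≈ M.scalar A.1# i k
      block-1 i k = A.trans
        (block≈ (R.sym (R.trans (combine-a-0 A.1#) e.1#-homo)) i k) (ones i k)
        where
        ones : ∀ i k → entries A.1# A.0# i k A.≈ M.scalar A.1# i k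
        ones 0F 0F = ρ.1#-homo
        ones 0F 1F = A.trans (A.*-congʳ ρ.0#-homo) (A.zeroˡ π)
        ones 1F 0F = ρ′.0#-homo
        ones 1F 1F = ρ′.1#-homo

      block-* : ∀ α β i k → block (α R.* β) i k A.≈ (block α * block β) i k
      block-* α β i k = A.trans
        (block≈ (R.trans (R.*-cong (split α) (split β)) (combine-* _ _ _ _)) i k)
        (A.trans (hom i k)
          (A.sym (A.+-cong (A.*-cong (block≈ (split α) i 0F) (block≈ (split β) 0F k))
                 (A.+-congʳ (A.*-cong (block≈ (split α) i 1F) (block≈ (split β) 1F k))))))
        where
        a = fst α
        b = snd α
        a′ = fst β
        b′ = snd β
        fst-* : ∀ χ χ′ → IsRingHomomorphism A.rawRing A.rawRing χ →
                (∀ a → χ (σ a) A.≈ χ′ a) → χ π A.≈ π →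
                χ (a A.* a′ A.+ b A.* σ b′ A.* π) A.≈ χ a A.* χ a′ A.+ χ b A.* χ′ b′ A.* π
        fst-* χ χ′ χ-hom χσ χπ = A.trans (χ.+-homo _ _) (A.+-cong (χ.*-homo _ _)
          (A.trans (χ.*-homo _ _) (A.*-cong (A.trans (χ.*-homo _ _) (A.*-congˡ (χσ b′))) χπ)))
          where
          module χ = IsRingHomomorphism χ-hom
        snd-* : ∀ χ χ′ → IsRingHomomorphism A.rawRing A.rawRing χ →
                (∀ a → χ (σ a) A.≈ χ′ a) →
                χ (a A.* b′ A.+ b A.* σ a′) A.≈ χ a A.* χ b′ A.+ χ b A.* χ′ a′
        snd-* χ χ′ χ-hom χσ = A.trans (χ.+-homo _ _)
          (A.+-cong (χ.*-homo _ _) (A.trans (χ.*-homo _ _) (A.*-congˡ (χσ a′))))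
          where
          module χ = IsRingHomomorphism χ-hom
        hom : ∀ i k →
              entries (a A.* a′ A.+ b A.* σ b′ A.* π) (a A.* b′ A.+ b A.* σ a′) i k A.≈
              (entries a b * entries a′ b′) i k
        hom 0F 0F = A.trans (fst-* ρ ρ′ ρ-hom ρσ ρπ)
          (solve 5 (λ x x′ y y′ π → x :* x′ :+ y :* y′ :* π := x :* x′ :+ (y :* π :* y′ :+ con 0))
            A.refl (ρ a) (ρ a′) (ρ b) (ρ′ b′) π)
        hom 0F 1F = A.trans (A.*-congʳ (snd-* ρ ρ′ ρ-hom ρσ))
          (solve 5 (λ x x′ y y′ π → (x :* y′ :+ y :* x′) :* π := x :* (y′ :* π) :+ (y :* π :* x′ :+ con 0))
            A.refl (ρ a) (ρ′ a′) (ρ b) (ρ b′) π)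
        hom 1F 0F = A.trans (snd-* ρ′ ρ ρ′-hom ρ′σ)
          (solve 4 (λ x x′ y y′ → x :* y′ :+ y :* x′ := y :* x′ :+ (x :* y′ :+ con 0))
            A.refl (ρ′ a) (ρ a′) (ρ′ b) (ρ′ b′))
        hom 1F 1F = A.trans (fst-* ρ′ ρ ρ′-hom ρ′σ ρ′π)
          (solve 5 (λ x x′ y y′ π → x :* x′ :+ y :* y′ :* π := y :* (y′ :* π) :+ (x :* x′ :+ con 0))
            A.refl (ρ′ a) (ρ′ a′) (ρ′ b) (ρ b′) π)

      block-isRingHomomorphism : IsRingHomomorphism R.rawRing (M.matrixRawRing 2) block
      block-isRingHomomorphism = record
        { isSemiringHomomorphism = record
          { isNearSemiringHomomorphism = record
            { +-isMonoidHomomorphism = record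
              { isMagmaHomomorphism = record
                { isRelHomomorphism = record
                  { cong = λ {_} {β} eq i k →
                      A.trans (block≈ (R.trans eq (split β)) i k) (A.sym (block≈ (split β) i k)) }
                ; homo = block-+
                }
              ; ε-homo = block-0
              }
            ; *-homo = block-*
            }
          ; 1#-homo = block-1
          }
        ; -‿homo = block-neg
        }

record ℕ⁴ : Set where
  constructor ⟨_,_,_,_⟩
  field
    r₁ r₂ t₁ t₂ : ℕ

module Bilattices
  {F : LocalField ℓ} {B : QuaternionDivisionAlgebra F}
  {O_B : Pred (QuaternionDivisionAlgebra.Carrier B) ℓ} (O_B-maximal : IsMaximalOrder B O_B)
  {K : UnramifiedQuadraticExtension F} (pres : Presentation B O_B K) where

  private
    module F = LocalField F
    module B = QuaternionDivisionAlgebra B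
    module K = UnramifiedQuadraticExtension K
    module P = Presentation pres
    module order = IsOrder (proj₁ O_B-maximal)
    module O_B = IsSubring order.isSubring
    module O_K = IsSubring (O-isSubring K.localField)
    module ι = IsRingHomomorphism B.ι-isRingHomomorphism
    module ιᴷ = IsRingHomomorphism K.ι-isRingHomomorphism
    module j = IsRingMonomorphism P.j-isRingMonomorphism
    module σ = IsRingIsomorphism K.σ-isRingIsomorphism

  𝒪B : Ring ℓ ℓ
  𝒪B = subring order.isSubring

  𝒪K : CommutativeRing ℓ ℓ
  𝒪K = integers K.localField

  private
    module 𝒪B = Ring 𝒪B
    module 𝒪K = CommutativeRing 𝒪K
    open Matrices 𝒪B using (Matrix; matrixRawRing; scalar; blockDiagonal)

  fromF : ∀ a → a ∈ F.O → 𝒪B.Carrier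
  fromF a a∈O = B.ι a , order.O⊆R a a∈O

  fromK : 𝒪K.Carrier → 𝒪B.Carrier
  fromK (a , a∈O) = P.j a , P.O_K⊆O_B a a∈O

  Π : 𝒪B.Carrier
  Π = P.Π , P.Π∈O_B

  πᴷ : 𝒪K.Carrier
  πᴷ = K.ι P.π ,
    ≡.subst ([ + 0 ] ≤⁺_) (≡.sym (≡.trans (K.v-ι P.π) P.π-uniformizer)) [ ℤ.+≤+ ℕ.z≤n ]

  fromK-isRingHomomorphism : IsRingHomomorphism 𝒪K.rawRing 𝒪B.rawRing fromK
  fromK-isRingHomomorphism = record
    { isSemiringHomomorphism = record
      { isNearSemiringHomomorphism = record
        { +-isMonoidHomomorphism = record
          { isMagmaHomomorphism = record
            { isRelHomomorphism = record { cong = j.⟦⟧-cong }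
            ; homo = λ _ _ → j.+-homo _ _
            }
          ; ε-homo = j.0#-homo
          }
        ; *-homo = λ _ _ → j.*-homo _ _
        }
      ; 1#-homo = j.1#-homo
      }
    ; -‿homo = λ _ → j.-‿homo _
    }

  π≉0 : ¬ P.π F.≈ F.0#
  π≉0 π≈0 with () ← ≡.trans (≡.sym P.π-uniformizer) (≡.trans (F.v-cong π≈0) F.v-0)

  Π≉0 : ¬ P.Π B.≈ B.0#
  Π≉0 Π≈0 = let y , πy≈1 = F.inverse P.π π≉0 in B.1≉0 (begin
    B.1#                ≈⟨ ι.1#-homo ⟨
    B.ι F.1#            ≈⟨ ι.⟦⟧-cong πy≈1 ⟨
    B.ι (P.π F.* y)     ≈⟨ ι.*-homo _ _ ⟩
    B.ι P.π B.* B.ι y   ≈⟨ B.*-congʳ P.Π²≈π ⟨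
    P.Π B.* P.Π B.* B.ι y ≈⟨ B.*-congʳ (B.*-congʳ Π≈0) ⟩
    B.0# B.* P.Π B.* B.ι y ≈⟨ B.*-congʳ (B.zeroˡ _) ⟩
    B.0# B.* B.ι y      ≈⟨ B.zeroˡ _ ⟩
    B.0#                ∎)
    where open SetoidReasoning B.setoid

  π-cancel : ∀ a b → K.ι P.π K.* a K.≈ K.ι P.π K.* b → a K.≈ b
  π-cancel a b eq = begin
    a                                   ≈⟨ lemma a ⟨
    K.ι y K.* (K.ι P.π K.* a)           ≈⟨ K.*-congˡ eq ⟩
    K.ι y K.* (K.ι P.π K.* b)           ≈⟨ lemma b ⟩
    b                                   ∎
    where
    open SetoidReasoning K.setoid
    y = proj₁ (F.inverse P.π π≉0)
    lemma : ∀ x → K.ι y K.* (K.ι P.π K.* x) K.≈ x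
    lemma x = begin
      K.ι y K.* (K.ι P.π K.* x)   ≈⟨ K.*-assoc _ _ _ ⟨
      K.ι y K.* K.ι P.π K.* x     ≈⟨ K.*-congʳ (ιᴷ.*-homo _ _) ⟨
      K.ι (y F.* P.π) K.* x       ≈⟨ K.*-congʳ (ιᴷ.⟦⟧-cong (F.trans (F.*-comm _ _) (proj₂ (F.inverse P.π π≉0)))) ⟩
      K.ι F.1# K.* x              ≈⟨ K.*-congʳ ιᴷ.1#-homo ⟩
      K.1# K.* x                  ≈⟨ K.*-identityˡ x ⟩
      x                           ∎

  σ∈O : ∀ a → a ∈ K.O → K.σ a ∈ K.O
  σ∈O a a∈O with ≤⁺-dec ℤₚ._≤?_ [ + 0 ] (K.v (K.σ a))
  ... | yes σa∈O = σa∈O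
  ... | no  σa∉O = O_K.resp d≈σa d∈O
    where
    decomposition = P.spanning (P.Π B.* P.j a) (O_B.*∈ P.Π∈O_B (P.O_K⊆O_B a a∈O))
    c₁ = proj₁ decomposition
    d₁ = proj₁ (proj₂ decomposition)
    c∈O = proj₁ (proj₂ (proj₂ decomposition))
    d∈O = proj₁ (proj₂ (proj₂ (proj₂ decomposition)))
    eq = proj₂ (proj₂ (proj₂ (proj₂ decomposition)))
    y,σa*y≈1 = K.inverse (K.σ a) (λ σa≈0 → σa∉O (O_K.resp (K.sym σa≈0) O_K.0∈))
    y = proj₁ y,σa*y≈1
    σa*y≈1 = proj₂ y,σa*y≈1
    y∈O = inverse-in-O K.localField (K.σ a) y σa*y≈1 σa∉O
    open RingProperties B.ring using (-‿distribˡ-*)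
    open RingProperties K.ring using (x∙y⁻¹≈ε⇒x≈y)
    expand : P.Π B.≈ P.j (y K.* c₁) B.+ P.j (y K.* d₁) B.* P.Π
    expand = begin
      P.Π                                        ≈⟨ B.*-identityˡ _ ⟨
      B.1# B.* P.Π                               ≈⟨ B.*-congʳ j.1#-homo ⟨
      P.j K.1# B.* P.Π                           ≈⟨ B.*-congʳ (j.⟦⟧-cong (K.trans (K.*-comm _ _) σa*y≈1)) ⟨
      P.j (y K.* K.σ a) B.* P.Π                  ≈⟨ B.*-congʳ (j.*-homo _ _) ⟩
      P.j y B.* P.j (K.σ a) B.* P.Π              ≈⟨ B.*-assoc _ _ _ ⟩
      P.j y B.* (P.j (K.σ a) B.* P.Π)            ≈⟨ B.*-congˡ (P.Πa≈σaΠ a a∈O) ⟨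
      P.j y B.* (P.Π B.* P.j a)                  ≈⟨ B.*-congˡ eq ⟩
      P.j y B.* (P.j c₁ B.+ P.j d₁ B.* P.Π)      ≈⟨ B.distribˡ _ _ _ ⟩
      P.j y B.* P.j c₁ B.+ P.j y B.* (P.j d₁ B.* P.Π) ≈⟨ B.+-congˡ (B.*-assoc _ _ _) ⟨
      P.j y B.* P.j c₁ B.+ P.j y B.* P.j d₁ B.* P.Π
        ≈⟨ B.+-cong (j.*-homo _ _) (B.*-congʳ (j.*-homo _ _)) ⟨
      P.j (y K.* c₁) B.+ P.j (y K.* d₁) B.* P.Π  ∎
      where open SetoidReasoning B.setoid
    vanish : P.j (y K.* c₁) B.+ P.j (y K.* d₁ K.- K.1#) B.* P.Π B.≈ B.0#
    vanish = begin
      P.j (y K.* c₁) B.+ P.j (y K.* d₁ K.- K.1#) B.* P.Π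
        ≈⟨ B.+-congˡ (B.*-congʳ (B.trans (j.+-homo _ _)
             (B.+-congˡ (B.trans (j.-‿homo _) (B.-‿cong j.1#-homo))))) ⟩
      P.j (y K.* c₁) B.+ (P.j (y K.* d₁) B.- B.1#) B.* P.Π
        ≈⟨ B.+-congˡ (B.trans (B.distribʳ _ _ _) (B.+-congˡ
             (B.trans (B.sym (-‿distribˡ-* _ _)) (B.-‿cong (B.*-identityˡ _))))) ⟩
      P.j (y K.* c₁) B.+ (P.j (y K.* d₁) B.* P.Π B.- P.Π)  ≈⟨ B.+-assoc _ _ _ ⟨
      P.j (y K.* c₁) B.+ P.j (y K.* d₁) B.* P.Π B.- P.Π    ≈⟨ B.+-congʳ expand ⟨
      P.Π B.- P.Π                                          ≈⟨ B.-‿inverseʳ _ ⟩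
      B.0#                                                 ∎
      where open SetoidReasoning B.setoid
    yd≈1 : y K.* d₁ K.≈ K.1#
    yd≈1 = x∙y⁻¹≈ε⇒x≈y _ _ (proj₂ (P.independent _ _
      (O_K.*∈ y∈O c∈O) (O_K.+∈ (O_K.*∈ y∈O d∈O) (O_K.-∈ O_K.1∈)) vanish))
    d≈σa : d₁ K.≈ K.σ a
    d≈σa = begin
      d₁                      ≈⟨ K.*-identityˡ _ ⟨
      K.1# K.* d₁             ≈⟨ K.*-congʳ σa*y≈1 ⟨
      K.σ a K.* y K.* d₁      ≈⟨ K.*-assoc _ _ _ ⟩
      K.σ a K.* (y K.* d₁)    ≈⟨ K.*-congˡ yd≈1 ⟩
      K.σ a K.* K.1#          ≈⟨ K.*-identityʳ _ ⟩
      K.σ a                   ∎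
      where open SetoidReasoning K.setoid

  σᴷ : 𝒪K.Carrier → 𝒪K.Carrier
  σᴷ (a , a∈O) = K.σ a , σ∈O a a∈O

  σᴷ-isRingHomomorphism : IsRingHomomorphism 𝒪K.rawRing 𝒪K.rawRing σᴷ
  σᴷ-isRingHomomorphism = record
    { isSemiringHomomorphism = record
      { isNearSemiringHomomorphism = record
        { +-isMonoidHomomorphism = record
          { isMagmaHomomorphism = record
            { isRelHomomorphism = record { cong = σ.⟦⟧-cong }
            ; homo = λ _ _ → σ.+-homo _ _
            }
          ; ε-homo = σ.0#-homo
          }
        ; *-homo = λ _ _ → σ.*-homo _ _
        }
      ; 1#-homo = σ.1#-homo
      }
    ; -‿homo = λ _ → σ.-‿homo _
    }

  spanning : ∀ α → ∃[ a ] ∃[ b ] α 𝒪B.≈ fromK a 𝒪B.+ fromK b 𝒪B.* Π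
  spanning (x , x∈) = let a , b , a∈ , b∈ , eq = P.spanning x x∈ in (a , a∈) , (b , b∈) , eq

  independent : ∀ a b → fromK a 𝒪B.+ fromK b 𝒪B.* Π 𝒪B.≈ 𝒪B.0# →
                a 𝒪K.≈ 𝒪K.0# × b 𝒪K.≈ 𝒪K.0#
  independent (a , a∈) (b , b∈) = P.independent a b a∈ b∈

  Πa≈σaΠ : ∀ a → Π 𝒪B.* fromK a 𝒪B.≈ fromK (σᴷ a) 𝒪B.* Π
  Πa≈σaΠ (a , a∈) = P.Πa≈σaΠ a a∈

  module Cyclic = CyclicRing 𝒪K 𝒪B fromK-isRingHomomorphism σᴷ-isRingHomomorphism πᴷ Π
    spanning independent (B.trans P.Π²≈π (B.sym (P.j-ι P.π))) Πa≈σaΠ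
    (λ (a , _) (b , _) → π-cancel a b)

  id-𝒪K : IsRingHomomorphism 𝒪K.rawRing 𝒪K.rawRing (λ a → a)
  id-𝒪K = Identity.isRingHomomorphism 𝒪K.rawRing (λ {x} → 𝒪K.refl {x})

  module Block₁ = Cyclic.Block (λ a → a) σᴷ id-𝒪K σᴷ-isRingHomomorphism
    (λ _ → K.refl) Cyclic.σ-involutive K.refl (K.σ-ι P.π)
  module Block₂ = Cyclic.Block σᴷ (λ a → a) σᴷ-isRingHomomorphism id-𝒪K
    Cyclic.σ-involutive (λ _ → K.refl) (K.σ-ι P.π) K.refl
  open MatrixMap 𝒪K.ring 𝒪B fromK-isRingHomomorphism

  Representation : ℕ → Set ℓ
  Representation n = 𝒪B.Carrier → Matrix n

  IsRepresentation : ∀ {n} → Representation n → Set ℓ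
  IsRepresentation {n} = IsRingHomomorphism 𝒪B.rawRing (matrixRawRing n)

  record IsEmbedding {n} (φ : Representation n) : Set ℓ where
    field
      isRingMonomorphism : IsRingMonomorphism 𝒪B.rawRing (matrixRawRing n) φ
      O_F-linear         : ∀ a (a∈O : a ∈ F.O) i k →
                           φ (fromF a a∈O) i k 𝒪B.≈ scalar (fromF a a∈O) i k

  φ₁ φ₂ : Representation 2
  φ₁ = mapMatrix ∘ Block₁.block
  φ₂ = mapMatrix ∘ Block₂.block

  Π⁻¹ : B.Carrier
  Π⁻¹ = proj₁ (B.division P.Π Π≉0)

  Π⁻¹Π≈1 : Π⁻¹ B.* P.Π B.≈ B.1#
  Π⁻¹Π≈1 = proj₂ (proj₂ (B.division P.Π Π≉0))

  ΠΠ⁻¹≈1 : P.Π B.* Π⁻¹ B.≈ B.1#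
  ΠΠ⁻¹≈1 = proj₁ (proj₂ (B.division P.Π Π≉0))

  τ∈O_B : ∀ (α : 𝒪B.Carrier) → Π⁻¹ B.* proj₁ α B.* P.Π ∈ O_B
  τ∈O_B α = O_B.resp (begin
    proj₁ β                         ≈⟨ B.*-identityˡ _ ⟨
    B.1# B.* proj₁ β                ≈⟨ B.*-congʳ Π⁻¹Π≈1 ⟨
    Π⁻¹ B.* P.Π B.* proj₁ β         ≈⟨ B.*-assoc _ _ _ ⟩
    Π⁻¹ B.* (P.Π B.* proj₁ β)       ≈⟨ B.*-congˡ (Cyclic.Π*conjugate α) ⟩
    Π⁻¹ B.* (proj₁ α B.* P.Π)       ≈⟨ B.*-assoc _ _ _ ⟨
    Π⁻¹ B.* proj₁ α B.* P.Π         ∎) (proj₂ β)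
    where
    open SetoidReasoning B.setoid
    β = Cyclic.conjugate α

  τ : 𝒪B.Carrier → 𝒪B.Carrier
  τ α = Π⁻¹ B.* proj₁ α B.* P.Π , τ∈O_B α

  τ-isRingHomomorphism : IsRingHomomorphism 𝒪B.rawRing 𝒪B.rawRing τ
  τ-isRingHomomorphism = record
    { isSemiringHomomorphism = record
      { isNearSemiringHomomorphism = record
        { +-isMonoidHomomorphism = record
          { isMagmaHomomorphism = record
            { isRelHomomorphism = record { cong = λ eq → B.*-congʳ (B.*-congˡ eq) }
            ; homo = λ _ _ → B.trans (B.*-congʳ (B.distribˡ _ _ _)) (B.distribʳ _ _ _)
            }
          ; ε-homo = B.trans (B.*-congʳ (B.zeroʳ _)) (B.zeroˡ _)
          }
        ; *-homo = λ (x , _) (y , _) → mult x y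
        }
      ; 1#-homo = B.trans (B.*-congʳ (B.*-identityʳ _)) Π⁻¹Π≈1
      }
    ; -‿homo = λ _ → B.trans (B.*-congʳ (B.sym (-‿distribʳ-* _ _))) (B.sym (-‿distribˡ-* _ _))
    }
    where
    open SetoidReasoning B.setoid
    open RingProperties B.ring using (-‿distribˡ-*; -‿distribʳ-*)
    mult : ∀ x y → Π⁻¹ B.* (x B.* y) B.* P.Π B.≈
                   Π⁻¹ B.* x B.* P.Π B.* (Π⁻¹ B.* y B.* P.Π)
    mult x y = begin
      Π⁻¹ B.* (x B.* y) B.* P.Π                          ≈⟨ B.*-congʳ (B.*-assoc _ _ _) ⟨
      Π⁻¹ B.* x B.* y B.* P.Π                            ≈⟨ B.*-congʳ (B.*-congʳ (B.*-identityʳ _)) ⟨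
      Π⁻¹ B.* x B.* B.1# B.* y B.* P.Π                   ≈⟨ B.*-congʳ (B.*-congʳ (B.*-congˡ ΠΠ⁻¹≈1)) ⟨
      Π⁻¹ B.* x B.* (P.Π B.* Π⁻¹) B.* y B.* P.Π          ≈⟨ B.*-congʳ (B.*-congʳ (B.*-assoc _ _ _)) ⟨
      Π⁻¹ B.* x B.* P.Π B.* Π⁻¹ B.* y B.* P.Π            ≈⟨ B.*-congʳ (B.*-assoc _ _ _) ⟩
      Π⁻¹ B.* x B.* P.Π B.* (Π⁻¹ B.* y) B.* P.Π          ≈⟨ B.*-assoc _ _ _ ⟩
      Π⁻¹ B.* x B.* P.Π B.* (Π⁻¹ B.* y B.* P.Π)          ∎

  scalar₁-isRingHomomorphism : IsRingHomomorphism 𝒪B.rawRing (matrixRawRing 1) (λ α → scalar α)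
  scalar₁-isRingHomomorphism = record
    { isSemiringHomomorphism = record
      { isNearSemiringHomomorphism = record
        { +-isMonoidHomomorphism = record
          { isMagmaHomomorphism = record
            { isRelHomomorphism = record { cong = λ { eq 0F 0F → eq } }
            ; homo = λ { _ _ 0F 0F → B.refl }
            }
          ; ε-homo = λ { 0F 0F → B.refl }
          }
        ; *-homo = λ { _ _ 0F 0F → B.sym (B.+-identityʳ _) }
        }
      ; 1#-homo = λ { 0F 0F → B.refl }
      }
    ; -‿homo = λ { _ 0F 0F → B.refl }
    }

  idᴿ τᴿ : Representation 1
  idᴿ α = scalar α
  τᴿ  α = scalar (τ α)

  idᴿ-isRepresentation : IsRepresentation idᴿ
  idᴿ-isRepresentation = scalar₁-isRingHomomorphism

  τᴿ-isRepresentation : IsRepresentation τᴿ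
  τᴿ-isRepresentation = Composition.isRingHomomorphism
    (λ eq eq′ i k → B.trans (eq i k) (eq′ i k)) τ-isRingHomomorphism scalar₁-isRingHomomorphism

  φ₁-isRepresentation : IsRepresentation φ₁
  φ₁-isRepresentation = Composition.isRingHomomorphism
    (λ eq eq′ i k → B.trans (eq i k) (eq′ i k))
    Block₁.block-isRingHomomorphism (mapMatrix-isRingHomomorphism 2)

  φ₂-isRepresentation : IsRepresentation φ₂
  φ₂-isRepresentation = Composition.isRingHomomorphism
    (λ eq eq′ i k → B.trans (eq i k) (eq′ i k))
    Block₂.block-isRingHomomorphism (mapMatrix-isRingHomomorphism 2)

  infixr 6 _⊕ᴿ_
  infixr 7 _⊕^ᴿ_

  _⊕ᴿ_ : ∀ {m n} → Representation m → Representation n → Representation (m ℕ.+ n)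
  (φ ⊕ᴿ ψ) α = blockDiagonal (φ α) (ψ α)

  _⊕^ᴿ_ : ∀ {n} → Representation n → (r : ℕ) → Representation (r ℕ.* n)
  φ ⊕^ᴿ zero  = λ _ ()
  φ ⊕^ᴿ suc r = φ ⊕ᴿ (φ ⊕^ᴿ r)

  size : ℕ⁴ → ℕ
  size ⟨ r₁ , r₂ , t₁ , t₂ ⟩ = r₁ ℕ.* 1 ℕ.+ (r₂ ℕ.* 1 ℕ.+ (t₁ ℕ.* 2 ℕ.+ t₂ ℕ.* 2))

  standard : ∀ q → Representation (size q)
  standard ⟨ r₁ , r₂ , t₁ , t₂ ⟩ = idᴿ ⊕^ᴿ r₁ ⊕ᴿ τᴿ ⊕^ᴿ r₂ ⊕ᴿ φ₁ ⊕^ᴿ t₁ ⊕ᴿ φ₂ ⊕^ᴿ t₂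

  IsConjugate : ∀ {n} → Representation n → Representation n → Set ℓ
  IsConjugate {n} φ ψ = ∃[ g ] ∃[ h ]
    (g * h ≈ 1# × h * g ≈ 1# × (∀ α → g * φ α * h ≈ ψ α))
    where open RawRing (matrixRawRing n)

  infix 4 _∼_

  _∼_ : ∀ {m n} → Representation m → Representation n → Set ℓ
  _∼_ {m} {n} φ ψ = Σ[ n≡m ∈ n ≡ m ] IsConjugate φ (≡.subst Representation n≡m ψ)

  𝒪B-Bimodule : Set (lsuc ℓ)
  𝒪B-Bimodule = Bimodule 𝒪B 𝒪B ℓ ℓ

  module _ (L : 𝒪B-Bimodule) where
    open Bimodule L

    data Generated {n} (g : Fin n → Carrierᴹ) : Carrierᴹ → Set ℓ where
      gen   : ∀ i → Generated g (g i)
      resp  : ∀ {x y} → x ≈ᴹ y → Generated g x → Generated g y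
      zero  : Generated g 0ᴹ
      add   : ∀ {x y} → Generated g x → Generated g y → Generated g (x +ᴹ y)
      left  : ∀ α {x} → Generated g x → Generated g (α *ₗ x)
      right : ∀ α {x} → Generated g x → Generated g (x *ᵣ α)

    record IsBilattice : Set ℓ where
      field
        finitelyGenerated : ∃[ n ] Σ[ g ∈ (Fin n → Carrierᴹ) ] (∀ x → Generated g x)
        torsionFree       : ∀ a (a∈O : a ∈ F.O) x → ¬ a F.≈ F.0# →
                            fromF a a∈O *ₗ x ≈ᴹ 0ᴹ → x ≈ᴹ 0ᴹ
        actionsAgree      : ∀ a (a∈O : a ∈ F.O) x → fromF a a∈O *ₗ x ≈ᴹ x *ᵣ fromF a a∈O

    IsZero : Set ℓ
    IsZero = ∀ x → x ≈ᴹ 0ᴹ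

  infix 4 _≅_

  _≅_ : 𝒪B-Bimodule → 𝒪B-Bimodule → Set ℓ
  L ≅ M = ∃ (IsBimoduleIsomorphism (Bimodule.rawBimodule L) (Bimodule.rawBimodule M))

  infixr 6 _⊕_
  infixr 7 _⊕^_

  _⊕_ : 𝒪B-Bimodule → 𝒪B-Bimodule → 𝒪B-Bimodule
  _⊕_ = DirectProduct.bimodule

  _⊕^_ : 𝒪B-Bimodule → ℕ → 𝒪B-Bimodule
  L ⊕^ zero  = Zero.bimodule
  L ⊕^ suc r = L ⊕ L ⊕^ r

  IsIndecomposable : 𝒪B-Bimodule → Set (lsuc ℓ)
  IsIndecomposable L = ¬ IsZero L × (∀ M N → L ≅ M ⊕ N → IsZero M ⊎ IsZero N)

  𝕆 ℙ 𝕃₁ 𝕃₂ : 𝒪B-Bimodule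
  𝕆  = Columns.columns 𝒪B idᴿ idᴿ-isRepresentation
  ℙ  = Columns.columns 𝒪B τᴿ τᴿ-isRepresentation
  𝕃₁ = Columns.columns 𝒪B φ₁ φ₁-isRepresentation
  𝕃₂ = Columns.columns 𝒪B φ₂ φ₂-isRepresentation

  𝒪B-natural : 𝒪B-Bimodule
  𝒪B-natural = TensorUnit.bimodule

  𝔓-raw : RawBimodule 𝒪B.Carrier 𝒪B.Carrier ℓ ℓ
  𝔓-raw = record
    { Carrierᴹ = ∃[ x ] ∃[ y ] x 𝒪B.≈ Π 𝒪B.* y
    ; _≈ᴹ_ = λ x y → proj₁ x 𝒪B.≈ proj₁ y
    ; _+ᴹ_ = λ (x , x′ , eq) (y , y′ , eq′) →
        x 𝒪B.+ y , x′ 𝒪B.+ y′ , B.trans (B.+-cong eq eq′) (B.sym (B.distribˡ _ _ _))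
    ; _*ₗ_ = λ α (x , x′ , eq) →
        α 𝒪B.* x , Cyclic.conjugate α 𝒪B.* x′ ,
        B.trans (B.*-congˡ eq) (B.trans (B.sym (B.*-assoc _ _ _))
          (B.trans (B.*-congʳ (B.sym (Cyclic.Π*conjugate α))) (B.*-assoc _ _ _)))
    ; _*ᵣ_ = λ (x , x′ , eq) α →
        x 𝒪B.* α , x′ 𝒪B.* α , B.trans (B.*-congʳ eq) (B.*-assoc _ _ _)
    ; 0ᴹ = 𝒪B.0# , 𝒪B.0# , B.sym (B.zeroʳ _)
    ; -ᴹ_ = λ (x , x′ , eq) →
        𝒪B.- x , 𝒪B.- x′ , B.trans (B.-‿cong eq) (RingProperties.-‿distribʳ-* B.ring _ _)
    }

  𝔓-inclusion : IsBimoduleMonomorphism 𝔓-raw (Bimodule.rawBimodule 𝒪B-natural) proj₁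
  𝔓-inclusion = record
    { isBimoduleHomomorphism = record
      { +ᴹ-isGroupHomomorphism = record
        { isMonoidHomomorphism = record
          { isMagmaHomomorphism = record
            { isRelHomomorphism = record { cong = λ eq → eq }
            ; homo = λ _ _ → B.refl
            }
          ; ε-homo = B.refl
          }
        ; ⁻¹-homo = λ _ → B.refl
        }
      ; *ₗ-homo = λ _ _ → B.refl
      ; *ᵣ-homo = λ _ _ → B.refl
      }
    ; injective = λ eq → eq
    }

  𝔓 : 𝒪B-Bimodule
  𝔓 = record
    { isBimodule = BimoduleMonomorphism.isBimodule 𝔓-inclusion 𝒪B.isRing 𝒪B.isRing
        (Bimodule.isBimodule 𝒪B-natural)
    }

  indecomposables : Fin 4 → 𝒪B-Bimodule
  indecomposables 0F = 𝕆
  indecomposables 1F = ℙ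
  indecomposables 2F = 𝕃₁
  indecomposables 3F = 𝕃₂

  standardBilattice : ℕ⁴ → 𝒪B-Bimodule
  standardBilattice ⟨ r₁ , r₂ , t₁ , t₂ ⟩ = 𝕆 ⊕^ r₁ ⊕ ℙ ⊕^ r₂ ⊕ 𝕃₁ ⊕^ t₁ ⊕ 𝕃₂ ⊕^ t₂

  naturalBilattice : ℕ⁴ → 𝒪B-Bimodule
  naturalBilattice ⟨ r₁ , r₂ , t₁ , t₂ ⟩ = 𝒪B-natural ⊕^ r₁ ⊕ 𝔓 ⊕^ r₂ ⊕ 𝕃₁ ⊕^ t₁ ⊕ 𝕃₂ ⊕^ t₂

{-# OPTIONS --safe #-}

-- Let L be a bilattice and P x = Π x, Q x = x Π, so that P and Q commute and
-- P² = Q² = π. Since K/F is unramified there is θ ∈ O_K with θ - σ θ a unit,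
-- and therefore L is graded: L = L₀ ⊕ L₁ with a x = x a on L₀ and a x = x σ(a)
-- on L₁ for a ∈ O_K; P and Q exchange the two degrees. Each of the four models
-- X is cyclic on a homogeneous generator e. For 𝕆 and ℙ it satisfies P e = Q e
-- (the thin models); for 𝕃₁ and 𝕃₂ one has P e ∉ Q X (the thick models). A
-- homogeneous element of X outside P X + Q X generates X.
--
-- Existence: L is a quotient of a sum S of thick models. If Φ : S → L is not
-- injective, take a homogeneous x in its kernel; as L is torsion free, x may
-- be divided by Q until x ∉ Q S. If x ∉ P S + Q S, some component of x generates
-- its summand, which can be dropped. Otherwise x = P y + Q z, and the elements
-- w = y a - z σ(a) satisfy P Φ(w) = Q Φ(w); for a = 1 or a = θ a component of w
-- generates a thick summand, which can be replaced by a thin one. Both steps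
-- lower the number of summands, thick ones counted twice.
--
-- Uniqueness: under an isomorphism of a sum X ⊕ N with a sum of models, the image
-- of e has a component generating a summand isomorphic to X, and this pair of
-- summands can be cancelled.
module Submission where

open import Defs
open import Algebra.Bundles using (CommutativeMonoid; CommutativeRing; RawRing; Ring)
open import Algebra.Module.Bundles using (Bimodule)
import Algebra.Module.Construct.DirectProduct as DirectProduct
import Algebra.Module.Construct.Zero as Zero
open import Algebra.Module.Morphism.Structures using (IsBimoduleHomomorphism; IsBimoduleIsomorphism)
open import Algebra.Morphism.Structures using (IsRingHomomorphism; IsRingIsomorphism; IsRingMonomorphism)
import Algebra.Properties.AbelianGroup as AbelianGroupProperties
import Algebra.Properties.CommutativeSemigroup as CommutativeSemigroupProperties
import Algebra.Properties.Ring as RingProperties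
import Algebra.Properties.Semiring.Sum as SemiringSum
import Algebra.Solver.Ring.NaturalCoefficients.Default as Solver
open import Axiom.ExcludedMiddle using (ExcludedMiddle)
open import Data.Fin.Base using (Fin; zero; suc; punchIn; splitAt; toℕ; _↑ˡ_; _↑ʳ_)
open import Data.Fin.Patterns using (0F; 1F; 2F; 3F)
open import Data.Fin.Properties using (pigeonhole; splitAt-↑ˡ; splitAt-↑ʳ; splitAt⁻¹-↑ˡ; splitAt⁻¹-↑ʳ)
open import Data.Integer.Base as ℤ using (ℤ; +_; -[1+_])
import Data.Integer.Properties as ℤₚ
open import Data.List.Base using (List; []; _∷_; _++_; length)
open import Data.List.Properties using (length-++; ∷-injectiveˡ)
open import Data.List.Relation.Binary.Permutation.Propositional as ↭ using (_↭_)
open import Data.List.Relation.Binary.Permutation.Propositional.Properties using (↭-singleton-inv; ↭-length)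
open import Data.Nat.Base as ℕ using (ℕ; zero; suc)
import Data.Nat.Properties as ℕₚ
open import Algebra.Properties.CommutativeSemigroup ℕₚ.+-commutativeSemigroup using (x∙yz≈y∙xz)
open import Data.Product using (∃-syntax; ∃!; _×_)
open import Data.Product.Base using (Σ-syntax; _,_; proj₁; proj₂)
open import Data.Sum.Base using (_⊎_; inj₁; inj₂; [_,_]′)
open import Data.Unit.Polymorphic.Base using (⊤)
open import Function.Base using (_∘_)
open import Level using () renaming (suc to lsuc)
open import Relation.Binary.Construct.Add.Supremum.NonStrict ℤ._≤_ using (_≤⁺_; [_]; _≤⊤⁺; ≤⁺-dec)
open import Relation.Binary.PropositionalEquality as ≡ using (_≡_)
import Relation.Binary.Reasoning.Setoid as SetoidReasoning
open import Relation.Nullary.Construct.Add.Supremum using (_⁺; [_]; ⊤⁺)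
open import Relation.Nullary.Decidable.Core using (Dec; yes; no; decidable-stable)
open import Relation.Nullary.Negation using (¬_; contradiction)
open import Relation.Unary using (Pred; _∈_)

-- Bimodules

module Homs {ℓ} (R : Ring ℓ ℓ) where
  private
    module R = Ring R

  Bimod : Set (lsuc ℓ)
  Bimod = Bimodule R R ℓ ℓ

  ∣_∣ : Bimod → Set ℓ
  ∣ M ∣ = Bimodule.Carrierᴹ M

  infixr 6 _⊕_
  _⊕_ : Bimod → Bimod → Bimod
  _⊕_ = DirectProduct.bimodule

  𝟘 : Bimod
  𝟘 = Zero.bimodule

  record Hom (M N : Bimod) : Set ℓ where
    private
      module M = Bimodule M
      module N = Bimodule N
    field
      fun     : M.Carrierᴹ → N.Carrierᴹ
      cong    : ∀ {x y} → x M.≈ᴹ y → fun x N.≈ᴹ fun y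
      +-homo  : ∀ x y → fun (x M.+ᴹ y) N.≈ᴹ fun x N.+ᴹ fun y
      *ₗ-homo : ∀ α x → fun (α M.*ₗ x) N.≈ᴹ α N.*ₗ fun x
      *ᵣ-homo : ∀ α x → fun (x M.*ᵣ α) N.≈ᴹ fun x N.*ᵣ α

    0-homo : fun M.0ᴹ N.≈ᴹ N.0ᴹ
    0-homo = N.≈ᴹ-trans (cong (M.≈ᴹ-sym (M.*ₗ-zeroˡ M.0ᴹ)))
      (N.≈ᴹ-trans (*ₗ-homo R.0# M.0ᴹ) (N.*ₗ-zeroˡ _))

    neg-homo : ∀ x → fun (M.-ᴹ x) N.≈ᴹ N.-ᴹ fun x
    neg-homo x = AbelianGroupProperties.inverseˡ-unique N.+ᴹ-abelianGroup _ _
      (N.≈ᴹ-trans (N.≈ᴹ-sym (+-homo _ _)) (N.≈ᴹ-trans (cong (M.-ᴹ‿inverseˡ x)) 0-homo))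

    sub-homo : ∀ x y → fun (x M.+ᴹ M.-ᴹ y) N.≈ᴹ fun x N.+ᴹ N.-ᴹ fun y
    sub-homo x y = N.≈ᴹ-trans (+-homo _ _) (N.+ᴹ-congˡ (neg-homo y))

    isBimoduleHomomorphism : IsBimoduleHomomorphism M.rawBimodule N.rawBimodule fun
    isBimoduleHomomorphism = record
      { +ᴹ-isGroupHomomorphism = record
        { isMonoidHomomorphism = record
          { isMagmaHomomorphism = record
            { isRelHomomorphism = record { cong = cong }
            ; homo = +-homo
            }
          ; ε-homo = 0-homo
          }
        ; ⁻¹-homo = neg-homo
        }
      ; *ₗ-homo = *ₗ-homo
      ; *ᵣ-homo = *ᵣ-homo
      }

  open Hom public using () renaming (fun to infixl 20 _⟨$⟩_)

  Injective : ∀ {M N} → Hom M N → Set ℓ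
  Injective {M} {N} f = ∀ {x y} → f ⟨$⟩ x N.≈ᴹ f ⟨$⟩ y → x M.≈ᴹ y
    where
    module M = Bimodule M
    module N = Bimodule N

  Surjective : ∀ {M N} → Hom M N → Set ℓ
  Surjective {M} {N} f = ∀ y → ∃[ x ] f ⟨$⟩ x N.≈ᴹ y
    where
    module N = Bimodule N

  idH : ∀ {M} → Hom M M
  idH {M} = record
    { fun = λ x → x ; cong = λ p → p ; +-homo = λ _ _ → ≈ᴹ-refl
    ; *ₗ-homo = λ _ _ → ≈ᴹ-refl ; *ᵣ-homo = λ _ _ → ≈ᴹ-refl }
    where open Bimodule M

  infixr 9 _∘H_
  _∘H_ : ∀ {M N O} → Hom N O → Hom M N → Hom M O
  _∘H_ {M} {N} {O} g f = record
    { fun = λ x → g ⟨$⟩ (f ⟨$⟩ x)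
    ; cong = λ p → g.cong (f.cong p)
    ; +-homo = λ x y → O.≈ᴹ-trans (g.cong (f.+-homo x y)) (g.+-homo _ _)
    ; *ₗ-homo = λ α x → O.≈ᴹ-trans (g.cong (f.*ₗ-homo α x)) (g.*ₗ-homo _ _)
    ; *ᵣ-homo = λ α x → O.≈ᴹ-trans (g.cong (f.*ᵣ-homo α x)) (g.*ᵣ-homo _ _) }
    where
    module O = Bimodule O
    module f = Hom f
    module g = Hom g

  zeroH : ∀ {M} → Hom 𝟘 M
  zeroH {M} = record
    { fun = λ _ → 0ᴹ ; cong = λ _ → ≈ᴹ-refl
    ; +-homo = λ _ _ → ≈ᴹ-sym (+ᴹ-identityˡ _)
    ; *ₗ-homo = λ α _ → ≈ᴹ-sym (*ₗ-zeroʳ α)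
    ; *ᵣ-homo = λ α _ → ≈ᴹ-sym (*ᵣ-zeroˡ α) }
    where open Bimodule M

  module _ {M N : Bimod} where
    private
      module M = Bimodule M
      module N = Bimodule N

    fstH : Hom (M ⊕ N) M
    fstH = record { fun = proj₁ ; cong = proj₁ ; +-homo = λ _ _ → M.≈ᴹ-refl
      ; *ₗ-homo = λ _ _ → M.≈ᴹ-refl ; *ᵣ-homo = λ _ _ → M.≈ᴹ-refl }

    sndH : Hom (M ⊕ N) N
    sndH = record { fun = proj₂ ; cong = proj₂ ; +-homo = λ _ _ → N.≈ᴹ-refl
      ; *ₗ-homo = λ _ _ → N.≈ᴹ-refl ; *ᵣ-homo = λ _ _ → N.≈ᴹ-refl }

    inlH : Hom M (M ⊕ N)
    inlH = record
      { fun = λ x → x , N.0ᴹ ; cong = λ p → p , N.≈ᴹ-refl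
      ; +-homo = λ _ _ → M.≈ᴹ-refl , N.≈ᴹ-sym (N.+ᴹ-identityˡ _)
      ; *ₗ-homo = λ α _ → M.≈ᴹ-refl , N.≈ᴹ-sym (N.*ₗ-zeroʳ α)
      ; *ᵣ-homo = λ α _ → M.≈ᴹ-refl , N.≈ᴹ-sym (N.*ᵣ-zeroˡ α) }

    inrH : Hom N (M ⊕ N)
    inrH = record
      { fun = λ x → M.0ᴹ , x ; cong = λ p → M.≈ᴹ-refl , p
      ; +-homo = λ _ _ → M.≈ᴹ-sym (M.+ᴹ-identityˡ _) , N.≈ᴹ-refl
      ; *ₗ-homo = λ α _ → M.≈ᴹ-sym (M.*ₗ-zeroʳ α) , N.≈ᴹ-refl
      ; *ᵣ-homo = λ α _ → M.≈ᴹ-sym (M.*ᵣ-zeroˡ α) , N.≈ᴹ-refl }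

    copair : ∀ {L} → Hom M L → Hom N L → Hom (M ⊕ N) L
    copair {L} f g = record
      { fun = λ (x , y) → f ⟨$⟩ x +ᴹ g ⟨$⟩ y
      ; cong = λ (p , q) → +ᴹ-cong (f.cong p) (g.cong q)
      ; +-homo = λ (x , y) (x′ , y′) → ≈ᴹ-trans (+ᴹ-cong (f.+-homo x x′) (g.+-homo y y′)) (medial _ _ _ _)
      ; *ₗ-homo = λ α (x , y) → ≈ᴹ-trans (+ᴹ-cong (f.*ₗ-homo α x) (g.*ₗ-homo α y)) (≈ᴹ-sym (*ₗ-distribˡ α _ _))
      ; *ᵣ-homo = λ α (x , y) → ≈ᴹ-trans (+ᴹ-cong (f.*ᵣ-homo α x) (g.*ᵣ-homo α y)) (≈ᴹ-sym (*ᵣ-distribʳ α _ _)) }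
      where
      open Bimodule L
      module f = Hom f
      module g = Hom g
      open CommutativeSemigroupProperties
        (CommutativeMonoid.commutativeSemigroup +ᴹ-commutativeMonoid) renaming (interchange to medial)

  record Iso (M N : Bimod) : Set ℓ where
    private
      module M = Bimodule M
      module N = Bimodule N
    field
      to       : Hom M N
      from     : Hom N M
      from∘to  : ∀ x → from ⟨$⟩ (to ⟨$⟩ x) M.≈ᴹ x
      to∘from  : ∀ y → to ⟨$⟩ (from ⟨$⟩ y) N.≈ᴹ y

    injective : Injective to
    injective p = M.≈ᴹ-trans (M.≈ᴹ-sym (from∘to _)) (M.≈ᴹ-trans (Hom.cong from p) (from∘to _))

    surjective : Surjective to
    surjective y = from ⟨$⟩ y , to∘from y

    isBimoduleIsomorphism :
      IsBimoduleIsomorphism M.rawBimodule N.rawBimodule (to ⟨$⟩_)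
    isBimoduleIsomorphism = record
      { isBimoduleMonomorphism = record
        { isBimoduleHomomorphism = Hom.isBimoduleHomomorphism to
        ; injective = injective }
      ; surjective = λ y → from ⟨$⟩ y , λ p → N.≈ᴹ-trans (Hom.cong to p) (to∘from y)
      }

  bijective⇒iso : ∀ {M N} (f : Hom M N) → Injective f → Surjective f → Iso M N
  bijective⇒iso {M} {N} f inj surj = record
    { to = f
    ; from = record
      { fun = g
      ; cong = λ p → inj (N.≈ᴹ-trans (fg _) (N.≈ᴹ-trans p (N.≈ᴹ-sym (fg _))))
      ; +-homo = λ x y → inj (N.≈ᴹ-trans (fg _)
          (N.≈ᴹ-sym (N.≈ᴹ-trans (f.+-homo _ _) (N.+ᴹ-cong (fg x) (fg y)))))
      ; *ₗ-homo = λ α x → inj (N.≈ᴹ-trans (fg _)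
          (N.≈ᴹ-sym (N.≈ᴹ-trans (f.*ₗ-homo _ _) (N.*ₗ-congˡ (fg x)))))
      ; *ᵣ-homo = λ α x → inj (N.≈ᴹ-trans (fg _)
          (N.≈ᴹ-sym (N.≈ᴹ-trans (f.*ᵣ-homo _ _) (N.*ᵣ-congʳ (fg x)))))
      }
    ; from∘to = λ x → inj (fg _)
    ; to∘from = fg
    }
    where
    module N = Bimodule N
    module f = Hom f
    g : ∣ N ∣ → ∣ M ∣
    g y = proj₁ (surj y)
    fg : ∀ y → f ⟨$⟩ g y N.≈ᴹ y
    fg y = proj₂ (surj y)

  isBimoduleIsomorphism⇒iso : ∀ {M N} {f : ∣ M ∣ → ∣ N ∣} →
    IsBimoduleIsomorphism (Bimodule.rawBimodule M) (Bimodule.rawBimodule N) f → Iso M N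
  isBimoduleIsomorphism⇒iso {M} {N} {f} f-iso = bijective⇒iso f′ f.injective
    λ y → let x , p = f.surjective y in x , p (Bimodule.≈ᴹ-refl M)
    where
    module f = IsBimoduleIsomorphism f-iso
    f′ : Hom M N
    f′ = record
      { fun = f ; cong = f.⟦⟧-cong ; +-homo = f.+ᴹ-homo
      ; *ₗ-homo = f.*ₗ-homo ; *ᵣ-homo = f.*ᵣ-homo }

  ≅-refl : ∀ {M} → Iso M M
  ≅-refl {M} = record { to = idH ; from = idH ; from∘to = λ _ → ≈ᴹ-refl ; to∘from = λ _ → ≈ᴹ-refl }
    where open Bimodule M

  ≅-sym : ∀ {M N} → Iso M N → Iso N M
  ≅-sym f = record { to = from ; from = to ; from∘to = to∘from ; to∘from = from∘to }
    where open Iso f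

  ≅-trans : ∀ {M N O} → Iso M N → Iso N O → Iso M O
  ≅-trans {M} {N} {O} f g = record
    { to = g.to ∘H f.to
    ; from = f.from ∘H g.from
    ; from∘to = λ x → Bimodule.≈ᴹ-trans M (Hom.cong f.from (g.from∘to _)) (f.from∘to x)
    ; to∘from = λ x → Bimodule.≈ᴹ-trans O (Hom.cong g.to (f.to∘from _)) (g.to∘from x) }
    where
    module f = Iso f
    module g = Iso g

  ⊕-map : ∀ {M M′ N N′} → Hom M M′ → Hom N N′ → Hom (M ⊕ N) (M′ ⊕ N′)
  ⊕-map f g = record
    { fun = λ (x , y) → f ⟨$⟩ x , g ⟨$⟩ y
    ; cong = λ (p , q) → f.cong p , g.cong q
    ; +-homo = λ (x , y) (x′ , y′) → f.+-homo x x′ , g.+-homo y y′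
    ; *ₗ-homo = λ α (x , y) → f.*ₗ-homo α x , g.*ₗ-homo α y
    ; *ᵣ-homo = λ α (x , y) → f.*ᵣ-homo α x , g.*ᵣ-homo α y }
    where
    module f = Hom f
    module g = Hom g

  ⊕-cong : ∀ {M M′ N N′} → Iso M M′ → Iso N N′ → Iso (M ⊕ N) (M′ ⊕ N′)
  ⊕-cong f g = record
    { to = ⊕-map f.to g.to ; from = ⊕-map f.from g.from
    ; from∘to = λ (x , y) → f.from∘to x , g.from∘to y
    ; to∘from = λ (x , y) → f.to∘from x , g.to∘from y }
    where
    module f = Iso f
    module g = Iso g

  ⊕-assoc : ∀ M N O → Iso ((M ⊕ N) ⊕ O) (M ⊕ (N ⊕ O))
  ⊕-assoc M N O = record
    { to = record { fun = λ ((x , y) , z) → x , y , z ; cong = λ ((p , q) , r) → p , q , r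
                  ; +-homo = λ _ _ → rfl ; *ₗ-homo = λ _ _ → rfl ; *ᵣ-homo = λ _ _ → rfl }
    ; from = record { fun = λ (x , y , z) → (x , y) , z ; cong = λ (p , q , r) → (p , q) , r
                  ; +-homo = λ _ _ → rfl′ ; *ₗ-homo = λ _ _ → rfl′ ; *ᵣ-homo = λ _ _ → rfl′ }
    ; from∘to = λ _ → rfl′ ; to∘from = λ _ → rfl }
    where
    rfl  = λ {x} → Bimodule.≈ᴹ-refl (M ⊕ (N ⊕ O)) {x}
    rfl′ = λ {x} → Bimodule.≈ᴹ-refl ((M ⊕ N) ⊕ O) {x}

  ⊕-swap : ∀ M N O → Iso (M ⊕ (N ⊕ O)) (N ⊕ (M ⊕ O))
  ⊕-swap M N O = record { to = swap M N ; from = swap N M ; from∘to = λ _ → rfl M N ; to∘from = λ _ → rfl N M }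
    where
    rfl : ∀ M N {x : ∣ M ⊕ (N ⊕ O) ∣} → Bimodule._≈ᴹ_ (M ⊕ (N ⊕ O)) x x
    rfl M N = Bimodule.≈ᴹ-refl (M ⊕ (N ⊕ O))
    swap : ∀ M N → Hom (M ⊕ (N ⊕ O)) (N ⊕ (M ⊕ O))
    swap M N = record
      { fun = λ (x , y , z) → y , x , z ; cong = λ (p , q , r) → q , p , r
      ; +-homo = λ _ _ → rfl N M ; *ₗ-homo = λ _ _ → rfl N M ; *ᵣ-homo = λ _ _ → rfl N M }

  ⊕-identityˡ : ∀ M → Iso (𝟘 ⊕ M) M
  ⊕-identityˡ M = record { to = sndH ; from = inrH ; from∘to = λ _ → _ , ≈ᴹ-refl ; to∘from = λ _ → ≈ᴹ-refl }
    where open Bimodule M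

  ⊕-identityʳ : ∀ M → Iso (M ⊕ 𝟘) M
  ⊕-identityʳ M = record { to = fstH ; from = inlH ; from∘to = λ _ → ≈ᴹ-refl , _ ; to∘from = λ _ → ≈ᴹ-refl }
    where open Bimodule M

module _ {ℓ} (A : CommutativeRing ℓ ℓ) where
  private module A = CommutativeRing A
  Divides^ : A.Carrier → ℕ → A.Carrier → Set ℓ
  Divides^ π zero    a = ⊤
  Divides^ π (suc n) a = ∃[ b ] (a A.≈ b A.* π × Divides^ π n b)

-- The properties of O_B = O_K ⊕ O_K Π used below; the fixed ring of σ stands
-- for O_F.
record CyclicOrder ℓ : Set (lsuc ℓ) where
  field
    A : CommutativeRing ℓ ℓ
    R : Ring ℓ ℓ
  module A = CommutativeRing A
  module R = Ring R
  field
    emb         : A.Carrier → R.Carrier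
    emb-hom     : IsRingHomomorphism A.rawRing R.rawRing emb
    σ           : A.Carrier → A.Carrier
    σ-hom       : IsRingHomomorphism A.rawRing A.rawRing σ
    σσ          : ∀ a → σ (σ a) A.≈ a
    π           : A.Carrier
    σπ          : σ π A.≈ π
    Π           : R.Carrier
    Π²          : Π R.* Π R.≈ emb π
    Πa          : ∀ a → Π R.* emb a R.≈ emb (σ a) R.* Π
    spanning    : ∀ α → ∃[ a ] ∃[ b ] α R.≈ emb a R.+ emb b R.* Π
    independent : ∀ {a b a′ b′} → emb a R.+ emb b R.* Π R.≈ emb a′ R.+ emb b′ R.* Π →
                  a A.≈ a′ × b A.≈ b′
    local       : ∀ a → (∃[ b ] a A.* b A.≈ A.1#) ⊎ (∃[ b ] a A.≈ b A.* π)
    π-nonunit   : ∀ b → ¬ A.1# A.≈ b A.* π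
    π-regular   : ∀ a → a A.* π A.≈ A.0# → a A.≈ A.0#
    separated   : ∀ a → (∀ n → Divides^ A π n a) → a A.≈ A.0#
    θ u         : A.Carrier
    θ-σθ-unit   : (θ A.- σ θ) A.* u A.≈ A.1#
    fixed+fixed*θ : ∀ a → ∃[ f ] ∃[ g ] (σ f A.≈ f × σ g A.≈ g × a A.≈ f A.+ g A.* θ)
  module emb = IsRingHomomorphism emb-hom
  module σ = IsRingHomomorphism σ-hom

data Degree : Set where
  even odd : Degree

flip : Degree → Degree
flip even = odd
flip odd  = even

module Graded {ℓ} (S : CyclicOrder ℓ) where
  open CyclicOrder S
  open Homs R
  twist : Degree → A.Carrier → A.Carrier
  twist even a = a
  twist odd  a = σ a

  twist-σ : ∀ s a → twist s (σ a) A.≈ twist (flip s) a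
  twist-σ even a = A.refl
  twist-σ odd  a = σσ a

  σ-twist : ∀ s a → σ (twist s a) A.≈ twist (flip s) a
  σ-twist even a = A.refl
  σ-twist odd  a = σσ a

  aΠ : ∀ a → emb a R.* Π R.≈ Π R.* emb (σ a)
  aΠ a = R.trans (R.*-congʳ (emb.⟦⟧-cong (A.sym (σσ a)))) (R.sym (Πa (σ a)))

  σ-norm : ∀ a → σ (a A.* σ a) A.≈ a A.* σ a
  σ-norm a = A.trans (σ.*-homo a (σ a)) (A.trans (A.*-congˡ (σσ a)) (A.*-comm _ _))

  σ-trace : ∀ a → σ (a A.+ σ a) A.≈ a A.+ σ a
  σ-trace a = A.trans (σ.+-homo a (σ a)) (A.trans (A.+-congˡ (σσ a)) (A.+-comm _ _))

  conjugate : ∀ α → ∃[ β ] Π R.* α R.≈ β R.* Π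
  conjugate α with spanning α
  ... | a , b , eq = emb (σ a) R.+ emb (σ b) R.* Π , (begin
    Π R.* α                                          ≈⟨ R.*-congˡ eq ⟩
    Π R.* (emb a R.+ emb b R.* Π)                    ≈⟨ R.distribˡ _ _ _ ⟩
    Π R.* emb a R.+ Π R.* (emb b R.* Π)
      ≈⟨ R.+-cong (Πa a) (R.trans (R.sym (R.*-assoc _ _ _)) (R.*-congʳ (Πa b))) ⟩
    emb (σ a) R.* Π R.+ emb (σ b) R.* Π R.* Π        ≈⟨ R.distribʳ _ _ _ ⟨
    (emb (σ a) R.+ emb (σ b) R.* Π) R.* Π            ∎)
    where open SetoidReasoning R.setoid

  module On (L : Bimod) where
    open Bimodule L public
    open AbelianGroupProperties +ᴹ-abelianGroup public
      using () renaming (⁻¹-∙-comm to -‿+-comm; x∙y⁻¹≈ε⇒x≈y to x-y≈0⇒x≈y; inverseˡ-unique to neg-uniqueˡ)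
    open CommutativeSemigroupProperties
      (CommutativeMonoid.commutativeSemigroup +ᴹ-commutativeMonoid) public
      using () renaming (interchange to medial)
    open SetoidReasoning ≈ᴹ-setoid public

    infixl 8 _·_
    infixr 8 _◃_
    infixl 6 _-ᴹ_

    _·_ : Carrierᴹ → A.Carrier → Carrierᴹ
    x · a = x *ᵣ emb a

    _◃_ : A.Carrier → Carrierᴹ → Carrierᴹ
    a ◃ x = emb a *ₗ x

    _-ᴹ_ : Carrierᴹ → Carrierᴹ → Carrierᴹ
    x -ᴹ y = x +ᴹ -ᴹ y

    P Q : Carrierᴹ → Carrierᴹ
    P x = Π *ₗ x
    Q x = x *ᵣ Π

    record Additive (f : Carrierᴹ → Carrierᴹ) : Set ℓ where
      field
        cong : ∀ {x y} → x ≈ᴹ y → f x ≈ᴹ f y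
        homo : ∀ x y → f (x +ᴹ y) ≈ᴹ f x +ᴹ f y

      zero-homo : f 0ᴹ ≈ᴹ 0ᴹ
      zero-homo = AbelianGroupProperties.identityʳ-unique +ᴹ-abelianGroup _ _
        (≈ᴹ-trans (≈ᴹ-sym (homo 0ᴹ 0ᴹ)) (cong (+ᴹ-identityˡ 0ᴹ)))

      neg-homo : ∀ x → f (-ᴹ x) ≈ᴹ -ᴹ f x
      neg-homo x = neg-uniqueˡ _ _
        (≈ᴹ-trans (≈ᴹ-sym (homo _ _)) (≈ᴹ-trans (cong (-ᴹ‿inverseˡ x)) zero-homo))

      sub-homo : ∀ x y → f (x -ᴹ y) ≈ᴹ f x -ᴹ f y
      sub-homo x y = ≈ᴹ-trans (homo _ _) (+ᴹ-congˡ (neg-homo y))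

    P-additive : Additive P
    P-additive = record { cong = *ₗ-congˡ ; homo = *ₗ-distribˡ Π }
    Q-additive : Additive Q
    Q-additive = record { cong = *ᵣ-congʳ ; homo = *ᵣ-distribʳ Π }
    ·-additive : ∀ a → Additive (_· a)
    ·-additive a = record { cong = *ᵣ-congʳ ; homo = *ᵣ-distribʳ (emb a) }
    ◃-additive : ∀ a → Additive (a ◃_)
    ◃-additive a = record { cong = *ₗ-congˡ ; homo = *ₗ-distribˡ (emb a) }

    module P = Additive P-additive
    module Q = Additive Q-additive
    module ·ₐ {a} = Additive (·-additive a)
    module ◃ₐ {a} = Additive (◃-additive a)

    ·-congˡ : ∀ {x a b} → a A.≈ b → x · a ≈ᴹ x · b
    ·-congˡ p = *ᵣ-congˡ (emb.⟦⟧-cong p)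

    ·-assoc : ∀ x a b → x · a · b ≈ᴹ x · (a A.* b)
    ·-assoc x a b = ≈ᴹ-trans (*ᵣ-assoc x _ _) (*ᵣ-congˡ (R.sym (emb.*-homo a b)))

    ·-comm : ∀ x a b → x · a · b ≈ᴹ x · b · a
    ·-comm x a b = ≈ᴹ-trans (·-assoc x a b) (≈ᴹ-trans (·-congˡ (A.*-comm a b)) (≈ᴹ-sym (·-assoc x b a)))

    ·-+ : ∀ x a b → x · (a A.+ b) ≈ᴹ x · a +ᴹ x · b
    ·-+ x a b = ≈ᴹ-trans (*ᵣ-congˡ (emb.+-homo a b)) (*ᵣ-distribˡ x _ _)

    ·-1 : ∀ x → x · A.1# ≈ᴹ x
    ·-1 x = ≈ᴹ-trans (*ᵣ-congˡ emb.1#-homo) (*ᵣ-identityʳ x)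

    ·-0 : ∀ x → x · A.0# ≈ᴹ 0ᴹ
    ·-0 x = ≈ᴹ-trans (*ᵣ-congˡ emb.0#-homo) (*ᵣ-zeroʳ x)

    ·-neg : ∀ x a → x · (A.- a) ≈ᴹ -ᴹ (x · a)
    ·-neg x a = neg-uniqueˡ _ _ (≈ᴹ-trans (≈ᴹ-sym (·-+ x _ _))
      (≈ᴹ-trans (·-congˡ (A.-‿inverseˡ a)) (·-0 x)))

    ·-sub : ∀ x a b → x · (a A.- b) ≈ᴹ x · a -ᴹ x · b
    ·-sub x a b = ≈ᴹ-trans (·-+ x _ _) (+ᴹ-congˡ (·-neg x b))

    ◃-· : ∀ a x b → (a ◃ x) · b ≈ᴹ a ◃ (x · b)
    ◃-· a x b = *ₗ-*ᵣ-assoc (emb a) x (emb b)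

    ◃-assoc : ∀ a b x → (a A.* b) ◃ x ≈ᴹ a ◃ b ◃ x
    ◃-assoc a b x = ≈ᴹ-trans (*ₗ-congʳ (emb.*-homo a b)) (*ₗ-assoc _ _ x)

    ◃-+ : ∀ a b x → (a A.+ b) ◃ x ≈ᴹ a ◃ x +ᴹ b ◃ x
    ◃-+ a b x = ≈ᴹ-trans (*ₗ-congʳ (emb.+-homo a b)) (*ₗ-distribʳ x _ _)

    PQ≈QP : ∀ x → P (Q x) ≈ᴹ Q (P x)
    PQ≈QP x = ≈ᴹ-sym (*ₗ-*ᵣ-assoc Π x Π)

    PP : ∀ x → P (P x) ≈ᴹ π ◃ x
    PP x = ≈ᴹ-trans (≈ᴹ-sym (*ₗ-assoc Π Π x)) (*ₗ-congʳ Π²)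

    QQ : ∀ x → Q (Q x) ≈ᴹ x · π
    QQ x = ≈ᴹ-trans (*ᵣ-assoc x Π Π) (*ᵣ-congˡ Π²)

    P-· : ∀ x a → P (x · a) ≈ᴹ P x · a
    P-· x a = ≈ᴹ-sym (*ₗ-*ᵣ-assoc Π x (emb a))

    Q-· : ∀ x a → Q (x · a) ≈ᴹ Q x · σ a
    Q-· x a = ≈ᴹ-trans (*ᵣ-assoc x _ _) (≈ᴹ-trans (*ᵣ-congˡ (aΠ a)) (≈ᴹ-sym (*ᵣ-assoc x _ _)))

    P-◃ : ∀ x a → a ◃ P x ≈ᴹ P (σ a ◃ x)
    P-◃ x a = ≈ᴹ-trans (≈ᴹ-sym (*ₗ-assoc _ _ x)) (≈ᴹ-trans (*ₗ-congʳ (aΠ a)) (*ₗ-assoc _ _ x))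

    Q-◃ : ∀ x a → a ◃ Q x ≈ᴹ Q (a ◃ x)
    Q-◃ x a = ≈ᴹ-sym (*ₗ-*ᵣ-assoc (emb a) x Π)

    x-x≈0 : ∀ {x y} → x ≈ᴹ y → x -ᴹ y ≈ᴹ 0ᴹ
    x-x≈0 {x} {y} p = ≈ᴹ-trans (+ᴹ-congʳ p) (-ᴹ‿inverseʳ y)

    telescope : ∀ x y z → (x -ᴹ y) +ᴹ (z -ᴹ x) ≈ᴹ z -ᴹ y
    telescope x y z = begin
      (x -ᴹ y) +ᴹ (z -ᴹ x) ≈⟨ +ᴹ-comm _ _ ⟩
      (z -ᴹ x) +ᴹ (x -ᴹ y) ≈⟨ +ᴹ-assoc _ _ _ ⟩
      z +ᴹ (-ᴹ x +ᴹ (x -ᴹ y)) ≈⟨ +ᴹ-congˡ (+ᴹ-assoc _ _ _) ⟨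
      z +ᴹ ((-ᴹ x +ᴹ x) -ᴹ y) ≈⟨ +ᴹ-congˡ (+ᴹ-congʳ (-ᴹ‿inverseˡ x)) ⟩
      z +ᴹ (0ᴹ -ᴹ y) ≈⟨ +ᴹ-congˡ (+ᴹ-identityˡ _) ⟩
      z -ᴹ y ∎

    exchange : ∀ {a b c d} → a +ᴹ b ≈ᴹ c +ᴹ d → a -ᴹ d ≈ᴹ c -ᴹ b
    exchange {a} {b} {c} {d} p = begin
      a -ᴹ d                    ≈⟨ +ᴹ-congʳ (+ᴹ-identityʳ a) ⟨
      (a +ᴹ 0ᴹ) -ᴹ d            ≈⟨ +ᴹ-congʳ (+ᴹ-congˡ (-ᴹ‿inverseʳ b)) ⟨
      (a +ᴹ (b -ᴹ b)) -ᴹ d      ≈⟨ +ᴹ-congʳ (+ᴹ-assoc _ _ _) ⟨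
      ((a +ᴹ b) -ᴹ b) -ᴹ d      ≈⟨ +ᴹ-congʳ (+ᴹ-congʳ p) ⟩
      ((c +ᴹ d) -ᴹ b) -ᴹ d      ≈⟨ +ᴹ-assoc _ _ _ ⟩
      (c +ᴹ d) +ᴹ (-ᴹ b -ᴹ d)   ≈⟨ medial _ _ _ _ ⟩
      (c -ᴹ b) +ᴹ (d -ᴹ d)      ≈⟨ +ᴹ-congˡ (-ᴹ‿inverseʳ d) ⟩
      (c -ᴹ b) +ᴹ 0ᴹ            ≈⟨ +ᴹ-identityʳ _ ⟩
      c -ᴹ b                    ∎

    isolate : ∀ {a b c} → a +ᴹ b ≈ᴹ c → a ≈ᴹ c -ᴹ b
    isolate {a} {b} {c} p = begin
      a                ≈⟨ +ᴹ-identityʳ a ⟨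
      a +ᴹ 0ᴹ          ≈⟨ +ᴹ-congˡ (-ᴹ‿inverseʳ b) ⟨
      a +ᴹ (b -ᴹ b)    ≈⟨ +ᴹ-assoc _ _ _ ⟨
      (a +ᴹ b) -ᴹ b    ≈⟨ +ᴹ-congʳ p ⟩
      c -ᴹ b           ∎

    Rad QDiv PinQ : Carrierᴹ → Set ℓ
    Rad x  = ∃[ y ] ∃[ z ] x ≈ᴹ P y +ᴹ Q z
    QDiv x = ∃[ z ] x ≈ᴹ Q z
    PinQ x = QDiv (P x)

    Div : ℕ → Carrierᴹ → Set ℓ
    Div zero    x = ⊤
    Div (suc n) x = ∃[ y ] (x ≈ᴹ Q y × Div n y)

    rad-resp : ∀ {x y} → x ≈ᴹ y → Rad x → Rad y
    rad-resp p (y , z , q) = y , z , ≈ᴹ-trans (≈ᴹ-sym p) q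

    rad-+ : ∀ {x y} → Rad x → Rad y → Rad (x +ᴹ y)
    rad-+ (y , z , p) (y′ , z′ , q) = y +ᴹ y′ , z +ᴹ z′ , (begin
      _                                       ≈⟨ +ᴹ-cong p q ⟩
      (P y +ᴹ Q z) +ᴹ (P y′ +ᴹ Q z′)          ≈⟨ medial _ _ _ _ ⟩
      (P y +ᴹ P y′) +ᴹ (Q z +ᴹ Q z′)          ≈⟨ +ᴹ-cong (P.homo _ _) (Q.homo _ _) ⟨
      P (y +ᴹ y′) +ᴹ Q (z +ᴹ z′)              ∎)

    rad-neg : ∀ {x} → Rad x → Rad (-ᴹ x)
    rad-neg (y , z , p) = -ᴹ y , -ᴹ z , (begin
      _                      ≈⟨ -ᴹ‿cong p ⟩
      -ᴹ (P y +ᴹ Q z)        ≈⟨ -‿+-comm _ _ ⟨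
      -ᴹ P y +ᴹ -ᴹ Q z       ≈⟨ +ᴹ-cong (P.neg-homo y) (Q.neg-homo z) ⟨
      P (-ᴹ y) +ᴹ Q (-ᴹ z)   ∎)

    rad-P : ∀ x → Rad (P x)
    rad-P x = x , 0ᴹ , ≈ᴹ-sym (≈ᴹ-trans (+ᴹ-congˡ Q.zero-homo) (+ᴹ-identityʳ _))

    rad-Q : ∀ x → Rad (Q x)
    rad-Q x = 0ᴹ , x , ≈ᴹ-sym (≈ᴹ-trans (+ᴹ-congʳ P.zero-homo) (+ᴹ-identityˡ _))

    Q-·σ : ∀ x a → Q x · a ≈ᴹ Q (x · σ a)
    Q-·σ x a = ≈ᴹ-sym (≈ᴹ-trans (Q-· x (σ a)) (·-congˡ (σσ a)))

    rad-· : ∀ {x} → Rad x → ∀ a → Rad (x · a)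
    rad-· (y , z , p) a = y · a , z · σ a , (begin
      _                       ≈⟨ *ᵣ-congʳ p ⟩
      (P y +ᴹ Q z) · a        ≈⟨ ·ₐ.homo _ _ ⟩
      P y · a +ᴹ Q z · a      ≈⟨ +ᴹ-cong (≈ᴹ-sym (P-· y a)) (Q-·σ z a) ⟩
      P (y · a) +ᴹ Q (z · σ a) ∎)

    rad-·π : ∀ x a → Rad (x · (a A.* π))
    rad-·π x a = rad-resp (≈ᴹ-trans (QQ (x · a)) (·-assoc x a π)) (rad-Q (Q (x · a)))

    record Closed (N : Carrierᴹ → Set ℓ) : Set ℓ where
      field
        resp  : ∀ {x y} → x ≈ᴹ y → N x → N y
        add   : ∀ {x y} → N x → N y → N (x +ᴹ y)
        left  : ∀ α {x} → N x → N (α *ₗ x)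
        right : ∀ α {x} → N x → N (x *ᵣ α)

      neg : ∀ {x} → N x → N (-ᴹ x)
      neg {x} n = resp (≈ᴹ-trans (·-neg x A.1#) (-ᴹ‿cong (·-1 x))) (right (emb (A.- A.1#)) n)

    Generates : Carrierᴹ → Set (lsuc ℓ)
    Generates x = ∀ {N} → Closed N → N x → ∀ v → N v

    pinQ-closed : Closed PinQ
    pinQ-closed = record
      { resp  = λ p (z , q) → z , ≈ᴹ-trans (P.cong (≈ᴹ-sym p)) q
      ; add   = λ (z , p) (z′ , q) → z +ᴹ z′ ,
          ≈ᴹ-trans (P.homo _ _) (≈ᴹ-trans (+ᴹ-cong p q) (≈ᴹ-sym (Q.homo _ _)))
      ; left  = λ α {x} (z , p) → let β , q = conjugate α in β *ₗ z , (begin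
          P (α *ₗ x)        ≈⟨ *ₗ-assoc Π α x ⟨
          (Π R.* α) *ₗ x    ≈⟨ *ₗ-congʳ q ⟩
          (β R.* Π) *ₗ x    ≈⟨ *ₗ-assoc β Π x ⟩
          β *ₗ P x          ≈⟨ *ₗ-congˡ p ⟩
          β *ₗ Q z          ≈⟨ *ₗ-*ᵣ-assoc β z Π ⟨
          Q (β *ₗ z)        ∎)
      ; right = λ α {x} (z , p) → let β , q = conjugate α in z *ᵣ β , (begin
          P (x *ᵣ α)        ≈⟨ *ₗ-*ᵣ-assoc Π x α ⟨
          P x *ᵣ α          ≈⟨ *ᵣ-congʳ p ⟩
          Q z *ᵣ α          ≈⟨ *ᵣ-assoc z Π α ⟩
          z *ᵣ (Π R.* α)    ≈⟨ *ᵣ-congˡ q ⟩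
          z *ᵣ (β R.* Π)    ≈⟨ *ᵣ-assoc z β Π ⟨
          Q (z *ᵣ β)        ∎)
      }

    Homogeneous : Degree → Carrierᴹ → Set ℓ
    Homogeneous s x = ∀ a → a ◃ x ≈ᴹ x · twist s a

    module _ (s : Degree) where
      hg-+ : ∀ {x y} → Homogeneous s x → Homogeneous s y → Homogeneous s (x +ᴹ y)
      hg-+ h k a = ≈ᴹ-trans (*ₗ-distribˡ _ _ _)
        (≈ᴹ-trans (+ᴹ-cong (h a) (k a)) (≈ᴹ-sym (*ᵣ-distribʳ _ _ _)))

      hg-neg : ∀ {x} → Homogeneous s x → Homogeneous s (-ᴹ x)
      hg-neg h a = ≈ᴹ-trans (◃ₐ.neg-homo _) (≈ᴹ-trans (-ᴹ‿cong (h a)) (≈ᴹ-sym (·ₐ.neg-homo _)))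

      hg-· : ∀ {x} → Homogeneous s x → ∀ b → Homogeneous s (x · b)
      hg-· {x} h b a = begin
        a ◃ (x · b)      ≈⟨ ◃-· a x b ⟨
        (a ◃ x) · b      ≈⟨ *ᵣ-congʳ (h a) ⟩
        x · twist s a · b ≈⟨ ·-comm x _ _ ⟩
        x · b · twist s a ∎

      hg-P : ∀ {x} → Homogeneous s x → Homogeneous (flip s) (P x)
      hg-P {x} h a = begin
        a ◃ P x               ≈⟨ P-◃ x a ⟩
        P (σ a ◃ x)           ≈⟨ P.cong (h (σ a)) ⟩
        P (x · twist s (σ a)) ≈⟨ P-· x _ ⟩
        P x · twist s (σ a)   ≈⟨ ·-congˡ (twist-σ s a) ⟩
        P x · twist (flip s) a ∎

      hg-Q : ∀ {x} → Homogeneous s x → Homogeneous (flip s) (Q x)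
      hg-Q {x} h a = begin
        a ◃ Q x               ≈⟨ Q-◃ x a ⟩
        Q (a ◃ x)             ≈⟨ Q.cong (h a) ⟩
        Q (x · twist s a)     ≈⟨ Q-· x _ ⟩
        Q x · σ (twist s a)   ≈⟨ ·-congˡ (σ-twist s a) ⟩
        Q x · twist (flip s) a ∎

    hg-P′ : ∀ s {x} → Homogeneous (flip s) x → Homogeneous s (P x)
    hg-P′ even = hg-P odd
    hg-P′ odd  = hg-P even

    hg-Q′ : ∀ s {x} → Homogeneous (flip s) x → Homogeneous s (Q x)
    hg-Q′ even = hg-Q odd
    hg-Q′ odd  = hg-Q even

    Balanced : Set ℓ
    Balanced = ∀ {f} → σ f A.≈ f → ∀ x → f ◃ x ≈ᴹ x · f

    π-TorsionFree : Set ℓ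
    π-TorsionFree = ∀ {x} → x · π ≈ᴹ 0ᴹ → x ≈ᴹ 0ᴹ

    raw-pr : Degree → Carrierᴹ → Carrierᴹ
    raw-pr even x = θ ◃ x -ᴹ x · σ θ
    raw-pr odd  x = x · θ -ᴹ θ ◃ x

    pr : Degree → Carrierᴹ → Carrierᴹ
    pr s x = raw-pr s x · u

    pr-additive : ∀ s → Additive (pr s)
    pr-additive even = record
      { cong = λ p → *ᵣ-congʳ (+ᴹ-cong (*ₗ-congˡ p) (-ᴹ‿cong (*ᵣ-congʳ p)))
      ; homo = λ x y → ≈ᴹ-trans (*ᵣ-congʳ (≈ᴹ-trans
          (+ᴹ-cong (◃ₐ.homo x y) (≈ᴹ-trans (-ᴹ‿cong (·ₐ.homo x y)) (≈ᴹ-sym (-‿+-comm _ _))))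
          (medial _ _ _ _))) (·ₐ.homo _ _) }
    pr-additive odd = record
      { cong = λ p → *ᵣ-congʳ (+ᴹ-cong (*ᵣ-congʳ p) (-ᴹ‿cong (*ₗ-congˡ p)))
      ; homo = λ x y → ≈ᴹ-trans (*ᵣ-congʳ (≈ᴹ-trans
          (+ᴹ-cong (·ₐ.homo x y) (≈ᴹ-trans (-ᴹ‿cong (◃ₐ.homo x y)) (≈ᴹ-sym (-‿+-comm _ _))))
          (medial _ _ _ _))) (·ₐ.homo _ _) }

    module pr s = Additive (pr-additive s)

    [θ-σθ]u : ∀ x → (x · θ -ᴹ x · σ θ) · u ≈ᴹ x
    [θ-σθ]u x = begin
      (x · θ -ᴹ x · σ θ) · u       ≈⟨ *ᵣ-congʳ (·-sub x θ (σ θ)) ⟨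
      x · (θ A.- σ θ) · u          ≈⟨ ·-assoc x _ _ ⟩
      x · ((θ A.- σ θ) A.* u)      ≈⟨ ·-congˡ θ-σθ-unit ⟩
      x · A.1#                     ≈⟨ ·-1 x ⟩
      x                            ∎

    pr-sum : ∀ x → x ≈ᴹ pr even x +ᴹ pr odd x
    pr-sum x = ≈ᴹ-sym (begin
      pr even x +ᴹ pr odd x                      ≈⟨ ·ₐ.homo _ _ ⟨
      (raw-pr even x +ᴹ raw-pr odd x) · u        ≈⟨ *ᵣ-congʳ (telescope _ _ _) ⟩
      (x · θ -ᴹ x · σ θ) · u                     ≈⟨ [θ-σθ]u x ⟩
      x                                          ∎)

    pr-hg : ∀ s {x} → Homogeneous s x → pr s x ≈ᴹ x
    pr-hg even h = ≈ᴹ-trans (*ᵣ-congʳ (+ᴹ-congʳ (h θ))) ([θ-σθ]u _)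
    pr-hg odd  h = ≈ᴹ-trans (*ᵣ-congʳ (+ᴹ-congˡ (-ᴹ‿cong (h θ)))) ([θ-σθ]u _)

    pr-flip-hg : ∀ s {x} → Homogeneous (flip s) x → pr s x ≈ᴹ 0ᴹ
    pr-flip-hg even h = ≈ᴹ-trans (*ᵣ-congʳ (x-x≈0 (h θ))) ·ₐ.zero-homo
    pr-flip-hg odd  h = ≈ᴹ-trans (*ᵣ-congʳ (x-x≈0 (≈ᴹ-sym (h θ)))) ·ₐ.zero-homo

    pr-sum′ : ∀ s x → x ≈ᴹ pr s x +ᴹ pr (flip s) x
    pr-sum′ even x = pr-sum x
    pr-sum′ odd  x = ≈ᴹ-trans (pr-sum x) (+ᴹ-comm _ _)

    module WhenBalanced (balanced : Balanced) where

      hg-θ : ∀ s {x} → θ ◃ x ≈ᴹ x · twist s θ → Homogeneous s x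
      hg-θ s {x} h a with fixed+fixed*θ a
      ... | f , g , σf , σg , eq = begin
        a ◃ x                            ≈⟨ *ₗ-congʳ (emb.⟦⟧-cong eq) ⟩
        (f A.+ g A.* θ) ◃ x              ≈⟨ ◃-+ f _ x ⟩
        f ◃ x +ᴹ (g A.* θ) ◃ x           ≈⟨ +ᴹ-cong (balanced σf x) (◃-assoc g θ x) ⟩
        x · f +ᴹ g ◃ θ ◃ x               ≈⟨ +ᴹ-congˡ (balanced σg _) ⟩
        x · f +ᴹ (θ ◃ x) · g             ≈⟨ +ᴹ-congˡ (*ᵣ-congʳ h) ⟩
        x · f +ᴹ x · twist s θ · g       ≈⟨ +ᴹ-congˡ (·-comm x _ _) ⟩
        x · f +ᴹ x · g · twist s θ       ≈⟨ +ᴹ-congˡ (·-assoc x _ _) ⟩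
        x · f +ᴹ x · (g A.* twist s θ)   ≈⟨ ·-+ x _ _ ⟨
        x · (f A.+ g A.* twist s θ)      ≈⟨ ·-congˡ (lemma s) ⟨
        x · twist s a                    ∎
        where
        lemma : ∀ s → twist s a A.≈ f A.+ g A.* twist s θ
        lemma even = eq
        lemma odd  = A.trans (σ.⟦⟧-cong eq) (A.trans (σ.+-homo _ _)
          (A.+-cong σf (A.trans (σ.*-homo _ _) (A.*-congʳ σg))))

      θ-quadratic : ∀ x → θ ◃ θ ◃ x +ᴹ x · θ · σ θ ≈ᴹ (θ ◃ x) · θ +ᴹ (θ ◃ x) · σ θ
      θ-quadratic x = begin
        θ ◃ θ ◃ x +ᴹ x · θ · σ θ
          ≈⟨ +ᴹ-cong (≈ᴹ-sym (◃-assoc θ θ x)) (≈ᴹ-trans (·-assoc x _ _) (≈ᴹ-sym (balanced (σ-norm θ) x))) ⟩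
        (θ A.* θ) ◃ x +ᴹ (θ A.* σ θ) ◃ x       ≈⟨ ◃-+ _ _ x ⟨
        (θ A.* θ A.+ θ A.* σ θ) ◃ x
          ≈⟨ *ₗ-congʳ (emb.⟦⟧-cong (A.trans (A.sym (A.distribˡ θ _ _)) (A.*-comm _ _))) ⟩
        ((θ A.+ σ θ) A.* θ) ◃ x                ≈⟨ ◃-assoc _ _ x ⟩
        (θ A.+ σ θ) ◃ θ ◃ x                    ≈⟨ balanced (σ-trace θ) _ ⟩
        (θ ◃ x) · (θ A.+ σ θ)                  ≈⟨ ·-+ _ _ _ ⟩
        (θ ◃ x) · θ +ᴹ (θ ◃ x) · σ θ           ∎

      pr-homogeneous : ∀ s x → Homogeneous s (pr s x)
      pr-homogeneous even x = hg-· even (hg-θ even (begin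
        θ ◃ (θ ◃ x -ᴹ x · σ θ)              ≈⟨ ◃ₐ.sub-homo _ _ ⟩
        θ ◃ θ ◃ x -ᴹ θ ◃ (x · σ θ)          ≈⟨ +ᴹ-congˡ (-ᴹ‿cong (◃-· θ x _)) ⟨
        θ ◃ θ ◃ x -ᴹ (θ ◃ x) · σ θ          ≈⟨ exchange (θ-quadratic x) ⟩
        (θ ◃ x) · θ -ᴹ x · θ · σ θ          ≈⟨ +ᴹ-congˡ (-ᴹ‿cong (·-comm x _ _)) ⟩
        (θ ◃ x) · θ -ᴹ x · σ θ · θ          ≈⟨ ·ₐ.sub-homo _ _ ⟨
        (θ ◃ x -ᴹ x · σ θ) · θ              ∎)) u
      pr-homogeneous odd x = hg-· odd (hg-θ odd (begin
        θ ◃ (x · θ -ᴹ θ ◃ x)                ≈⟨ ◃ₐ.sub-homo _ _ ⟩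
        θ ◃ (x · θ) -ᴹ θ ◃ θ ◃ x            ≈⟨ +ᴹ-congʳ (◃-· θ x _) ⟨
        (θ ◃ x) · θ -ᴹ θ ◃ θ ◃ x            ≈⟨ exchange (≈ᴹ-trans (≈ᴹ-sym (θ-quadratic x)) (+ᴹ-comm _ _)) ⟩
        x · θ · σ θ -ᴹ (θ ◃ x) · σ θ        ≈⟨ ·ₐ.sub-homo _ _ ⟨
        (x · θ -ᴹ θ ◃ x) · σ θ              ∎)) u

      pr-P : ∀ s x → pr s (P x) ≈ᴹ P (pr (flip s) x)
      pr-P s x = begin
        pr s (P x)                                         ≈⟨ pr.cong s (P.cong (pr-sum′ s x)) ⟩
        pr s (P (pr s x +ᴹ pr (flip s) x))                 ≈⟨ pr.cong s (P.homo _ _) ⟩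
        pr s (P (pr s x) +ᴹ P (pr (flip s) x))             ≈⟨ pr.homo s _ _ ⟩
        pr s (P (pr s x)) +ᴹ pr s (P (pr (flip s) x))
          ≈⟨ +ᴹ-cong (pr-flip-hg s (hg-P s (pr-homogeneous s x))) (pr-hg s (hg-P′ s (pr-homogeneous (flip s) x))) ⟩
        0ᴹ +ᴹ P (pr (flip s) x)                            ≈⟨ +ᴹ-identityˡ _ ⟩
        P (pr (flip s) x)                                  ∎

      pr-Q : ∀ s x → pr s (Q x) ≈ᴹ Q (pr (flip s) x)
      pr-Q s x = begin
        pr s (Q x)                                         ≈⟨ pr.cong s (Q.cong (pr-sum′ s x)) ⟩
        pr s (Q (pr s x +ᴹ pr (flip s) x))                 ≈⟨ pr.cong s (Q.homo _ _) ⟩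
        pr s (Q (pr s x) +ᴹ Q (pr (flip s) x))             ≈⟨ pr.homo s _ _ ⟩
        pr s (Q (pr s x)) +ᴹ pr s (Q (pr (flip s) x))
          ≈⟨ +ᴹ-cong (pr-flip-hg s (hg-Q s (pr-homogeneous s x))) (pr-hg s (hg-Q′ s (pr-homogeneous (flip s) x))) ⟩
        0ᴹ +ᴹ Q (pr (flip s) x)                            ≈⟨ +ᴹ-identityˡ _ ⟩
        Q (pr (flip s) x)                                  ∎

      PP-balanced : ∀ x → P (P x) ≈ᴹ x · π
      PP-balanced x = ≈ᴹ-trans (PP x) (balanced σπ x)

      rad-hg : ∀ s {x} → Homogeneous s x → Rad x →
               ∃[ y ] ∃[ z ] (Homogeneous (flip s) y × Homogeneous (flip s) z × x ≈ᴹ P y +ᴹ Q z)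
      rad-hg s {x} h (y , z , p) =
        pr (flip s) y , pr (flip s) z , pr-homogeneous (flip s) y , pr-homogeneous (flip s) z , (begin
          x                                    ≈⟨ pr-hg s h ⟨
          pr s x                               ≈⟨ pr.cong s p ⟩
          pr s (P y +ᴹ Q z)                    ≈⟨ pr.homo s _ _ ⟩
          pr s (P y) +ᴹ pr s (Q z)             ≈⟨ +ᴹ-cong (pr-P s y) (pr-Q s z) ⟩
          P (pr (flip s) y) +ᴹ Q (pr (flip s) z) ∎)

      qdiv-hg : ∀ s {x y} → Homogeneous s x → x ≈ᴹ Q y → x ≈ᴹ Q (pr (flip s) y)
      qdiv-hg s h p = ≈ᴹ-trans (≈ᴹ-sym (pr-hg s h)) (≈ᴹ-trans (pr.cong s p) (pr-Q s _))

      rad⇒pinQ : ∀ {x} → Rad x → PinQ x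
      rad⇒pinQ {x} (y , z , p) = Q y +ᴹ P z , (begin
        P x                       ≈⟨ P.cong p ⟩
        P (P y +ᴹ Q z)            ≈⟨ P.homo _ _ ⟩
        P (P y) +ᴹ P (Q z)        ≈⟨ +ᴹ-cong (≈ᴹ-trans (PP-balanced y) (≈ᴹ-sym (QQ y))) (PQ≈QP z) ⟩
        Q (Q y) +ᴹ Q (P z)        ≈⟨ Q.homo _ _ ⟨
        Q (Q y +ᴹ P z)            ∎)

      module _ (torsionFree : π-TorsionFree) where
        Q-cancel : ∀ {x} → Q x ≈ᴹ 0ᴹ → x ≈ᴹ 0ᴹ
        Q-cancel p = torsionFree (≈ᴹ-trans (≈ᴹ-sym (QQ _)) (≈ᴹ-trans (Q.cong p) Q.zero-homo))

        P-cancel : ∀ {x} → P x ≈ᴹ 0ᴹ → x ≈ᴹ 0ᴹ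
        P-cancel p = torsionFree (≈ᴹ-trans (≈ᴹ-sym (PP-balanced _)) (≈ᴹ-trans (P.cong p) P.zero-homo))

        relation-swap : ∀ {y z} → P y +ᴹ Q z ≈ᴹ 0ᴹ → Q y +ᴹ P z ≈ᴹ 0ᴹ
        relation-swap {y} {z} p = P-cancel (begin
          P (Q y +ᴹ P z)            ≈⟨ P.homo _ _ ⟩
          P (Q y) +ᴹ P (P z)        ≈⟨ +ᴹ-cong (PQ≈QP y) (≈ᴹ-trans (PP-balanced z) (≈ᴹ-sym (QQ z))) ⟩
          Q (P y) +ᴹ Q (Q z)        ≈⟨ Q.homo _ _ ⟨
          Q (P y +ᴹ Q z)            ≈⟨ Q.cong p ⟩
          Q 0ᴹ                      ≈⟨ Q.zero-homo ⟩
          0ᴹ                        ∎)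

        -- P Q⁻¹ is a semilinear involution exchanging y and -z up to Q; these
        -- are its fixed vectors.
        P≈Q-combination : ∀ {y z} → P y +ᴹ Q z ≈ᴹ 0ᴹ → ∀ a →
                          P (y · a -ᴹ z · σ a) ≈ᴹ Q (y · a -ᴹ z · σ a)
        P≈Q-combination {y} {z} p a = begin
          P (y · a -ᴹ z · σ a)          ≈⟨ P.sub-homo _ _ ⟩
          P (y · a) -ᴹ P (z · σ a)      ≈⟨ +ᴹ-cong (P-· y a) (-ᴹ‿cong (P-· z (σ a))) ⟩
          P y · a -ᴹ P z · σ a          ≈⟨ exchange vanish ⟩
          Q y · σ a -ᴹ Q z · a          ≈⟨ +ᴹ-cong (Q-· y a) (-ᴹ‿cong (≈ᴹ-sym (Q-·σ z a))) ⟨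
          Q (y · a) -ᴹ Q (z · σ a)      ≈⟨ Q.sub-homo _ _ ⟨
          Q (y · a -ᴹ z · σ a)          ∎
          where
          vanish : P y · a +ᴹ Q z · a ≈ᴹ Q y · σ a +ᴹ P z · σ a
          vanish = begin
            P y · a +ᴹ Q z · a             ≈⟨ ·ₐ.homo _ _ ⟨
            (P y +ᴹ Q z) · a               ≈⟨ *ᵣ-congʳ p ⟩
            0ᴹ · a                         ≈⟨ ·ₐ.zero-homo ⟩
            0ᴹ                             ≈⟨ ·ₐ.zero-homo ⟨
            0ᴹ · σ a                       ≈⟨ *ᵣ-congʳ (relation-swap p) ⟨
            (Q y +ᴹ P z) · σ a             ≈⟨ ·ₐ.homo _ _ ⟩
            Q y · σ a +ᴹ P z · σ a         ∎

data Kind : Set where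
  thin thick : Kind

degree-cases : ∀ s d → d ≡ s ⊎ d ≡ flip s
degree-cases even even = inj₁ ≡.refl
degree-cases even odd  = inj₂ ≡.refl
degree-cases odd  even = inj₂ ≡.refl
degree-cases odd  odd  = inj₁ ≡.refl

module Modelled {ℓ} (S : CyclicOrder ℓ) where
  open CyclicOrder S
  open Homs R
  open Graded S
  module _ {M N : Bimod} (f : Hom M N) where
    private
      module M = On M
      module N = On N
      module f = Hom f

    hom-hg : ∀ s {x} → M.Homogeneous s x → N.Homogeneous s (f ⟨$⟩ x)
    hom-hg s h a = N.≈ᴹ-trans (N.≈ᴹ-sym (f.*ₗ-homo _ _)) (N.≈ᴹ-trans (f.cong (h a)) (f.*ᵣ-homo _ _))

    hom-rad : ∀ {x} → M.Rad x → N.Rad (f ⟨$⟩ x)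
    hom-rad (y , z , p) = f ⟨$⟩ y , f ⟨$⟩ z ,
      N.≈ᴹ-trans (f.cong p) (N.≈ᴹ-trans (f.+-homo _ _) (N.+ᴹ-cong (f.*ₗ-homo _ _) (f.*ᵣ-homo _ _)))

    hom-pinQ : ∀ {x} → M.PinQ x → N.PinQ (f ⟨$⟩ x)
    hom-pinQ (z , p) = f ⟨$⟩ z ,
      N.≈ᴹ-trans (N.≈ᴹ-sym (f.*ₗ-homo _ _)) (N.≈ᴹ-trans (f.cong p) (f.*ᵣ-homo _ _))

    hom-pr : ∀ s x → f ⟨$⟩ M.pr s x N.≈ᴹ N.pr s (f ⟨$⟩ x)
    hom-pr even x = N.≈ᴹ-trans (f.*ᵣ-homo _ _) (N.*ᵣ-congʳ (N.≈ᴹ-trans (f.sub-homo _ _)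
      (N.+ᴹ-cong (f.*ₗ-homo _ _) (N.-ᴹ‿cong (f.*ᵣ-homo _ _)))))
    hom-pr odd x = N.≈ᴹ-trans (f.*ᵣ-homo _ _) (N.*ᵣ-congʳ (N.≈ᴹ-trans (f.sub-homo _ _)
      (N.+ᴹ-cong (f.*ᵣ-homo _ _) (N.-ᴹ‿cong (f.*ₗ-homo _ _)))))

    image-closed : N.Closed (λ y → ∃[ x ] f ⟨$⟩ x N.≈ᴹ y)
    image-closed = record
      { resp  = λ p (x , q) → x , N.≈ᴹ-trans q p
      ; add   = λ (x , p) (y , q) → x M.+ᴹ y , N.≈ᴹ-trans (f.+-homo x y) (N.+ᴹ-cong p q)
      ; left  = λ α (x , p) → α M.*ₗ x , N.≈ᴹ-trans (f.*ₗ-homo α x) (N.*ₗ-congˡ p)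
      ; right = λ α (x , p) → x M.*ᵣ α , N.≈ᴹ-trans (f.*ᵣ-homo α x) (N.*ᵣ-congʳ p) }

  module _ (L : Bimod) where
    open On L
    Spec : Kind → Carrierᴹ → Set ℓ
    Spec thin  x = P x ≈ᴹ Q x
    Spec thick x = ¬ PinQ x

    Admits : Kind → Carrierᴹ → Set ℓ
    Admits thin  x = P x ≈ᴹ Q x
    Admits thick x = ⊤

  record Model (s : Degree) (κ : Kind) (X : Bimod) : Set (lsuc ℓ) where
    open On X
    field
      balanced    : Balanced
      torsionFree : π-TorsionFree
      separatedᴹ  : ∀ x → (∀ n → Div n x) → x ≈ᴹ 0ᴹ
      gen         : Carrierᴹ
      gen-hg      : Homogeneous s gen
      gen∉Rad     : ¬ Rad gen
      gen-kind    : Spec X κ gen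
      span        : ∀ x → ∃[ a ] ∃[ b ] ∃[ c ] ∃[ d ]
                    x ≈ᴹ (gen · a +ᴹ P (Q gen) · b) +ᴹ (P gen · c +ᴹ Q gen · d)
      universal   : ∀ (L : Bimod) → On.Balanced L → ∀ w → On.Homogeneous L s w → Admits L κ w →
                    Σ[ f ∈ Hom X L ] Bimodule._≈ᴹ_ L (f ⟨$⟩ gen) w

    open WhenBalanced balanced public

    private
      hg-even-part : ∀ a b → Homogeneous s (gen · a +ᴹ P (Q gen) · b)
      hg-even-part a b = hg-+ s (hg-· s gen-hg a) (hg-· s (hg-P′ s (hg-Q s gen-hg)) b)

      hg-odd-part : ∀ c d → Homogeneous (flip s) (P gen · c +ᴹ Q gen · d)
      hg-odd-part c d = hg-+ (flip s) (hg-· (flip s) (hg-P s gen-hg) c) (hg-· (flip s) (hg-Q s gen-hg) d)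

    span-hg : ∀ {x} → Homogeneous s x → ∃[ a ] ∃[ b ] x ≈ᴹ gen · a +ᴹ P (Q gen) · b
    span-hg {x} h with span x
    ... | a , b , c , d , p = a , b , (begin
      x                       ≈⟨ pr-hg s h ⟨
      pr s x                  ≈⟨ pr.cong s p ⟩
      pr s (_ +ᴹ _)           ≈⟨ pr.homo s _ _ ⟩
      pr s _ +ᴹ pr s _        ≈⟨ +ᴹ-cong (pr-hg s (hg-even-part a b)) (pr-flip-hg s (hg-odd-part c d)) ⟩
      (gen · a +ᴹ P (Q gen) · b) +ᴹ 0ᴹ ≈⟨ +ᴹ-identityʳ _ ⟩
      gen · a +ᴹ P (Q gen) · b         ∎)

    flip-hg⇒rad : ∀ {x} → Homogeneous (flip s) x → Rad x
    flip-hg⇒rad {x} h with span x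
    ... | a , b , c , d , p = rad-resp (≈ᴹ-sym eq) (rad-+ (rad-· (rad-P gen) c) (rad-· (rad-Q gen) d))
      where
      pr-even : pr (flip s) (gen · a +ᴹ P (Q gen) · b) ≈ᴹ 0ᴹ
      pr-even = pr-flip-hg (flip s) (≡.subst (λ t → Homogeneous t (gen · a +ᴹ P (Q gen) · b)) (≡.sym (flip-flip s)) (hg-even-part a b))
        where
        flip-flip : ∀ s → flip (flip s) ≡ s
        flip-flip even = ≡.refl
        flip-flip odd  = ≡.refl
      eq : x ≈ᴹ P gen · c +ᴹ Q gen · d
      eq = begin
        x                       ≈⟨ pr-hg (flip s) h ⟨
        pr (flip s) x           ≈⟨ pr.cong (flip s) p ⟩
        pr (flip s) (_ +ᴹ _)    ≈⟨ pr.homo (flip s) _ _ ⟩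
        pr (flip s) _ +ᴹ pr (flip s) _ ≈⟨ +ᴹ-cong pr-even (pr-hg (flip s) (hg-odd-part c d)) ⟩
        0ᴹ +ᴹ (P gen · c +ᴹ Q gen · d) ≈⟨ +ᴹ-identityˡ _ ⟩
        P gen · c +ᴹ Q gen · d         ∎

    gen-generates : Generates gen
    gen-generates closed n v with span v
    ... | a , b , c , d , p = resp (≈ᴹ-sym p)
      (add (add (right _ n) (right _ (left _ (right _ n)))) (add (right _ (left _ n)) (right _ (right _ n))))
      where open Closed closed

    private
      norm : A.Carrier → A.Carrier
      norm c = π A.* π A.* σ c A.* c

      1-norm-unit : ∀ c → ∃[ d ] (A.1# A.- norm c) A.* d A.≈ A.1#
      1-norm-unit c with local (A.1# A.- norm c)
      ... | inj₁ unit = unit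
      ... | inj₂ (b , eq) = contradiction 1≈ (π-nonunit (b A.+ π A.* σ c A.* c))
        where
        norm≈ : norm c A.≈ π A.* σ c A.* c A.* π
        norm≈ = A.trans (A.*-congʳ (A.*-assoc π π (σ c))) (A.trans (A.*-assoc π _ c) (A.*-comm π _))
        1≈ : A.1# A.≈ (b A.+ π A.* σ c A.* c) A.* π
        1≈ = A.trans (A.sym (A.+-identityʳ A.1#)) (A.trans (A.+-congˡ (A.sym (A.-‿inverseˡ (norm c))))
          (A.trans (A.sym (A.+-assoc _ _ _)) (A.trans (A.+-cong eq norm≈) (A.sym (A.distribʳ π _ _)))))

      PQPQ : ∀ c → P (Q (P (Q gen) · c)) ≈ᴹ gen · (π A.* π A.* σ c)
      PQPQ c = begin
        P (Q (P (Q gen) · c))         ≈⟨ P.cong (Q-· _ c) ⟩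
        P (Q (P (Q gen)) · σ c)       ≈⟨ P-· _ _ ⟩
        P (Q (P (Q gen))) · σ c       ≈⟨ *ᵣ-congʳ (P.cong (PQ≈QP _)) ⟨
        P (P (Q (Q gen))) · σ c       ≈⟨ *ᵣ-congʳ (PP-balanced _) ⟩
        Q (Q gen) · π · σ c           ≈⟨ *ᵣ-congʳ (*ᵣ-congʳ (QQ gen)) ⟩
        gen · π · π · σ c             ≈⟨ *ᵣ-congʳ (·-assoc gen π π) ⟩
        gen · (π A.* π) · σ c         ≈⟨ ·-assoc gen _ _ ⟩
        gen · (π A.* π A.* σ c)       ∎

    -- If u = gen·a + PQ gen·b with a a unit, then gen is recovered from u and
    -- PQ u because PQ is topologically nilpotent.
    generates : ∀ {x} → Homogeneous s x → ¬ Rad x → Generates x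
    generates {x} h x∉Rad {N} closed n with span-hg h
    ... | a , b , p with local a
    ...   | inj₂ (a′ , q) = contradiction
      (rad-resp (≈ᴹ-sym p) (rad-+ (rad-resp (·-congˡ (A.sym q)) (rad-·π gen a′)) (rad-· (rad-P _) b))) x∉Rad
    ...   | inj₁ (a′ , aa′) = gen-generates closed (resp recovered (right (emb (proj₁ unit)) N[gen·k]))
      where
      open Closed closed
      c = b A.* a′
      unit = 1-norm-unit c
      y = gen +ᴹ P (Q gen) · c
      x·a′≈y : x · a′ ≈ᴹ y
      x·a′≈y = begin
        x · a′                                   ≈⟨ *ᵣ-congʳ p ⟩
        (gen · a +ᴹ P (Q gen) · b) · a′          ≈⟨ ·ₐ.homo _ _ ⟩
        gen · a · a′ +ᴹ P (Q gen) · b · a′       ≈⟨ +ᴹ-cong (·-assoc _ _ _) (·-assoc _ _ _) ⟩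
        gen · (a A.* a′) +ᴹ P (Q gen) · c        ≈⟨ +ᴹ-congʳ (≈ᴹ-trans (·-congˡ aa′) (·-1 gen)) ⟩
        y                                        ∎
      N[y] : N y
      N[y] = resp x·a′≈y (right _ n)
      PQy : P (Q y) · c ≈ᴹ P (Q gen) · c +ᴹ gen · norm c
      PQy = begin
        P (Q y) · c                                      ≈⟨ *ᵣ-congʳ (≈ᴹ-trans (P.cong (Q.homo _ _)) (P.homo _ _)) ⟩
        (P (Q gen) +ᴹ P (Q (P (Q gen) · c))) · c         ≈⟨ *ᵣ-congʳ (+ᴹ-congˡ (PQPQ c)) ⟩
        (P (Q gen) +ᴹ gen · (π A.* π A.* σ c)) · c       ≈⟨ ·ₐ.homo _ _ ⟩
        P (Q gen) · c +ᴹ gen · (π A.* π A.* σ c) · c     ≈⟨ +ᴹ-congˡ (·-assoc _ _ _) ⟩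
        P (Q gen) · c +ᴹ gen · norm c                    ∎
      N[gen·k] : N (gen · (A.1# A.- norm c))
      N[gen·k] = resp (begin
        y -ᴹ P (Q y) · c               ≈⟨ exchange (≈ᴹ-trans (+ᴹ-assoc _ _ _) (+ᴹ-congˡ (≈ᴹ-sym PQy))) ⟩
        gen -ᴹ gen · norm c            ≈⟨ +ᴹ-congʳ (·-1 gen) ⟨
        gen · A.1# -ᴹ gen · norm c     ≈⟨ ·-sub gen _ _ ⟨
        gen · (A.1# A.- norm c)        ∎) (add N[y] (neg (right _ (left _ (right _ N[y])))))
      recovered : gen · (A.1# A.- norm c) · proj₁ unit ≈ᴹ gen
      recovered = ≈ᴹ-trans (·-assoc gen _ _) (≈ᴹ-trans (·-congˡ (proj₂ unit)) (·-1 gen))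

    rad-or-degree : ∀ d {x} → Homogeneous d x → ¬ Rad x → d ≡ s
    rad-or-degree d h x∉Rad with degree-cases s d
    ... | inj₁ eq     = eq
    ... | inj₂ ≡.refl = contradiction (flip-hg⇒rad h) x∉Rad

  thin⇒pinQ : ∀ {s X} → Model s thin X → ∀ x → On.PinQ X x
  thin⇒pinQ {X = X} m = gen-generates pinQ-closed (gen , gen-kind)
    where
    open Model m
    open On X

  thick⇒¬pinQ : ∀ {s X} (m : Model s thick X) → ∀ {x} → On.Homogeneous X s x → ¬ On.Rad X x → ¬ On.PinQ X x
  thick⇒¬pinQ {X = X} m h x∉Rad pinQ = Model.gen-kind m (Model.generates m h x∉Rad (On.pinQ-closed X) pinQ _)

Type : Set
Type = Degree × Kind

data Pick (t : Type) : List Type → List Type → Set where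
  here  : ∀ {ts} → Pick t (t ∷ ts) ts
  there : ∀ {u ts rs} → Pick t ts rs → Pick t (u ∷ ts) (u ∷ rs)

pick-↭ : ∀ {t ts rs} → Pick t ts rs → t ∷ rs ↭ ts
pick-↭ here      = ↭.↭-refl
pick-↭ (there p) = ↭.↭-trans (↭.swap _ _ ↭.↭-refl) (↭.prep _ (pick-↭ p))

kindWeight : Kind → ℕ
kindWeight thin  = 1
kindWeight thick = 2

weight : List Type → ℕ
weight []             = 0
weight ((_ , κ) ∷ ts) = kindWeight κ ℕ.+ weight ts

pick-weight : ∀ {s κ ts rs} → Pick (s , κ) ts rs → weight ts ≡ kindWeight κ ℕ.+ weight rs
pick-weight here = ≡.refl
pick-weight {κ = κ} (there {u = _ , κ′} {rs = rs} p) = ≡.trans (≡.cong (kindWeight κ′ ℕ.+_) (pick-weight p))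
  (≡.trans (≡.sym (ℕₚ.+-assoc (kindWeight κ′) (kindWeight κ) (weight rs)))
    (≡.trans (≡.cong (ℕ._+ weight rs) (ℕₚ.+-comm (kindWeight κ′) (kindWeight κ)))
      (ℕₚ.+-assoc (kindWeight κ) (kindWeight κ′) (weight rs))))

kindWeight>0 : ∀ κ → 0 ℕ.< kindWeight κ
kindWeight>0 thin  = ℕ.s≤s ℕ.z≤n
kindWeight>0 thick = ℕ.s≤s ℕ.z≤n

module Classification {ℓ} (em : ExcludedMiddle ℓ) (S : CyclicOrder ℓ)
  (X : Degree → Kind → Homs.Bimod (CyclicOrder.R S))
  (model : ∀ s κ → Modelled.Model S s κ (X s κ)) where
  open CyclicOrder S
  open Homs R
  open Graded S
  open Modelled S

  module X s κ = Model (model s κ)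

  Std : List Type → Bimod
  Std []             = 𝟘
  Std ((s , κ) ∷ ts) = X s κ ⊕ Std ts

  std-balanced : ∀ ts → On.Balanced (Std ts)
  std-balanced []             _ _       = _
  std-balanced ((s , κ) ∷ ts) p (x , y) = X.balanced s κ p x , std-balanced ts p y

  std-separated : ∀ ts x → (∀ n → On.Div (Std ts) n x) → Bimodule._≈ᴹ_ (Std ts) x (Bimodule.0ᴹ (Std ts))
  std-separated []             _       _ = _
  std-separated ((s , κ) ∷ ts) (x , y) h =
    X.separatedᴹ s κ x (λ n → proj₁ (div n (h n))) , std-separated ts y (λ n → proj₂ (div n (h n)))
    where
    div : ∀ n {x y} → On.Div (X s κ ⊕ Std ts) n (x , y) → On.Div (X s κ) n x × On.Div (Std ts) n y
    div zero    _ = _ , _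
    div (suc n) ((x′ , y′) , (p , q) , d) = let d₁ , d₂ = div n d in (x′ , p , d₁) , (y′ , q , d₂)

  pick-iso : ∀ {s κ ts rs} → Pick (s , κ) ts rs → Iso (Std ts) (X s κ ⊕ Std rs)
  pick-iso here = ≅-refl
  pick-iso {s} {κ} (there {u = s′ , κ′} {rs = rs} p) =
    ≅-trans (⊕-cong ≅-refl (pick-iso p)) (⊕-swap (X s′ κ′) (X s κ) (Std rs))

  component : ∀ {s κ ts rs} → Pick (s , κ) ts rs → Hom (Std ts) (X s κ)
  component p = fstH ∘H Iso.to (pick-iso p)

  find : (N : ∀ M → ∣ M ∣ → Set ℓ) → (∀ {x} → N 𝟘 x) →
         (∀ {M M′ x y} → N M x → N M′ y → N (M ⊕ M′) (x , y)) →
         ∀ ts x → ¬ N (Std ts) x →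
         ∃[ s ] ∃[ κ ] ∃[ rs ] Σ[ p ∈ Pick (s , κ) ts rs ] ¬ N (X s κ) (component p ⟨$⟩ x)
  find N N-𝟘 N-⊕ [] x ¬n = contradiction N-𝟘 ¬n
  find N N-𝟘 N-⊕ ((s , κ) ∷ ts) (x , y) ¬n with em {N (X s κ) x}
  ... | no ¬nx = s , κ , ts , here , ¬nx
  ... | yes nx with find N N-𝟘 N-⊕ ts y (λ ny → ¬n (N-⊕ {X s κ} {Std ts} nx ny))
  ...   | s′ , κ′ , rs , p , ¬n′ = s′ , κ′ , (s , κ) ∷ rs , there p , ¬n′

  find-rad : ∀ ts x → ¬ On.Rad (Std ts) x →
    ∃[ s ] ∃[ κ ] ∃[ rs ] Σ[ p ∈ Pick (s , κ) ts rs ] ¬ On.Rad (X s κ) (component p ⟨$⟩ x)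
  find-rad = find On.Rad (_ , _ , _)
    λ (y , z , p) (y′ , z′ , p′) → (y , y′) , (z , z′) , p , p′

  find-pinQ : ∀ ts x → ¬ On.PinQ (Std ts) x →
    ∃[ s ] ∃[ κ ] ∃[ rs ] Σ[ p ∈ Pick (s , κ) ts rs ] ¬ On.PinQ (X s κ) (component p ⟨$⟩ x)
  find-pinQ = find On.PinQ (_ , _) λ (z , p) (z′ , p′) → (z , z′) , p , p′

  -- If a generator u of M has the same image as some element of N′, then the
  -- summand M can be traded for N′.
  surjective-transfer : ∀ {M N N′ L} (Ψ : Hom (M ⊕ N) L) → Surjective Ψ →
    (Ψ′ : Hom N′ L) (g : Hom N N′) → let open Bimodule L in
    (∀ s → Ψ′ ⟨$⟩ (g ⟨$⟩ s) ≈ᴹ Ψ ⟨$⟩ (inrH {M} {N} ⟨$⟩ s)) →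
    ∀ {u} → On.Generates M u → ∃[ z ] Ψ′ ⟨$⟩ z ≈ᴹ Ψ ⟨$⟩ (inlH {M} {N} ⟨$⟩ u) →
    Surjective Ψ′
  surjective-transfer {M} {N} {N′} {L} Ψ surj Ψ′ g compat {u} gen u∈ y
    with surj y
  ... | (a , b) , p with gen {λ a → ∃[ z ] Ψ′ ⟨$⟩ z ≈ᴹ Ψ ⟨$⟩ (inlH {M} {N} ⟨$⟩ a)} closed u∈ a
    where
    open On L
    module Ψ = Hom (Ψ ∘H inlH {M} {N})
    module I = Closed (image-closed Ψ′)
    closed : On.Closed M (λ a → ∃[ z ] Ψ′ ⟨$⟩ z ≈ᴹ Ψ ⟨$⟩ (inlH {M} {N} ⟨$⟩ a))
    closed = record
      { resp  = λ p → I.resp (Ψ.cong p)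
      ; add   = λ m n → I.resp (≈ᴹ-sym (Ψ.+-homo _ _)) (I.add m n)
      ; left  = λ α n → I.resp (≈ᴹ-sym (Ψ.*ₗ-homo α _)) (I.left α n)
      ; right = λ α n → I.resp (≈ᴹ-sym (Ψ.*ᵣ-homo α _)) (I.right α n) }
  ... | z , q = z N′.+ᴹ g ⟨$⟩ b , (begin
    Ψ′ ⟨$⟩ (z N′.+ᴹ g ⟨$⟩ b)                 ≈⟨ Hom.+-homo Ψ′ _ _ ⟩
    Ψ′ ⟨$⟩ z +ᴹ Ψ′ ⟨$⟩ (g ⟨$⟩ b)             ≈⟨ +ᴹ-cong q (compat b) ⟩
    Ψ ⟨$⟩ (a , N.0ᴹ) +ᴹ Ψ ⟨$⟩ (M.0ᴹ , b)     ≈⟨ Hom.+-homo Ψ _ _ ⟨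
    Ψ ⟨$⟩ (a M.+ᴹ M.0ᴹ , N.0ᴹ N.+ᴹ b)        ≈⟨ Hom.cong Ψ (M.+ᴹ-identityʳ a , N.+ᴹ-identityˡ b) ⟩
    Ψ ⟨$⟩ (a , b)                            ≈⟨ p ⟩
    y                                        ∎)
    where
    open On L
    module N = Bimodule N
    module N′ = Bimodule N′
    module M = Bimodule M

  split-off : ∀ {M N L} (Ψ : Hom (M ⊕ N) L) → let open On L in
    ∀ x → Ψ ⟨$⟩ (inlH {M} {N} ⟨$⟩ proj₁ x) ≈ᴹ Ψ ⟨$⟩ x -ᴹ Ψ ⟨$⟩ (inrH {M} {N} ⟨$⟩ proj₂ x)
  split-off {M} {N} {L} Ψ (a , b) = isolate
    (≈ᴹ-trans (≈ᴹ-sym (Hom.+-homo Ψ _ _)) (Hom.cong Ψ (Bimodule.+ᴹ-identityʳ M a , Bimodule.+ᴹ-identityˡ N b)))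
    where open On L

  module Reduction (L : Bimod) (balanced : On.Balanced L) (torsionFree : On.π-TorsionFree L) where
    open On L
    open WhenBalanced balanced

    Reduced : List Type → Set ℓ
    Reduced ts = ∃[ ts′ ] (weight ts′ ℕ.< weight ts × Σ[ Φ ∈ Hom (Std ts′) L ] Surjective Φ)

    module _ {ts : List Type} (Φ : Hom (Std ts) L) (surj : Surjective Φ) where
      private
        module Φ = Hom Φ
        module T where
          open On (Std ts) public
          open On.WhenBalanced (Std ts) (std-balanced ts) public

      module _ {s κ rs} (p : Pick (s , κ) ts rs) where
        private
          module I = Iso (pick-iso p)

        Ψ : Hom (X s κ ⊕ Std rs) L
        Ψ = Φ ∘H I.from

        Ψ-surjective : Surjective Ψ
        Ψ-surjective y = let x , q = surj y in
          I.to ⟨$⟩ x , ≈ᴹ-trans (Φ.cong (I.from∘to x)) q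

        Ψ-inl : ∀ x → Ψ ⟨$⟩ (inlH {X s κ} {Std rs} ⟨$⟩ (component p ⟨$⟩ x)) ≈ᴹ
                Φ ⟨$⟩ x -ᴹ Ψ ⟨$⟩ (inrH {X s κ} {Std rs} ⟨$⟩ proj₂ (I.to ⟨$⟩ x))
        Ψ-inl x = ≈ᴹ-trans (split-off Ψ (I.to ⟨$⟩ x)) (+ᴹ-congʳ (Φ.cong (I.from∘to x)))

        drop : ∀ {x} → Φ ⟨$⟩ x ≈ᴹ 0ᴹ → On.Generates (X s κ) (component p ⟨$⟩ x) → Reduced ts
        drop {x} Φx≈0 gen = rs ,
          ≡.subst (weight rs ℕ.<_) (≡.sym (pick-weight p)) (ℕₚ.m<n+m (weight rs) (kindWeight>0 κ)) ,
          Ψ ∘H inrH {X s κ} {Std rs} ,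
          surjective-transfer Ψ Ψ-surjective (Ψ ∘H inrH {X s κ} {Std rs}) idH (λ _ → ≈ᴹ-refl) gen
            (Bimodule.-ᴹ_ (Std rs) v , (begin
              (Ψ ∘H inrH {X s κ} {Std rs}) ⟨$⟩ (Bimodule.-ᴹ_ (Std rs) v)   ≈⟨ Hom.neg-homo (Ψ ∘H inrH {X s κ} {Std rs}) v ⟩
              -ᴹ (Ψ ⟨$⟩ (inrH {X s κ} {Std rs} ⟨$⟩ v))                     ≈⟨ +ᴹ-identityˡ _ ⟨
              0ᴹ -ᴹ Ψ ⟨$⟩ (inrH {X s κ} {Std rs} ⟨$⟩ v)                    ≈⟨ +ᴹ-congʳ Φx≈0 ⟨
              Φ ⟨$⟩ x -ᴹ Ψ ⟨$⟩ (inrH {X s κ} {Std rs} ⟨$⟩ v)               ≈⟨ Ψ-inl x ⟨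
              _                                                           ∎))
          where v = proj₂ (I.to ⟨$⟩ x)

      module _ {s rs} (p : Pick (s , thick) ts rs) where
        private
          module I = Iso (pick-iso p)
          module T′ = X s thin

        replace : ∀ {w} → T.Homogeneous s w → P (Φ ⟨$⟩ w) ≈ᴹ Q (Φ ⟨$⟩ w) →
                  On.Generates (X s thick) (component p ⟨$⟩ w) → Reduced ts
        replace {w} hg fixed gen = (s , thin) ∷ rs ,
          ≡.subst (suc (weight rs) ℕ.<_) (≡.sym (pick-weight p)) (ℕₚ.n<1+n _) ,
          Ψ′ ,
          surjective-transfer (Ψ p) (Ψ-surjective p) Ψ′ (inrH {X s thin} {Std rs})
            (λ b → ≈ᴹ-trans (+ᴹ-congʳ (Hom.0-homo h)) (+ᴹ-identityˡ _)) gen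
            ((T′.gen , Bimodule.-ᴹ_ (Std rs) v) , (begin
              h ⟨$⟩ T′.gen +ᴹ (Ψ p ∘H inrH {X s thick} {Std rs}) ⟨$⟩ (Bimodule.-ᴹ_ (Std rs) v)
                ≈⟨ +ᴹ-cong h-gen (Hom.neg-homo (Ψ p ∘H inrH {X s thick} {Std rs}) v) ⟩
              Φ ⟨$⟩ w -ᴹ Ψ p ⟨$⟩ (inrH {X s thick} {Std rs} ⟨$⟩ v)  ≈⟨ Ψ-inl p w ⟨
              _                                                     ∎))
          where
          v = proj₂ (I.to ⟨$⟩ w)
          extension = T′.universal L balanced (Φ ⟨$⟩ w) (hom-hg Φ s hg) fixed
          h = proj₁ extension
          h-gen = proj₂ extension
          Ψ′ : Hom (X s thin ⊕ Std rs) L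
          Ψ′ = copair {X s thin} {Std rs} h (Ψ p ∘H inrH {X s thick} {Std rs})

      -- The two radical conditions at a = 1 and a = θ together would put
      -- y·(θ - σ θ) in the radical.
      nonradical-combination : ∀ {s κ y z} → ¬ On.PinQ (X s κ) y →
        let module M = On (X s κ) in ∃[ a ] ¬ M.Rad (y M.· a M.-ᴹ z M.· σ a)
      nonradical-combination {s} {κ} {y} {z} ¬pinQ
        with em {On.Rad (X s κ) (On._-ᴹ_ (X s κ) (On._·_ (X s κ) y A.1#) (On._·_ (X s κ) z (σ A.1#)))}
           | em {On.Rad (X s κ) (On._-ᴹ_ (X s κ) (On._·_ (X s κ) y θ) (On._·_ (X s κ) z (σ θ)))}
      ... | no ¬r | _     = A.1# , ¬r
      ... | yes _ | no ¬r = θ , ¬r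
      ... | yes r | yes r′ = contradiction (M.rad⇒pinQ rad-y) ¬pinQ
        where
        module M where
          open On (X s κ) public
          open On.WhenBalanced (X s κ) (X.balanced s κ) public
        open M using () renaming (_·_ to _•_; _-ᴹ_ to _-ₘ_)
        difference : (y • θ -ₘ z • σ θ) -ₘ (y • A.1# -ₘ z • σ A.1#) • σ θ M.≈ᴹ y • θ -ₘ y • σ θ
        difference = M.exchange (M.≈ᴹ-trans (M.+ᴹ-assoc _ _ _) (M.≈ᴹ-trans (M.+ᴹ-congˡ (M.+ᴹ-comm _ _))
          (M.+ᴹ-congˡ
            (M.≈ᴹ-sym (M.≈ᴹ-trans (M.·ₐ.sub-homo _ _) (M.+ᴹ-cong (M.*ᵣ-congʳ (M.·-1 y))
              (M.-ᴹ‿cong (M.*ᵣ-congʳ (M.≈ᴹ-trans (M.·-congˡ σ.1#-homo) (M.·-1 z))))))))))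
        rad-y : M.Rad y
        rad-y = M.rad-resp (M.≈ᴹ-trans (M.*ᵣ-congʳ difference) (M.[θ-σθ]u y))
          (M.rad-· (M.rad-+ r′ (M.rad-neg (M.rad-· r (σ θ)))) u)

      reduce : ∀ n d {x} → T.Homogeneous d x → Φ ⟨$⟩ x ≈ᴹ 0ᴹ → ¬ T.Div n x → Reduced ts
      reduce zero d hg Φx≈0 ¬div = contradiction _ ¬div
      reduce (suc n) d {x} hg Φx≈0 ¬div with em {T.QDiv x}
      ... | yes (y , p) = reduce n (flip d) (T.pr-homogeneous (flip d) y)
        (Q-cancel torsionFree (≈ᴹ-trans (≈ᴹ-sym (Φ.*ᵣ-homo _ _)) (≈ᴹ-trans (Φ.cong (T.≈ᴹ-sym x≈Qy)) Φx≈0)))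
        (λ div → ¬div (T.pr (flip d) y , x≈Qy , div))
        where x≈Qy = T.qdiv-hg d hg p
      ... | no ¬qdiv with em {T.Rad x}
      ...   | no ¬rad with find-rad ts x ¬rad
      ...     | s , κ , rs , p , ¬rad′
        with ≡.refl ← X.rad-or-degree s κ d (hom-hg (component p) d hg) ¬rad′
        = drop p Φx≈0 (X.generates d κ (hom-hg (component p) d hg) ¬rad′)
      reduce (suc n) d {x} hg Φx≈0 ¬div | no ¬qdiv | yes rad
        with T.rad-hg d hg rad
      ... | y , z , hy , hz , x≈
        with find-pinQ ts y (λ (v , q) → ¬qdiv (v T.+ᴹ z , T.≈ᴹ-trans x≈ (T.≈ᴹ-trans (T.+ᴹ-congʳ q) (T.≈ᴹ-sym (T.Q.homo v z)))))
      ... | s , thin , rs , p , ¬pinQ = contradiction (thin⇒pinQ (model s thin) _) ¬pinQ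
      ... | s , thick , rs , p , ¬pinQ
        with ≡.refl ← X.rad-or-degree s thick (flip d) (hom-hg (component p) (flip d) hy)
                        (λ r → ¬pinQ (X.rad⇒pinQ s thick r))
        with nonradical-combination {flip d} {thick} {z = component p ⟨$⟩ z} ¬pinQ
      ... | a , ¬rad = replace p hw fixed (X.generates (flip d) thick (hom-hg (component p) (flip d) hw)
              λ r → ¬rad (M.rad-resp (M.≈ᴹ-trans (f.sub-homo _ _) (M.+ᴹ-cong (f.*ᵣ-homo _ _) (M.-ᴹ‿cong (f.*ᵣ-homo _ _)))) r))

        where
        module M = On (X (flip d) thick)
        module f = Hom (component p)
        w = y T.· a T.-ᴹ z T.· σ a
        hw : T.Homogeneous (flip d) w
        hw = T.hg-+ (flip d) (T.hg-· (flip d) hy a) (T.hg-neg (flip d) (T.hg-· (flip d) hz (σ a)))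
        relation : P (Φ ⟨$⟩ y) +ᴹ Q (Φ ⟨$⟩ z) ≈ᴹ 0ᴹ
        relation = begin
          P (Φ ⟨$⟩ y) +ᴹ Q (Φ ⟨$⟩ z)   ≈⟨ +ᴹ-cong (Φ.*ₗ-homo _ _) (Φ.*ᵣ-homo _ _) ⟨
          _                            ≈⟨ Φ.+-homo _ _ ⟨
          Φ ⟨$⟩ (T.P y T.+ᴹ T.Q z)     ≈⟨ Φ.cong x≈ ⟨
          Φ ⟨$⟩ x                      ≈⟨ Φx≈0 ⟩
          0ᴹ                           ∎
        Φw : Φ ⟨$⟩ w ≈ᴹ Φ ⟨$⟩ y · a -ᴹ Φ ⟨$⟩ z · σ a
        Φw = ≈ᴹ-trans (Φ.sub-homo _ _) (+ᴹ-cong (Φ.*ᵣ-homo _ _) (-ᴹ‿cong (Φ.*ᵣ-homo _ _)))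
        fixed : P (Φ ⟨$⟩ w) ≈ᴹ Q (Φ ⟨$⟩ w)
        fixed = ≈ᴹ-trans (P.cong Φw) (≈ᴹ-trans (P≈Q-combination torsionFree relation a) (≈ᴹ-sym (Q.cong Φw)))

  module Existence (L : Bimod) (balanced : On.Balanced L) (torsionFree : On.π-TorsionFree L) where
    open On L
    open Reduction L balanced torsionFree

    injective-or-reduced : ∀ {ts} (Φ : Hom (Std ts) L) → Surjective Φ → Injective Φ ⊎ Reduced ts
    injective-or-reduced {ts} Φ surj with em {∃[ x ] (Φ ⟨$⟩ x ≈ᴹ 0ᴹ × ¬ x T.≈ᴹ T.0ᴹ)}
      where module T = On (Std ts)
    ... | no ¬ker = inj₁ λ {x} {y} p → T.x-y≈0⇒x≈y x y
      (decidable-stable em λ ≉0 → ¬ker (_ , ≈ᴹ-trans (Hom.sub-homo Φ x y) (x-x≈0 p) , ≉0))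
      where module T = On (Std ts)
    ... | yes (x , Φx≈0 , x≉0) = inj₂ (reduced em)
      where
      module T where
        open On (Std ts) public
        open On.WhenBalanced (Std ts) (std-balanced ts) public
      from-component : ∀ d → ¬ T.pr d x T.≈ᴹ T.0ᴹ → Reduced ts
      from-component d ≉0 with em {∃[ n ] ¬ T.Div n (T.pr d x)}
      ... | yes (n , ¬div) = reduce {ts} Φ surj n d (T.pr-homogeneous d x)
              (≈ᴹ-trans (hom-pr Φ d x) (≈ᴹ-trans (pr.cong d Φx≈0) (pr.zero-homo d))) ¬div
      ... | no  none = contradiction
              (std-separated ts _ λ n → decidable-stable em λ ¬div → none (n , ¬div)) ≉0
      reduced : Dec (T.pr even x T.≈ᴹ T.0ᴹ) → Reduced ts
      reduced (no ≉0) = from-component even ≉0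
      reduced (yes ≈0) = from-component odd λ ≈0′ → x≉0
        (T.≈ᴹ-trans (T.pr-sum x) (T.≈ᴹ-trans (T.+ᴹ-cong ≈0 ≈0′) (T.+ᴹ-identityˡ _)))

    decompose : ∀ n {ts} → weight ts ℕ.< n → (Φ : Hom (Std ts) L) → Surjective Φ → ∃[ ts′ ] Iso (Std ts′) L
    decompose (suc n) {ts} (ℕ.s≤s w≤n) Φ surj with injective-or-reduced {ts} Φ surj
    ... | inj₁ inj = ts , bijective⇒iso Φ inj surj
    ... | inj₂ (ts′ , w′<w , Φ′ , surj′) = decompose n {ts′} (ℕₚ.<-≤-trans w′<w w≤n) Φ′ surj′

    -- The standard bimodules surject onto anything generated by finitely many
    -- elements, two thick summands being enough for each generator.
    cover : ∀ n (g : Fin n → Carrierᴹ) → ∃[ ts ] Σ[ Φ ∈ Hom (Std ts) L ] (∀ i → ∃[ x ] Φ ⟨$⟩ x ≈ᴹ g i)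
    cover zero    g = [] , zeroH , λ ()
    cover (suc n) g with cover n (g ∘ suc)
    ... | ts , Φ , hit = (even , thick) ∷ (odd , thick) ∷ ts , Φ′ , hit′
      where
      open WhenBalanced balanced
      g₀ = g zero
      E = X.universal even thick L balanced (pr even g₀) (pr-homogeneous even g₀) _
      O = X.universal odd  thick L balanced (pr odd  g₀) (pr-homogeneous odd  g₀) _
      rest = copair {X odd thick} {Std ts} (proj₁ O) Φ
      Φ′ : Hom (Std ((even , thick) ∷ (odd , thick) ∷ ts)) L
      Φ′ = copair {X even thick} {X odd thick ⊕ Std ts} (proj₁ E) rest
      hit′ : ∀ i → ∃[ x ] Φ′ ⟨$⟩ x ≈ᴹ g i
      hit′ (suc i) = let x , p = hit i in
        (Bimodule.0ᴹ (X even thick) , Bimodule.0ᴹ (X odd thick) , x) ,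
        ≈ᴹ-trans (+ᴹ-cong (Hom.0-homo (proj₁ E)) (+ᴹ-congʳ (Hom.0-homo (proj₁ O))))
          (≈ᴹ-trans (+ᴹ-identityˡ _) (≈ᴹ-trans (+ᴹ-identityˡ _) p))
      hit′ zero = (X.gen even thick , X.gen odd thick , Bimodule.0ᴹ (Std ts)) , (begin
        proj₁ E ⟨$⟩ X.gen even thick +ᴹ (proj₁ O ⟨$⟩ X.gen odd thick +ᴹ Φ ⟨$⟩ Bimodule.0ᴹ (Std ts))
          ≈⟨ +ᴹ-cong (proj₂ E) (+ᴹ-cong (proj₂ O) (Hom.0-homo Φ)) ⟩
        pr even g₀ +ᴹ (pr odd g₀ +ᴹ 0ᴹ)   ≈⟨ +ᴹ-congˡ (+ᴹ-identityʳ _) ⟩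
        pr even g₀ +ᴹ pr odd g₀           ≈⟨ pr-sum g₀ ⟨
        g₀                                ∎)

    existence : ∀ n (g : Fin n → Carrierᴹ) → (∀ {N} → Closed N → N 0ᴹ → (∀ i → N (g i)) → ∀ x → N x) →
                ∃[ ts ] Iso (Std ts) L
    existence n g generated = let ts , Φ , hit = cover n g in
      decompose (suc (weight ts)) {ts} ℕₚ.≤-refl Φ (generated (image-closed Φ) (_ , Hom.0-homo Φ) hit)

  weight>0 : ∀ t ts → 0 ℕ.< weight (t ∷ ts)
  weight>0 (_ , κ) ts = ℕₚ.<-≤-trans (kindWeight>0 κ) (ℕₚ.m≤m+n _ _)

  no-smaller-cover : ∀ s κ ts → weight ts ℕ.< kindWeight κ → (Φ : Hom (Std ts) (X s κ)) → ¬ Surjective Φ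
  no-smaller-cover s κ [] _ Φ surj = let x , p = surj gen in
    gen∉Rad (0ᴹ , 0ᴹ , (begin
      gen            ≈⟨ p ⟨
      Φ ⟨$⟩ _        ≈⟨ Hom.0-homo Φ ⟩
      0ᴹ             ≈⟨ +ᴹ-identityˡ 0ᴹ ⟨
      0ᴹ +ᴹ 0ᴹ       ≈⟨ +ᴹ-cong P.zero-homo Q.zero-homo ⟨
      P 0ᴹ +ᴹ Q 0ᴹ   ∎))
    where
    open On (X s κ)
    open Model (model s κ) using (gen; gen∉Rad)
  no-smaller-cover s thin (t ∷ ts) w<1 Φ surj = contradiction w<1 (ℕₚ.≤⇒≯ (weight>0 t ts))
  no-smaller-cover s thick ((s′ , thin) ∷ []) _ Φ surj =
    let (x , _) , p = surj (X.gen s thick)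
        z , q = thin⇒pinQ (model s′ thin) x
    in X.gen-kind s thick (Closed.resp pinQ-closed p (hom-pinQ Φ {x = x , _} ((z , _) , q , _)))
    where open On (X s thick)
  no-smaller-cover s thick ((s′ , thin) ∷ t ∷ ts) (ℕ.s≤s w<1) Φ surj = contradiction w<1 (ℕₚ.≤⇒≯ (weight>0 t ts))
  no-smaller-cover s thick ((s′ , thick) ∷ ts) (ℕ.s≤s (ℕ.s≤s ())) Φ surj

  surjective-endo⇒injective : ∀ {s κ} (f : Hom (X s κ) (X s κ)) → Surjective f → Injective f
  surjective-endo⇒injective {s} {κ} f surj
    with Existence.injective-or-reduced (X s κ) (X.balanced s κ) (X.torsionFree s κ)
           {(s , κ) ∷ []} (f ∘H fstH {X s κ} {𝟘}) (λ y → let x , p = surj y in (x , _) , p)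
  ... | inj₁ inj = λ p → proj₁ (inj p)
  ... | inj₂ (ts , w< , Φ , surj′) = contradiction surj′
    (no-smaller-cover s κ ts (≡.subst (weight ts ℕ.<_) (ℕₚ.+-identityʳ _) w<) Φ)

  -- For each s the equation pr₁ Φ(v , s) = 0 has a unique solution v, and
  -- s ↦ pr₂ Φ(v , s) is the required isomorphism.
  cancel : ∀ {M N N′} (Φ : Iso (M ⊕ N) (M ⊕ N′)) →
           let f = fstH {M} {N′} ∘H Iso.to Φ ∘H inlH {M} {N} in
           Injective f → Surjective f → Iso N N′
  cancel {M} {N} {N′} Φ inj surj = bijective⇒iso h h-injective h-surjective
    where
    module M = On M
    module N = Bimodule N
    module N′ = Bimodule N′
    module Φ = Iso Φ
    module Φₕ = Hom Φ.to
    module MN′ = Bimodule (M ⊕ N′)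
    Solution : ∣ M ∣ → ∣ N ∣ → ∣ N′ ∣ → Set ℓ
    Solution v x y = Φ.to ⟨$⟩ (v , x) MN′.≈ᴹ (M.0ᴹ , y)
    f = fstH {M} {N′} ∘H Φ.to ∘H inlH {M} {N}
    solve : ∀ x → ∃[ v ] ∃[ y ] Solution v x y
    solve x with surj (M.-ᴹ proj₁ (Φ.to ⟨$⟩ (M.0ᴹ , x)))
    ... | v , p = v , proj₂ (Φ.to ⟨$⟩ (v , x)) , (M.≈ᴹ-trans (M.≈ᴹ-trans
        (proj₁ (Φₕ.cong (M.≈ᴹ-sym (M.+ᴹ-identityʳ v) , N.≈ᴹ-sym (N.+ᴹ-identityˡ x))))
        (proj₁ (Φₕ.+-homo (v , N.0ᴹ) (M.0ᴹ , x))))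
        (M.≈ᴹ-trans (M.+ᴹ-congʳ p) (M.-ᴹ‿inverseˡ _))) , N′.≈ᴹ-refl
    unique : ∀ {v v′ x x′ y y′} → x N.≈ᴹ x′ → Solution v x y → Solution v′ x′ y′ → y N′.≈ᴹ y′
    unique {v} {v′} {x} {x′} p s s′ = N′.≈ᴹ-trans (N′.≈ᴹ-sym (proj₂ s)) (N′.≈ᴹ-trans (proj₂ (Φₕ.cong (v≈v′ , p))) (proj₂ s′))
      where
      open M
      image : ∀ v x → f ⟨$⟩ v ≈ᴹ proj₁ (Φ.to ⟨$⟩ (v , x)) -ᴹ proj₁ (Φ.to ⟨$⟩ (0ᴹ , x))
      image v x = split-off (fstH {M} {N′} ∘H Φ.to) (v , x)
      v≈v′ : v ≈ᴹ v′
      v≈v′ = inj (begin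
        f ⟨$⟩ v                                                     ≈⟨ image v x ⟩
        proj₁ (Φ.to ⟨$⟩ (v , x)) -ᴹ proj₁ (Φ.to ⟨$⟩ (0ᴹ , x))
          ≈⟨ +ᴹ-cong (≈ᴹ-trans (proj₁ s) (≈ᴹ-sym (proj₁ s′))) (-ᴹ‿cong (proj₁ (Φₕ.cong (≈ᴹ-refl , p)))) ⟩
        proj₁ (Φ.to ⟨$⟩ (v′ , x′)) -ᴹ proj₁ (Φ.to ⟨$⟩ (0ᴹ , x′))    ≈⟨ image v′ x′ ⟨
        f ⟨$⟩ v′                                                    ∎)
    value : ∀ x → ∣ N′ ∣
    value x = proj₁ (proj₂ (solve x))
    solution : ∀ x → Solution (proj₁ (solve x)) x (value x)
    solution x = proj₂ (proj₂ (solve x))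
    h : Hom N N′
    h = record
      { fun = value
      ; cong = λ {x} {y} p → unique p (solution x) (solution y)
      ; +-homo = λ x y → unique N.≈ᴹ-refl (solution (x N.+ᴹ y))
          (MN′.≈ᴹ-trans (Φₕ.+-homo _ _) (MN′.≈ᴹ-trans (MN′.+ᴹ-cong (solution x) (solution y)) (M.+ᴹ-identityˡ _ , N′.≈ᴹ-refl)))
      ; *ₗ-homo = λ α x → unique N.≈ᴹ-refl (solution (α N.*ₗ x))
          (MN′.≈ᴹ-trans (Φₕ.*ₗ-homo α _) (MN′.≈ᴹ-trans (MN′.*ₗ-congˡ (solution x)) (M.*ₗ-zeroʳ α , N′.≈ᴹ-refl)))
      ; *ᵣ-homo = λ α x → unique N.≈ᴹ-refl (solution (x N.*ᵣ α))
          (MN′.≈ᴹ-trans (Φₕ.*ᵣ-homo α _) (MN′.≈ᴹ-trans (MN′.*ᵣ-congʳ (solution x)) (M.*ᵣ-zeroˡ α , N′.≈ᴹ-refl))) }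
    h-injective : Injective h
    h-injective {x} {y} p = proj₂ (Φ.injective (MN′.≈ᴹ-trans (solution x)
      (MN′.≈ᴹ-trans (M.≈ᴹ-refl , p) (MN′.≈ᴹ-sym (solution y)))))
    h-surjective : Surjective h
    h-surjective y with Φ.surjective (M.0ᴹ , y)
    ... | (v , x) , p = x , unique N.≈ᴹ-refl (solution x) p

  cancel-model : ∀ {s κ N N′} (Φ : Iso (X s κ ⊕ N) (X s κ ⊕ N′)) →
    ¬ On.Rad (X s κ) (proj₁ (Iso.to Φ ⟨$⟩ (X.gen s κ , Bimodule.0ᴹ N))) → Iso N N′
  cancel-model {s} {κ} {N} {N′} Φ ∉Rad = cancel Φ (surjective-endo⇒injective f surj) surj
    where
    f = fstH {X s κ} {N′} ∘H Iso.to Φ ∘H inlH {X s κ} {N}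
    surj : Surjective f
    surj = X.generates s κ (hom-hg f s (X.gen-hg s κ)) ∉Rad (image-closed f) (_ , Bimodule.≈ᴹ-refl (X s κ))

  find-summand : ∀ {s κ N} ts (Φ : Iso (X s κ ⊕ N) (Std ts)) →
    ∃[ rs ] Σ[ p ∈ Pick (s , κ) ts rs ] ¬ On.Rad (X s κ) (component p ⟨$⟩ (Iso.to Φ ⟨$⟩ (X.gen s κ , Bimodule.0ᴹ N)))
  find-summand {s} {κ} {N} ts Φ = search κ ≡.refl
    where
    module Φ = Iso Φ
    ι = inlH {X s κ} {N}
    g = Φ.to ⟨$⟩ (ι ⟨$⟩ X.gen s κ)
    hg : On.Homogeneous (Std ts) s g
    hg = hom-hg (Φ.to ∘H ι) s (X.gen-hg s κ)
    back = fstH {X s κ} {N} ∘H Φ.from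
    back-g : Bimodule._≈ᴹ_ (X s κ) (back ⟨$⟩ g) (X.gen s κ)
    back-g = proj₁ (Φ.from∘to (ι ⟨$⟩ X.gen s κ))
    Result = ∃[ rs ] Σ[ p ∈ Pick (s , κ) ts rs ] ¬ On.Rad (X s κ) (component p ⟨$⟩ g)
    search : ∀ κ′ → κ ≡ κ′ → Result
    search thin ≡.refl
      with find-rad ts g (λ r → X.gen∉Rad s κ (On.rad-resp (X s κ) back-g (hom-rad back r)))
    ... | s′ , κ′ , rs , p , ∉Rad with ≡.refl ← X.rad-or-degree s′ κ′ s (hom-hg (component p) s hg) ∉Rad
      with κ′
    ...   | thin  = rs , p , ∉Rad
    ...   | thick = contradiction
      (hom-pinQ (component p ∘H Φ.to ∘H ι) (X.gen s thin , X.gen-kind s thin))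
      (thick⇒¬pinQ (model s thick) (hom-hg (component p) s hg) ∉Rad)
    search thick ≡.refl
      with find-pinQ ts g (λ r → X.gen-kind s κ (On.Closed.resp (On.pinQ-closed (X s κ)) back-g (hom-pinQ back r)))
    ... | s′ , thin , rs , p , ¬pinQ = contradiction (thin⇒pinQ (model s′ thin) _) ¬pinQ
    ... | s′ , thick , rs , p , ¬pinQ
      with ∉Rad ← (λ r → ¬pinQ (X.rad⇒pinQ s′ thick r))
      with ≡.refl ← X.rad-or-degree s′ thick s (hom-hg (component p) s hg) ∉Rad = rs , p , ∉Rad

  unique : ∀ ts ts′ → Iso (Std ts) (Std ts′) → ts ↭ ts′
  unique [] [] Φ = ↭.↭-refl
  unique [] ((s , κ) ∷ ts′) Φ = contradiction (λ y → let x , p = Iso.surjective Φ (y , Bimodule.0ᴹ (Std ts′)) in x , proj₁ p)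
    (no-smaller-cover s κ [] (kindWeight>0 κ) (fstH {X s κ} {Std ts′} ∘H Iso.to Φ))
  unique ((s , κ) ∷ ts) ts′ Φ with find-summand ts′ Φ
  ... | rs , p , ∉Rad = ↭.↭-trans (↭.prep _ (unique ts rs (cancel-model (≅-trans Φ (pick-iso p)) ∉Rad))) (pick-↭ p)

-- Unramified quadratic extensions

record Involution {ℓ} (A : CommutativeRing ℓ ℓ) : Set ℓ where
  open CommutativeRing A
  field
    σ     : Carrier → Carrier
    σ-hom : IsRingHomomorphism rawRing rawRing σ
    σσ    : ∀ a → σ (σ a) ≈ a

module SplitInvolution {ℓ} (A : CommutativeRing ℓ ℓ) (I : Involution A) where
  open CommutativeRing A
  open Involution I
  open SetoidReasoning setoid
  private module σ = IsRingHomomorphism σ-hom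
  open Solver commutativeSemiring using (solve; _:+_; _:*_; _:=_)

  sub-add : ∀ x y → x ≈ y + (x - y)
  sub-add x y = begin
    x               ≈⟨ +-identityʳ x ⟨
    x + 0#          ≈⟨ +-congˡ (-‿inverseˡ y) ⟨
    x + (- y + y)   ≈⟨ solve 3 (λ x y n → x :+ (n :+ y) := y :+ (x :+ n)) refl x y (- y) ⟩
    y + (x - y)     ∎

  +-cancelʳ : ∀ z {x y} → x + z ≈ y + z → x ≈ y
  +-cancelʳ z {x} {y} p = begin
    x               ≈⟨ lemma x ⟨
    x + z - z       ≈⟨ +-congʳ p ⟩
    y + z - z       ≈⟨ lemma y ⟩
    y               ∎
    where
    lemma : ∀ x → x + z - z ≈ x
    lemma x = trans (+-assoc _ _ _) (trans (+-congˡ (-‿inverseʳ z)) (+-identityʳ x))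

  -- If θ - σ θ is a unit, then a = f + g θ with g = (a - σ a)/(θ - σ θ).
  fixed-coordinates : ∀ θ u → (θ - σ θ) * u ≈ 1# →
    ∀ a → ∃[ f ] ∃[ g ] (σ f ≈ f × σ g ≈ g × a ≈ f + g * θ)
  fixed-coordinates θ u unit a = f , g , σf≈f , σg≈g , a≈
    where
    δ = θ - σ θ
    g = (a - σ a) * u
    f = a - g * θ
    a≈ : a ≈ f + g * θ
    a≈ = trans (sub-add a (g * θ)) (+-comm _ _)
    θ≈ : θ ≈ σ θ + δ
    θ≈ = sub-add θ (σ θ)
    gδ : σ a + g * δ ≈ a
    gδ = begin
      σ a + (a - σ a) * u * δ    ≈⟨ +-congˡ (solve 3 (λ d u δ → d :* u :* δ := d :* (δ :* u)) refl (a - σ a) u δ) ⟩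
      σ a + (a - σ a) * (δ * u)  ≈⟨ +-congˡ (trans (*-congˡ unit) (*-identityʳ _)) ⟩
      σ a + (a - σ a)            ≈⟨ sub-add a (σ a) ⟨
      a                          ∎
    σδ : σ δ + δ ≈ 0#
    σδ = begin
      σ (θ - σ θ) + (θ - σ θ)       ≈⟨ +-congʳ (trans (σ.+-homo _ _) (+-congˡ (trans (σ.-‿homo _) (-‿cong (σσ θ))))) ⟩
      σ θ - θ + (θ - σ θ)           ≈⟨ solve 4 (λ a b c d → a :+ b :+ (c :+ d) := a :+ d :+ (c :+ b)) refl (σ θ) (- θ) θ (- σ θ) ⟩
      (σ θ - σ θ) + (θ - θ)         ≈⟨ +-cong (-‿inverseʳ _) (-‿inverseʳ _) ⟩
      0# + 0#                       ≈⟨ +-identityˡ 0# ⟩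
      0#                            ∎
    σgδ : σ a + σ g * δ ≈ a
    σgδ = +-cancelʳ (σ g * σ δ) (begin
      σ a + σ g * δ + σ g * σ δ     ≈⟨ solve 4 (λ a g d e → a :+ g :* d :+ g :* e := a :+ g :* (e :+ d)) refl (σ a) (σ g) δ (σ δ) ⟩
      σ a + σ g * (σ δ + δ)         ≈⟨ +-congˡ (trans (*-congˡ σδ) (zeroʳ _)) ⟩
      σ a + 0#                      ≈⟨ +-identityʳ _ ⟩
      σ a                           ≈⟨ σ.⟦⟧-cong gδ ⟨
      σ (σ a + g * δ)               ≈⟨ trans (σ.+-homo _ _) (+-cong (σσ a) (σ.*-homo _ _)) ⟩
      a + σ g * σ δ                 ∎)
    δ-cancel : ∀ {x y} → x * δ ≈ y * δ → x ≈ y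
    δ-cancel {x} {y} p = begin
      x              ≈⟨ lemma x ⟨
      x * δ * u      ≈⟨ *-congʳ p ⟩
      y * δ * u      ≈⟨ lemma y ⟩
      y              ∎
      where
      lemma : ∀ x → x * δ * u ≈ x
      lemma x = trans (*-assoc _ _ _) (trans (*-congˡ unit) (*-identityʳ x))
    σg≈g : σ g ≈ g
    σg≈g = δ-cancel (+-cancelʳ (σ a) (trans (+-comm _ _) (trans σgδ (trans (sym gδ) (+-comm _ _)))))
    σf≈f : σ f ≈ f
    σf≈f = +-cancelʳ (g * θ) (begin
      σ f + g * θ              ≈⟨ +-congˡ (*-congˡ θ≈) ⟩
      σ f + g * (σ θ + δ)      ≈⟨ solve 4 (λ f g t d → f :+ g :* (t :+ d) := (f :+ g :* t) :+ g :* d) refl (σ f) g (σ θ) δ ⟩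
      σ f + g * σ θ + g * δ    ≈⟨ +-congʳ (+-congˡ (*-congʳ σg≈g)) ⟨
      σ f + σ g * σ θ + g * δ  ≈⟨ +-congʳ (trans (σ.⟦⟧-cong a≈) (trans (σ.+-homo _ _) (+-congˡ (σ.*-homo _ _)))) ⟨
      σ a + g * δ              ≈⟨ gδ ⟩
      a                        ≈⟨ a≈ ⟩
      f + g * θ                ∎)

record FiniteResidueDVR {ℓ} (A : CommutativeRing ℓ ℓ) (I : Involution A) : Set ℓ where
  open CommutativeRing A
  open Involution I
  field
    π         : Carrier
    σπ        : σ π ≈ π
    local     : ∀ a → (∃[ b ] a * b ≈ 1#) ⊎ (∃[ b ] a ≈ b * π)
    π-nonunit : ∀ b → ¬ 1# ≈ b * π
    separated : ∀ a → (∀ n → Divides^ A π n a) → a ≈ 0#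
    residues  : ∃[ q ] Σ[ r ∈ (Fin q → Carrier) ] (∀ x → ∃[ i ] ∃[ b ] x ≈ r i + b * π)

module NontrivialInvolution {ℓ} (em : ExcludedMiddle ℓ) (A : CommutativeRing ℓ ℓ) (I : Involution A)
  (D : FiniteResidueDVR A I) where
  open CommutativeRing A
  open Involution I
  open FiniteResidueDVR D
  open RingProperties ring using (x∙y⁻¹≈ε⇒x≈y)
  open SetoidReasoning setoid
  open SplitInvolution A I using (sub-add; +-cancelʳ)
  private module σ = IsRingHomomorphism σ-hom
  open Solver commutativeSemiring using (solve; _:+_; _:*_; con; _:=_)

  infix 4 _≡π_
  _≡π_ : Carrier → Carrier → Set ℓ
  x ≡π y = ∃[ b ] x ≈ y + b * π

  ≡π-sym : ∀ {x y} → x ≡π y → y ≡π x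
  ≡π-sym {x} {y} (b , p) = - b , +-cancelʳ (b * π) (begin
    y + b * π                  ≈⟨ p ⟨
    x                          ≈⟨ +-identityʳ x ⟨
    x + 0#                     ≈⟨ +-congˡ (trans (*-congʳ (-‿inverseˡ b)) (zeroˡ π)) ⟨
    x + (- b + b) * π          ≈⟨ solve 4 (λ x n b π → x :+ (n :+ b) :* π := x :+ n :* π :+ b :* π) refl x (- b) b π ⟩
    x + - b * π + b * π        ∎)

  ≡π-trans : ∀ {x y z} → x ≡π y → y ≡π z → x ≡π z
  ≡π-trans {x} {y} {z} (b , p) (c , q) = c + b , (begin
    x                      ≈⟨ p ⟩
    y + b * π              ≈⟨ +-congʳ q ⟩
    z + c * π + b * π      ≈⟨ solve 4 (λ z c b π → z :+ c :* π :+ b :* π := z :+ (c :+ b) :* π) refl z c b π ⟩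
    z + (c + b) * π        ∎)

  1+aπ≉bπ : ∀ a b → ¬ 1# + a * π ≈ b * π
  1+aπ≉bπ a b p = π-nonunit (b - a) (+-cancelʳ (a * π) (begin
    1# + a * π                ≈⟨ p ⟩
    b * π                     ≈⟨ *-congʳ (sub-add b a) ⟩
    (a + (b - a)) * π         ≈⟨ solve 3 (λ a d π → (a :+ d) :* π := d :* π :+ a :* π) refl a (b - a) π ⟩
    (b - a) * π + a * π       ∎))

  module _ (2≡0 : ∃[ b ] 1# + 1# ≈ b * π) where
    sq-injective : ∀ {y z} → y * y ≡π z * z → y ≡π z
    sq-injective {y} {z} (c , p) with local (y - z)
    ... | inj₂ (b , q) = b , trans (sub-add y z) (+-congˡ q)
    ... | inj₁ (w , unit) = contradiction (begin
      1# + b * (z * d) * (w * w) * π             ≈⟨ +-congʳ (trans (*-cong unit unit) (*-identityˡ 1#)) ⟨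
      d * w * (d * w) + b * (z * d) * (w * w) * π
        ≈⟨ +-cong (solve 2 (λ d w → d :* w :* (d :* w) := d :* d :* (w :* w)) refl d w)
                  (solve 4 (λ b e v π → b :* e :* v :* π := b :* π :* e :* v) refl b (z * d) (w * w) π) ⟩
      d * d * (w * w) + b * π * (z * d) * (w * w) ≈⟨ distribʳ _ _ _ ⟨
      (d * d + b * π * (z * d)) * (w * w)        ≈⟨ *-congʳ (+-congˡ (*-congʳ 2≈)) ⟨
      (d * d + (1# + 1#) * (z * d)) * (w * w)    ≈⟨ *-congʳ key ⟩
      c * π * (w * w)                            ≈⟨ solve 3 (λ c π w → c :* π :* w := c :* w :* π) refl c π (w * w) ⟩
      c * (w * w) * π                            ∎) (1+aπ≉bπ _ _)
      where
      d = y - z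
      b = proj₁ 2≡0
      2≈ = proj₂ 2≡0
      key : d * d + (1# + 1#) * (z * d) ≈ c * π
      key = +-cancelʳ (z * z) (begin
        d * d + (1# + 1#) * (z * d) + z * z
          ≈⟨ solve 2 (λ d z → d :* d :+ (con 1 :+ con 1) :* (z :* d) :+ z :* z := (z :+ d) :* (z :+ d)) refl d z ⟩
        (z + d) * (z + d)        ≈⟨ *-cong (sub-add y z) (sub-add y z) ⟨
        y * y                    ≈⟨ p ⟩
        z * z + c * π            ≈⟨ +-comm _ _ ⟩
        c * π + z * z            ∎)

    sq^ : ℕ → Carrier → Carrier
    sq^ zero    x = x
    sq^ (suc n) x = sq^ n x * sq^ n x

    sq^-periodic : ∀ i k x → sq^ i x ≡π sq^ (i ℕ.+ suc k) x → x ≡π sq^ (suc k) x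
    sq^-periodic zero    k x p = p
    sq^-periodic (suc i) k x p = sq^-periodic i k x (sq-injective p)

    -- Squaring is injective on the finite residue field.
    square-root : ∀ x → ∃[ y ] x ≡π y * y
    square-root x with residues
    ... | q , r , r-hit with pigeonhole (ℕₚ.n<1+n q) (λ i → proj₁ (r-hit (sq^ (toℕ i) x)))
    ... | i , j , i<j , eq with ℕₚ.m≤n⇒∃[o]m+o≡n i<j
    ... | k , 1+i+k≡j = sq^ k x , sq^-periodic (toℕ i) k x
      (≡π-trans (at i) (≡.subst₂ (λ a b → r a ≡π sq^ b x) (≡.sym eq)
        (≡.trans (≡.sym 1+i+k≡j) (≡.sym (ℕₚ.+-suc (toℕ i) k))) (≡π-sym (at j))))
      where
      at : ∀ i → sq^ (toℕ i) x ≡π r (proj₁ (r-hit (sq^ (toℕ i) x)))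
      at i = proj₂ (r-hit (sq^ (toℕ i) x))

  module _ (σ≡id : ∀ x → x ≡π σ x) where
    norm-approximation : ∀ x → ∃[ y ] x ≡π y * y → ∃[ f ] (σ f ≈ f × x ≡π f)
    norm-approximation x (y , b , p) = y * σ y , norm-fixed , y * c + b , (begin
      x                               ≈⟨ p ⟩
      y * y + b * π                   ≈⟨ +-congʳ (*-congˡ q) ⟩
      y * (σ y + c * π) + b * π
        ≈⟨ solve 5 (λ y s c π b → y :* (s :+ c :* π) :+ b :* π := y :* s :+ (y :* c :+ b) :* π) refl y (σ y) c π b ⟩
      y * σ y + (y * c + b) * π       ∎)
      where
      c = proj₁ (σ≡id y)
      q = proj₂ (σ≡id y)
      norm-fixed : σ (y * σ y) ≈ y * σ y
      norm-fixed = trans (σ.*-homo _ _) (trans (*-congˡ (σσ y)) (*-comm _ _))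

    fixed-approximation : ∀ x → ∃[ f ] (σ f ≈ f × x ≡π f)
    fixed-approximation x with local (1# + 1#)
    ... | inj₁ (h , 2h≈1) = (x + σ x) * h , σf≈f , c * h , (begin
      x                             ≈⟨ trans (*-congˡ 2h≈1) (*-identityʳ x) ⟨
      x * ((1# + 1#) * h)           ≈⟨ solve 2 (λ x h → x :* ((con 1 :+ con 1) :* h) := (x :+ x) :* h) refl x h ⟩
      (x + x) * h                   ≈⟨ *-congʳ (+-congˡ p) ⟩
      (x + (σ x + c * π)) * h
        ≈⟨ solve 5 (λ x y c π h → (x :+ (y :+ c :* π)) :* h := (x :+ y) :* h :+ c :* h :* π) refl x (σ x) c π h ⟩
      (x + σ x) * h + c * h * π     ∎)
      where
      c = proj₁ (σ≡id x)
      p = proj₂ (σ≡id x)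
      σ2h≈1 : (1# + 1#) * σ h ≈ 1#
      σ2h≈1 = begin
        (1# + 1#) * σ h     ≈⟨ *-congʳ (trans (σ.+-homo _ _) (+-cong σ.1#-homo σ.1#-homo)) ⟨
        σ (1# + 1#) * σ h   ≈⟨ σ.*-homo _ _ ⟨
        σ ((1# + 1#) * h)   ≈⟨ σ.⟦⟧-cong 2h≈1 ⟩
        σ 1#                ≈⟨ σ.1#-homo ⟩
        1#                  ∎
      σh≈h : σ h ≈ h
      σh≈h = begin
        σ h                       ≈⟨ trans (*-congʳ 2h≈1) (*-identityˡ _) ⟨
        (1# + 1#) * h * σ h       ≈⟨ solve 2 (λ h k → (con 1 :+ con 1) :* h :* k := (con 1 :+ con 1) :* k :* h) refl h (σ h) ⟩
        (1# + 1#) * σ h * h       ≈⟨ trans (*-congʳ σ2h≈1) (*-identityˡ _) ⟩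
        h                         ∎
      σf≈f : σ ((x + σ x) * h) ≈ (x + σ x) * h
      σf≈f = trans (σ.*-homo _ _) (*-cong (trans (σ.+-homo _ _) (trans (+-congˡ (σσ x)) (+-comm _ _))) σh≈h)
    ... | inj₂ 2≡0 = norm-approximation x (square-root 2≡0 x)

    x-σx-divisible : ∀ n x → Divides^ A π n (x - σ x)
    x-σx-divisible zero    x = _
    x-σx-divisible (suc n) x with fixed-approximation x
    ... | f , σf , b , p = b - σ b , +-cancelʳ (σ x) (begin
        x - σ x + σ x                    ≈⟨ trans (+-comm _ _) (sym (sub-add x (σ x))) ⟩
        x                                ≈⟨ p ⟩
        f + b * π                        ≈⟨ +-congˡ (*-congʳ (sub-add b (σ b))) ⟩
        f + (σ b + (b - σ b)) * π        ≈⟨ solve 4 (λ f s d π → f :+ (s :+ d) :* π := d :* π :+ (f :+ s :* π)) refl f (σ b) (b - σ b) π ⟩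
        (b - σ b) * π + (f + σ b * π)    ≈⟨ +-congˡ σx≈ ⟨
        (b - σ b) * π + σ x              ∎) , x-σx-divisible n b
      where
      σx≈ : σ x ≈ f + σ b * π
      σx≈ = trans (σ.⟦⟧-cong p) (trans (σ.+-homo _ _) (+-cong σf (trans (σ.*-homo _ _) (*-congˡ σπ))))

    σ≈id : ∀ x → σ x ≈ x
    σ≈id x = sym (x∙y⁻¹≈ε⇒x≈y x (σ x) (separated (x - σ x) λ n → x-σx-divisible n x))

  -- Otherwise σ is trivial modulo π; every x is then congruent to a fixed
  -- element, namely (x + σ x)/2 or, when 2 is not a unit, the norm of a square
  -- root of x modulo π, and so x - σ x is divisible by every power of π.
  unit-difference : ¬ (∀ x → σ x ≈ x) → ∃[ θ ] ∃[ u ] (θ - σ θ) * u ≈ 1#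
  unit-difference nontrivial with em {∃[ θ ] ∃[ u ] (θ - σ θ) * u ≈ 1#}
  ... | yes found = found
  ... | no none = contradiction (σ≈id λ x → congruent x) nontrivial
    where
    congruent : ∀ x → x ≡π σ x
    congruent x with local (x - σ x)
    ... | inj₁ (u , unit) = contradiction (x , u , unit) none
    ... | inj₂ (b , p) = b , trans (sub-add x (σ x)) (+-congˡ p)

1≤+⁺1⇒0≤ : ∀ m → [ + 1 ] ≤⁺ m +⁺ [ + 1 ] → [ + 0 ] ≤⁺ m
1≤+⁺1⇒0≤ ⊤⁺                 _              = _ ≤⊤⁺
1≤+⁺1⇒0≤ [ + n ]            _              = [ ℤ.+≤+ ℕ.z≤n ]
1≤+⁺1⇒0≤ [ -[1+ zero ] ]    [ ℤ.+≤+ () ]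
1≤+⁺1⇒0≤ [ -[1+ suc n ] ]   [ () ]

module ValuationRing {ℓ} (F : LocalField ℓ) where
  open LocalField F
  private
    module O = IsSubring (O-isSubring F)
    module 𝒪 = CommutativeRing (integers F)

  module _ (ϖ : 𝒪.Carrier) (vϖ≡1 : v (proj₁ ϖ) ≡ [ + 1 ]) where

    v-*ϖ : ∀ {x b} → x ≈ b * proj₁ ϖ → v x ≡ v b +⁺ [ + 1 ]
    v-*ϖ p = ≡.trans (v-cong p) (≡.trans (v-* _ _) (≡.cong (v _ +⁺_) vϖ≡1))

    divide : ∀ x → [ + 1 ] ≤⁺ v x → Σ[ b ∈ 𝒪.Carrier ] x ≈ proj₁ b * proj₁ ϖ
    divide x 1≤vx = (x * y , 1≤+⁺1⇒0≤ (v (x * y)) (≡.subst ([ + 1 ] ≤⁺_) (v-*ϖ x≈) 1≤vx)) , x≈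
      where
      ϖ≉0 : ¬ proj₁ ϖ ≈ 0#
      ϖ≉0 p with () ← ≡.trans (≡.sym vϖ≡1) (≡.trans (v-cong p) v-0)
      y = proj₁ (inverse (proj₁ ϖ) ϖ≉0)
      x≈ : x ≈ x * y * proj₁ ϖ
      x≈ = sym (trans (*-assoc _ _ _) (trans (*-congˡ (trans (*-comm _ _) (proj₂ (inverse (proj₁ ϖ) ϖ≉0)))) (*-identityʳ x)))

    valuation-local : ∀ (a : 𝒪.Carrier) → (∃[ b ] a 𝒪.* b 𝒪.≈ 𝒪.1#) ⊎ (∃[ b ] a 𝒪.≈ b 𝒪.* ϖ)
    valuation-local (x , x∈) = split (v x) ≡.refl x∈
      where
      split : ∀ m → v x ≡ m → [ + 0 ] ≤⁺ m →
              (Σ[ b ∈ 𝒪.Carrier ] x * proj₁ b ≈ 1#) ⊎ (Σ[ b ∈ 𝒪.Carrier ] x ≈ proj₁ b * proj₁ ϖ)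
      split ⊤⁺          eq _ = inj₂ (divide x (≡.subst ([ + 1 ] ≤⁺_) (≡.sym eq) (_ ≤⊤⁺)))
      split [ -[1+ n ] ] eq [ () ]
      split [ + suc n ] eq _ = inj₂ (divide x (≡.subst ([ + 1 ] ≤⁺_) (≡.sym eq) [ ℤ.+≤+ (ℕ.s≤s ℕ.z≤n) ]))
      split [ + zero ]  eq _ = inj₁ ((y , y∈) , xy≈1)
        where
        x≉0 : ¬ x ≈ 0#
        x≉0 p with () ← ≡.trans (≡.sym eq) (≡.trans (v-cong p) v-0)
        y = proj₁ (inverse x x≉0)
        xy≈1 = proj₂ (inverse x x≉0)
        0+⁺ : ∀ m → [ + 0 ] +⁺ m ≡ m
        0+⁺ ⊤⁺    = ≡.refl
        0+⁺ [ m ] = ≡.cong [_] (ℤₚ.+-identityˡ m)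
        y∈ : y ∈ O
        y∈ = ≡.subst ([ + 0 ] ≤⁺_)
          (≡.trans (v-cong (sym xy≈1)) (≡.trans (v-* x y) (≡.trans (≡.cong (_+⁺ v y) eq) (0+⁺ (v y))))) O.1∈

    valuation-nonunit : ∀ b → ¬ 𝒪.1# 𝒪.≈ b 𝒪.* ϖ
    valuation-nonunit (b , b∈) p = absurd (v b) (v-*ϖ p) b∈
      where
      absurd : ∀ m → v 1# ≡ m +⁺ [ + 1 ] → ¬ [ + 0 ] ≤⁺ m
      absurd ⊤⁺ eq _ = 1≉0 (v-⊤ 1# eq)
      absurd [ -[1+ n ] ] eq [ () ]
      absurd [ + n ] eq _ = ℕₚ.m+1+n≢m (n ℕ.+ 1)
        ([+]-injective (≡.trans (≡.cong (λ k → [ + (n ℕ.+ 1 ℕ.+ k) ]) (ℕₚ.+-comm 1 n)) (≡.trans (≡.sym double) eq)))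
        where
        [+]-injective : ∀ {m n} → _≡_ {A = ℤ ⁺} [ + m ] [ + n ] → m ≡ n
        [+]-injective ≡.refl = ≡.refl
        double : v 1# ≡ [ + (n ℕ.+ 1 ℕ.+ (n ℕ.+ 1)) ]
        double = ≡.trans (v-cong (sym (*-identityˡ 1#))) (≡.trans (v-* 1# 1#) (≡.cong₂ _+⁺_ eq eq))

    divides⇒≤v : ∀ n a → Divides^ (integers F) ϖ n a → [ + n ] ≤⁺ v (proj₁ a)
    divides⇒≤v zero    a       _               = proj₂ a
    divides⇒≤v (suc n) a (b , p , d) = ≡.subst ([ + suc n ] ≤⁺_) (≡.sym (v-*ϖ p)) (step (v (proj₁ b)) (divides⇒≤v n b d))
      where
      step : ∀ m → [ + n ] ≤⁺ m → [ + suc n ] ≤⁺ m +⁺ [ + 1 ]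
      step [ m ] [ p ] = [ ≡.subst (ℤ._≤ m ℤ.+ + 1) (≡.cong +_ (ℕₚ.+-comm n 1)) (ℤₚ.+-monoˡ-≤ (+ 1) p) ]
      step ⊤⁺    _     = _ ≤⊤⁺

    valuation-separated : ∀ a → (∀ n → Divides^ (integers F) ϖ n a) → a 𝒪.≈ 𝒪.0#
    valuation-separated a h = bounded (v (proj₁ a)) ≡.refl
      where
      bounded : ∀ m → v (proj₁ a) ≡ m → proj₁ a ≈ 0#
      bounded ⊤⁺ eq = v-⊤ _ eq
      bounded [ m ] eq with ≡.subst ([ + suc ℤ.∣ m ∣ ] ≤⁺_) eq (divides⇒≤v (suc ℤ.∣ m ∣) a (h _))
      bounded [ + n ] eq      | [ ℤ.+≤+ n<n ] = contradiction n<n (ℕₚ.n≮n n)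
      bounded [ -[1+ n ] ] eq | [ () ]

    valuation-residues : ∃[ q ] Σ[ r ∈ (Fin q → 𝒪.Carrier) ] (∀ x → ∃[ i ] ∃[ b ] x 𝒪.≈ r i 𝒪.+ b 𝒪.* ϖ)
    valuation-residues = let q , r , r∈ , hit = finiteResidueField in
      q , (λ i → r i , r∈ i) , λ (x , x∈) → let i , p = hit x x∈
                                                b , eq = divide (x - r i) p
                                            in i , b , trans (sub-add x (r i)) (+-congˡ eq)
      where
      sub-add : ∀ x y → x ≈ y + (x - y)
      sub-add x y = sym (trans (+-comm _ _) (trans (+-assoc _ _ _) (trans (+-congˡ (-‿inverseˡ y)) (+-identityʳ x))))

module FixedField {ℓ} (em : ExcludedMiddle ℓ) {F : LocalField ℓ} (K : UnramifiedQuadraticExtension F) where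
  private
    module F = LocalField F
    module σ = IsRingIsomorphism (UnramifiedQuadraticExtension.σ-isRingIsomorphism K)
    module ι = IsRingHomomorphism (UnramifiedQuadraticExtension.ι-isRingHomomorphism K)
  open UnramifiedQuadraticExtension K
  open RingProperties ring using (x∙y⁻¹≈ε⇒x≈y; -‿distribʳ-*; -‿+-comm)
  open SetoidReasoning setoid
  open Solver commutativeSemiring using (solve; _:+_; _:*_; _:=_)

  private
    e : Fin 2 → Carrier
    e = proj₁ quadratic
    e₀ = e 0F
    e₁ = e 1F
    coords : ∀ x → Fin 2 → F.Carrier
    coords x = proj₁ (proj₂ quadratic x)
    c₀ c₁ : Carrier → Carrier
    c₀ x = ι (coords x 0F)
    c₁ x = ι (coords x 1F)
    expand : ∀ x → x ≈ c₀ x * e₀ + c₁ x * e₁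
    expand x = trans (proj₁ (proj₂ (proj₂ quadratic x))) (+-congˡ (+-identityʳ _))

    σ-expand : ∀ x → σ x ≈ c₀ x * σ e₀ + c₁ x * σ e₁
    σ-expand x = trans (σ.⟦⟧-cong (expand x)) (trans (σ.+-homo _ _)
      (+-cong (trans (σ.*-homo _ _) (*-congʳ (σ-ι _))) (trans (σ.*-homo _ _) (*-congʳ (σ-ι _)))))

    σ-difference : ∀ {x} → σ x ≈ x → c₀ x * (e₀ - σ e₀) + c₁ x * (e₁ - σ e₁) ≈ 0#
    σ-difference {x} p = begin
      c₀ x * (e₀ - σ e₀) + c₁ x * (e₁ - σ e₁)
        ≈⟨ solve 6 (λ a b x x′ y y′ → a :* (x :+ x′) :+ b :* (y :+ y′) := (a :* x :+ b :* y) :+ (a :* x′ :+ b :* y′))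
             refl (c₀ x) (c₁ x) e₀ (- σ e₀) e₁ (- σ e₁) ⟩
      (c₀ x * e₀ + c₁ x * e₁) + (c₀ x * - σ e₀ + c₁ x * - σ e₁)
        ≈⟨ +-cong (sym (expand x)) (trans (+-cong (sym (-‿distribʳ-* _ _)) (sym (-‿distribʳ-* _ _)))
             (trans (-‿+-comm _ _) (-‿cong (trans (sym (σ-expand x)) p)))) ⟩
      x - x         ≈⟨ -‿inverseʳ x ⟩
      0#            ∎

    cancel-nonzero : ∀ {x y z} → ¬ z ≈ 0# → x * z ≈ y * z → x ≈ y
    cancel-nonzero {x} {y} {z} z≉0 p = trans (sym (lemma x)) (trans (*-congʳ p) (lemma y))
      where
      w = proj₁ (inverse z z≉0)
      lemma : ∀ x → x * z * w ≈ x
      lemma x = trans (*-assoc _ _ _) (trans (*-congˡ (proj₂ (inverse z z≉0))) (*-identityʳ x))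

    minors : ∀ {a b c d x y} → a * x + b * y ≈ 0# → c * x + d * y ≈ 0# → a * d * x ≈ b * c * x
    minors {a} {b} {c} {d} {x} {y} p q = RingProperties.+-cancelʳ ring (b * d * y) _ _ (begin
      a * d * x + b * d * y     ≈⟨ solve 5 (λ a b d x y → a :* d :* x :+ b :* d :* y := d :* (a :* x :+ b :* y)) refl a b d x y ⟩
      d * (a * x + b * y)       ≈⟨ trans (*-congˡ p) (zeroʳ d) ⟩
      0#                        ≈⟨ trans (*-congˡ q) (zeroʳ b) ⟨
      b * (c * x + d * y)       ≈⟨ solve 5 (λ b c d x y → b :* (c :* x :+ d :* y) := b :* c :* x :+ b :* d :* y) refl b c d x y ⟩
      b * c * x + b * d * y     ∎)

    proportional : ∀ {a b c d w x y z} → a * x + b * y ≈ 1# → z ≈ c * x + d * y → a * d ≈ b * c → a * w ≈ 1# → z ≈ w * c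
    proportional {a} {b} {c} {d} {w} {x} {y} {z} p q r s = begin
      z                              ≈⟨ trans (*-congʳ s) (*-identityˡ z) ⟨
      a * w * z                      ≈⟨ *-congˡ q ⟩
      a * w * (c * x + d * y)
        ≈⟨ solve 6 (λ a w c x d y → a :* w :* (c :* x :+ d :* y) := w :* (c :* (a :* x) :+ a :* d :* y)) refl a w c x d y ⟩
      w * (c * (a * x) + a * d * y)  ≈⟨ *-congˡ (+-congˡ (*-congʳ r)) ⟩
      w * (c * (a * x) + b * c * y)
        ≈⟨ solve 6 (λ a w c x b y → w :* (c :* (a :* x) :+ b :* c :* y) := w :* c :* (a :* x :+ b :* y)) refl a w c x b y ⟩
      w * c * (a * x + b * y)        ≈⟨ trans (*-congˡ p) (*-identityʳ _) ⟩
      w * c                          ∎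

    determinant : ∀ {x y} → σ x ≈ x → σ y ≈ y → c₀ x * c₁ y ≈ c₁ x * c₀ y
    determinant {x} {y} σx σy with em {e₀ - σ e₀ ≈ 0#} | em {e₁ - σ e₁ ≈ 0#}
    ... | no δ≉0 | _       = cancel-nonzero δ≉0 (minors (σ-difference σx) (σ-difference σy))
    ... | yes _  | no δ≉0  = sym (cancel-nonzero δ≉0 (minors (trans (+-comm _ _) (σ-difference σx))
                                                                    (trans (+-comm _ _) (σ-difference σy))))
    ... | yes p  | yes q   = contradiction (λ z → trans (σ-expand z) (trans (+-cong
        (*-congˡ (sym (x∙y⁻¹≈ε⇒x≈y _ _ p))) (*-congˡ (sym (x∙y⁻¹≈ε⇒x≈y _ _ q)))) (sym (expand z)))) σ-nontrivial

    ι-inverse : ∀ {a} → ¬ a F.≈ F.0# → ∃[ w ] ι a * ι w ≈ 1#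
    ι-inverse a≉0 = let w , aw≈1 = F.inverse _ a≉0 in
      w , trans (sym (ι.*-homo _ _)) (trans (ι.⟦⟧-cong aw≈1) ι.1#-homo)

  fixed⇒∈F : ∀ {x} → σ x ≈ x → ∃[ f ] x ≈ ι f
  fixed⇒∈F {x} σx with em {coords 1# 0F F.≈ F.0#} | em {coords 1# 1F F.≈ F.0#}
  ... | no a≉0 | _ = let w , p = ι-inverse a≉0 in w F.* coords x 0F ,
    trans (proportional (sym (expand 1#)) (expand x) (determinant σ.1#-homo σx) p) (sym (ι.*-homo _ _))
  ... | yes _ | no a≉0 = let w , p = ι-inverse a≉0 in w F.* coords x 1F ,
    trans (proportional (trans (+-comm _ _) (sym (expand 1#))) (trans (expand x) (+-comm _ _))
      (sym (determinant σ.1#-homo σx)) p) (sym (ι.*-homo _ _))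
  ... | yes p | yes q = contradiction (begin
    1#                            ≈⟨ expand 1# ⟩
    c₀ 1# * e₀ + c₁ 1# * e₁       ≈⟨ +-cong (zero-term p) (zero-term q) ⟩
    0# + 0#                       ≈⟨ +-identityˡ 0# ⟩
    0#                            ∎) 1≉0
    where
    zero-term : ∀ {a x} → a F.≈ F.0# → ι a * x ≈ 0#
    zero-term p = trans (*-congʳ (trans (ι.⟦⟧-cong p) ι.0#-homo)) (zeroˡ _)

-- The four models

module ColumnModels {ℓ} (S : CyclicOrder ℓ) where
  open CyclicOrder S
  open Homs R
  open Graded S
  open Modelled S
  open Matrices R
  open SetoidReasoning R.setoid

  emb-0-Π : ∀ a → emb a R.+ emb A.0# R.* Π R.≈ emb a
  emb-0-Π a = R.trans (R.+-congˡ (R.trans (R.*-congʳ emb.0#-homo) (R.zeroˡ Π))) (R.+-identityʳ _)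

  emb-*Π : ∀ a b → emb a R.* (emb b R.* Π) R.≈ emb (a A.* b) R.* Π
  emb-*Π a b = R.trans (R.sym (R.*-assoc _ _ _)) (R.*-congʳ (R.sym (emb.*-homo a b)))

  Π-emb : ∀ a → Π R.* emb (σ a) R.≈ emb a R.* Π
  Π-emb a = R.sym (aΠ a)

  fixed-central : ∀ {f} → σ f A.≈ f → ∀ x → emb f R.* x R.≈ x R.* emb f
  fixed-central {f} σf x with spanning x
  ... | a , b , p = begin
    emb f R.* x                              ≈⟨ R.*-congˡ p ⟩
    emb f R.* (emb a R.+ emb b R.* Π)        ≈⟨ R.distribˡ _ _ _ ⟩
    emb f R.* emb a R.+ emb f R.* (emb b R.* Π)
      ≈⟨ R.+-cong (swap a) (R.trans (R.sym (R.*-assoc _ _ _)) (R.trans (R.*-congʳ (swap b))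
           (R.trans (R.*-assoc _ _ _) (R.trans (R.*-congˡ (R.trans (R.*-congʳ (emb.⟦⟧-cong (A.sym σf))) (R.sym (Πa f))))
             (R.sym (R.*-assoc _ _ _)))))) ⟩
    emb a R.* emb f R.+ emb b R.* Π R.* emb f ≈⟨ R.distribʳ _ _ _ ⟨
    (emb a R.+ emb b R.* Π) R.* emb f        ≈⟨ R.*-congʳ p ⟨
    x R.* emb f                              ∎
    where
    swap : ∀ a → emb f R.* emb a R.≈ emb a R.* emb f
    swap a = R.trans (R.sym (emb.*-homo f a)) (R.trans (emb.⟦⟧-cong (A.*-comm f a)) (emb.*-homo a f))

  twist-fixed : ∀ s {f} → σ f A.≈ f → twist s f A.≈ f
  twist-fixed even _ = A.refl
  twist-fixed odd  p = p

  NonUnit : R.Carrier → Set ℓ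
  NonUnit x = ∃[ a ] ∃[ b ] x R.≈ emb (a A.* π) R.+ emb b R.* Π

  1-unit : ¬ NonUnit R.1#
  1-unit (a , b , p) = π-nonunit a (proj₁ (independent
    (R.trans (emb-0-Π A.1#) (R.trans emb.1#-homo p))))

  nonUnit-+ : ∀ {x y} → NonUnit x → NonUnit y → NonUnit (x R.+ y)
  nonUnit-+ (a , b , p) (c , d , q) = a A.+ c , b A.+ d , (begin
    _                                                              ≈⟨ R.+-cong p q ⟩
    (emb (a A.* π) R.+ emb b R.* Π) R.+ (emb (c A.* π) R.+ emb d R.* Π) ≈⟨ interchange _ _ _ _ ⟩
    (emb (a A.* π) R.+ emb (c A.* π)) R.+ (emb b R.* Π R.+ emb d R.* Π)
      ≈⟨ R.+-cong (R.trans (R.sym (emb.+-homo _ _)) (emb.⟦⟧-cong (A.sym (A.distribʳ π a c))))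
                  (R.trans (R.sym (R.distribʳ Π _ _)) (R.*-congʳ (R.sym (emb.+-homo b d)))) ⟩
    emb ((a A.+ c) A.* π) R.+ emb (b A.+ d) R.* Π                  ∎)
    where open CommutativeSemigroupProperties R.+-commutativeSemigroup using (interchange)

  nonUnit-*Π : ∀ x → NonUnit (x R.* Π)
  nonUnit-*Π x with spanning x
  ... | a , b , p = b , a , (begin
    x R.* Π                                   ≈⟨ R.*-congʳ p ⟩
    (emb a R.+ emb b R.* Π) R.* Π             ≈⟨ R.distribʳ _ _ _ ⟩
    emb a R.* Π R.+ emb b R.* Π R.* Π         ≈⟨ R.+-comm _ _ ⟩
    emb b R.* Π R.* Π R.+ emb a R.* Π         ≈⟨ R.+-congʳ (R.trans (R.*-assoc _ _ _) (R.trans (R.*-congˡ Π²) (R.sym (emb.*-homo b π)))) ⟩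
    emb (b A.* π) R.+ emb a R.* Π             ∎)

  nonUnit-resp : ∀ {x y} → x R.≈ y → NonUnit x → NonUnit y
  nonUnit-resp p (a , b , q) = a , b , R.trans (R.sym p) q

  nonUnit-Π* : ∀ x → NonUnit (Π R.* x)
  nonUnit-Π* x = let y , p = conjugate x in nonUnit-resp (R.sym p) (nonUnit-*Π y)

  nonUnit-π* : ∀ x → NonUnit (emb π R.* x)
  nonUnit-π* x = nonUnit-resp (R.trans (R.sym (R.*-assoc Π Π x)) (R.*-congʳ Π²)) (nonUnit-Π* (Π R.* x))

  *π-coordinates : ∀ {x a b} → x R.≈ emb a R.+ emb b R.* Π → x R.* emb π R.≈ emb (a A.* π) R.+ emb (b A.* π) R.* Π
  *π-coordinates {x} {a} {b} p = begin
    x R.* emb π                                   ≈⟨ fixed-central σπ x ⟨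
    emb π R.* x                                   ≈⟨ R.*-congˡ p ⟩
    emb π R.* (emb a R.+ emb b R.* Π)             ≈⟨ R.distribˡ _ _ _ ⟩
    emb π R.* emb a R.+ emb π R.* (emb b R.* Π)   ≈⟨ R.+-cong (R.sym (emb.*-homo π a)) (emb-*Π π b) ⟩
    emb (π A.* a) R.+ emb (π A.* b) R.* Π         ≈⟨ R.+-cong (emb.⟦⟧-cong (A.*-comm π a)) (R.*-congʳ (emb.⟦⟧-cong (A.*-comm π b))) ⟩
    emb (a A.* π) R.+ emb (b A.* π) R.* Π         ∎

  zero-coordinates : ∀ {x a b} → x R.≈ emb a R.+ emb b R.* Π → a A.≈ A.0# → b A.≈ A.0# → x R.≈ R.0#
  zero-coordinates {x} {a} {b} p q r = begin
    x                              ≈⟨ p ⟩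
    emb a R.+ emb b R.* Π          ≈⟨ R.+-cong (emb.⟦⟧-cong q) (R.*-congʳ (emb.⟦⟧-cong r)) ⟩
    emb A.0# R.+ emb A.0# R.* Π    ≈⟨ emb-0-Π A.0# ⟩
    emb A.0#                       ≈⟨ emb.0#-homo ⟩
    R.0#                           ∎

  R-torsionFree : ∀ {x} → x R.* emb π R.≈ R.0# → x R.≈ R.0#
  R-torsionFree {x} p with spanning x
  ... | a , b , q = let r , s = independent (begin
                          emb (a A.* π) R.+ emb (b A.* π) R.* Π  ≈⟨ *π-coordinates q ⟨
                          x R.* emb π                            ≈⟨ p ⟩
                          R.0#                                   ≈⟨ emb.0#-homo ⟨
                          emb A.0#                               ≈⟨ emb-0-Π A.0# ⟨
                          emb A.0# R.+ emb A.0# R.* Π            ∎)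
                    in zero-coordinates q (π-regular a r) (π-regular b s)

  DivR : ℕ → R.Carrier → Set ℓ
  DivR zero    x = ⊤
  DivR (suc n) x = ∃[ y ] (x R.≈ y R.* Π × DivR n y)

  private
    double : ℕ → ℕ
    double zero    = zero
    double (suc n) = suc (suc (double n))

  divR⇒divides : ∀ n {x a b} → x R.≈ emb a R.+ emb b R.* Π → DivR (double n) x → Divides^ A π n a × Divides^ A π n b
  divR⇒divides zero _ _ = _ , _
  divR⇒divides (suc n) {x} {a} {b} p (y , x≈yΠ , z , y≈zΠ , d) with spanning z
  ... | c , e , q = let r , s = independent (begin
                          emb a R.+ emb b R.* Π                    ≈⟨ p ⟨
                          x                                        ≈⟨ x≈yΠ ⟩
                          y R.* Π                                  ≈⟨ R.*-congʳ y≈zΠ ⟩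
                          z R.* Π R.* Π                            ≈⟨ R.trans (R.*-assoc _ _ _) (R.*-congˡ Π²) ⟩
                          z R.* emb π                              ≈⟨ *π-coordinates q ⟩
                          emb (c A.* π) R.+ emb (e A.* π) R.* Π    ∎)
                        d₁ , d₂ = divR⇒divides n q d
                    in (c , r , d₁) , (e , s , d₂)

  R-separated : ∀ x → (∀ n → DivR n x) → x R.≈ R.0#
  R-separated x h with spanning x
  ... | a , b , p = zero-coordinates p
    (separated a λ n → proj₁ (divR⇒divides n p (h (double n))))
    (separated b λ n → proj₂ (divR⇒divides n p (h (double n))))

  module _ {n} (φ : R.Carrier → Matrix n) (φ-hom : IsRingHomomorphism R.rawRing (matrixRawRing n) φ) where
    private
      module C = On (Columns.columns R φ φ-hom)

    columns-torsionFree : C.π-TorsionFree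
    columns-torsionFree p i = R-torsionFree (p i)

    columns-separated : ∀ x → (∀ n → C.Div n x) → x C.≈ᴹ C.0ᴹ
    columns-separated x h i = R-separated (x i) λ n → div n (h n)
      where
      div : ∀ n {x} → C.Div n x → DivR n (x i)
      div zero    _           = _
      div (suc n) (y , p , d) = y i , p i , div n d

  module _ {X L : Bimod} where
    private
      module X = On X
      module L = On L
    -- R is generated as a ring by emb A and Π.
    mkHom : (f : X.Carrierᴹ → L.Carrierᴹ) →
      (∀ {x y} → x X.≈ᴹ y → f x L.≈ᴹ f y) → (∀ x y → f (x X.+ᴹ y) L.≈ᴹ f x L.+ᴹ f y) →
      (∀ a x → f (a X.◃ x) L.≈ᴹ a L.◃ f x) → (∀ x → f (X.P x) L.≈ᴹ L.P (f x)) →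
      (∀ α x → f (x X.*ᵣ α) L.≈ᴹ f x L.*ᵣ α) → Hom X L
    mkHom f f-cong f-+ f-◃ f-P f-*ᵣ = record
      { fun = f ; cong = f-cong ; +-homo = f-+ ; *ₗ-homo = f-*ₗ ; *ᵣ-homo = f-*ᵣ }
      where
      f-*ₗ : ∀ α x → f (α X.*ₗ x) L.≈ᴹ α L.*ₗ f x
      f-*ₗ α x with spanning α
      ... | a , b , p = L.≈ᴹ-trans (f-cong (X.≈ᴹ-trans (X.*ₗ-congʳ p) (X.≈ᴹ-trans (X.*ₗ-distribʳ x _ _) (X.+ᴹ-congˡ (X.*ₗ-assoc _ _ x)))))
        (L.≈ᴹ-trans (f-+ _ _)
        (L.≈ᴹ-trans (L.+ᴹ-cong (f-◃ a x) (L.≈ᴹ-trans (f-◃ b _) (L.*ₗ-congˡ (f-P x))))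
        (L.≈ᴹ-sym (L.≈ᴹ-trans (L.*ₗ-congʳ p) (L.≈ᴹ-trans (L.*ₗ-distribʳ (f x) _ _) (L.+ᴹ-congˡ (L.*ₗ-assoc _ _ (f x))))))))

  module ThinModel (s : Degree) (φ : R.Carrier → Matrix 1)
    (φ-hom : IsRingHomomorphism R.rawRing (matrixRawRing 1) φ)
    (φ-emb : ∀ a → φ (emb a) 0F 0F R.≈ emb (twist s a)) (φ-Π : φ Π 0F 0F R.≈ Π) where

    X : Bimod
    X = Columns.columns R φ φ-hom
    open On X using (P; Q; _◃_; _·_)

    X-◃ : ∀ a x → (a ◃ x) 0F R.≈ emb (twist s a) R.* x 0F
    X-◃ a x = R.trans (R.+-identityʳ _) (R.*-congʳ (φ-emb a))

    X-P : ∀ x → P x 0F R.≈ Π R.* x 0F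
    X-P x = R.trans (R.+-identityʳ _) (R.*-congʳ φ-Π)

    gen : Fin 1 → R.Carrier
    gen _ = R.1#

    span : ∀ (x : Fin 1 → R.Carrier) → ∃[ a ] ∃[ b ] ∃[ c ] ∃[ d ]
           (∀ i → x i R.≈ ((gen · a) i R.+ (P (Q gen) · b) i) R.+ ((P gen · c) i R.+ (Q gen · d) i))
    span x with spanning (x 0F)
    ... | a , b , p = a , A.0# , A.0# , σ b , λ { 0F → begin
      x 0F                                                        ≈⟨ p ⟩
      emb a R.+ emb b R.* Π
        ≈⟨ R.+-cong (R.sym (R.trans (R.+-identityʳ _) (R.*-identityˡ _)))
             (R.sym (R.trans (R.+-identityˡ _) (R.trans (R.*-congʳ (R.*-identityˡ Π)) (Π-emb b)))) ⟩
      (R.1# R.* emb a R.+ R.0#) R.+ (R.0# R.+ R.1# R.* Π R.* emb (σ b))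
        ≈⟨ R.+-cong (R.+-congˡ (absorb _)) (R.+-congʳ (absorb _)) ⟨
      _                                                           ∎ }
      where
      absorb : ∀ y → y R.* emb A.0# R.≈ R.0#
      absorb y = R.trans (R.*-congˡ emb.0#-homo) (R.zeroʳ y)

    universal : ∀ (L : Bimod) → On.Balanced L → ∀ w → On.Homogeneous L s w → Admits L thin w →
                Σ[ f ∈ Hom X L ] Bimodule._≈ᴹ_ L (f ⟨$⟩ gen) w
    universal L _ w hg fixed = mkHom (λ x → w L.*ᵣ x 0F) (λ p → L.*ᵣ-congˡ (p 0F)) (λ _ _ → L.*ᵣ-distribˡ w _ _)
      (λ a x → L.≈ᴹ-trans (L.*ᵣ-congˡ (X-◃ a x)) (L.≈ᴹ-trans (L.≈ᴹ-sym (L.*ᵣ-assoc w _ _))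
        (L.≈ᴹ-trans (L.*ᵣ-congʳ (L.≈ᴹ-sym (hg a))) (L.*ₗ-*ᵣ-assoc _ w _))))
      (λ x → L.≈ᴹ-trans (L.*ᵣ-congˡ (X-P x)) (L.≈ᴹ-trans (L.≈ᴹ-sym (L.*ᵣ-assoc w _ _))
        (L.≈ᴹ-trans (L.*ᵣ-congʳ (L.≈ᴹ-sym fixed)) (L.*ₗ-*ᵣ-assoc _ w _))))
      (λ α x → L.≈ᴹ-sym (L.*ᵣ-assoc w _ _)) , L.*ᵣ-identityʳ w
      where module L = On L

    model : Model s thin X
    model = record
      { balanced    = λ {f} σf x → λ { 0F → R.trans (X-◃ f x)
          (R.trans (R.*-congʳ (emb.⟦⟧-cong (twist-fixed s σf))) (fixed-central σf _)) }
      ; torsionFree = columns-torsionFree φ φ-hom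
      ; separatedᴹ  = columns-separated φ φ-hom
      ; gen         = gen
      ; gen-hg      = λ a → λ { 0F → R.trans (X-◃ a gen) (R.trans (R.*-identityʳ _) (R.sym (R.*-identityˡ _))) }
      ; gen∉Rad     = λ (y , z , p) → 1-unit (nonUnit-resp (R.sym (p 0F))
          (nonUnit-+ (nonUnit-resp (R.sym (X-P y)) (nonUnit-Π* _)) (nonUnit-*Π _)))
      ; gen-kind    = λ { 0F → R.trans (X-P gen) (R.trans (R.*-identityʳ Π) (R.sym (R.*-identityˡ Π))) }
      ; span        = span
      ; universal   = universal
      }

  module ThickModel (s : Degree) (φ : R.Carrier → Matrix 2)
    (φ-hom : IsRingHomomorphism R.rawRing (matrixRawRing 2) φ)
    (φ-emb : ∀ a i k → φ (emb a) i k R.≈ matrix₂ (emb (twist s a)) R.0# R.0# (emb (twist (flip s) a)) i k)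
    (φ-Π : ∀ i k → φ Π i k R.≈ matrix₂ R.0# (emb π) R.1# R.0# i k) where

    X : Bimod
    X = Columns.columns R φ φ-hom
    open On X using (P; Q; _◃_; _·_)

    private
      left-term : ∀ {x y z u v} → x R.≈ z → y R.≈ R.0# → x R.* u R.+ (y R.* v R.+ R.0#) R.≈ z R.* u
      left-term p q = R.trans (R.+-cong (R.*-congʳ p) (R.trans (R.+-identityʳ _) (R.trans (R.*-congʳ q) (R.zeroˡ _)))) (R.+-identityʳ _)

      right-term : ∀ {x y z u v} → x R.≈ R.0# → y R.≈ z → x R.* u R.+ (y R.* v R.+ R.0#) R.≈ z R.* v
      right-term p q = R.trans (R.+-cong (R.trans (R.*-congʳ p) (R.zeroˡ _)) (R.trans (R.+-identityʳ _) (R.*-congʳ q))) (R.+-identityˡ _)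

    X-◃₀ : ∀ a x → (a ◃ x) 0F R.≈ emb (twist s a) R.* x 0F
    X-◃₀ a x = left-term (φ-emb a 0F 0F) (φ-emb a 0F 1F)

    X-◃₁ : ∀ a x → (a ◃ x) 1F R.≈ emb (twist (flip s) a) R.* x 1F
    X-◃₁ a x = right-term (φ-emb a 1F 0F) (φ-emb a 1F 1F)

    X-P₀ : ∀ x → P x 0F R.≈ emb π R.* x 1F
    X-P₀ x = right-term (φ-Π 0F 0F) (φ-Π 0F 1F)

    X-P₁ : ∀ x → P x 1F R.≈ x 0F
    X-P₁ x = R.trans (left-term (φ-Π 1F 0F) (φ-Π 1F 1F)) (R.*-identityˡ _)

    gen : Fin 2 → R.Carrier
    gen 0F = R.1#
    gen 1F = R.0#

    span : ∀ (x : Fin 2 → R.Carrier) → ∃[ a ] ∃[ b ] ∃[ c ] ∃[ d ]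
           (∀ i → x i R.≈ ((gen · a) i R.+ (P (Q gen) · b) i) R.+ ((P gen · c) i R.+ (Q gen · d) i))
    span x with spanning (x 0F) | spanning (x 1F)
    ... | a , b , p | c , d , q = a , σ d , c , σ b , λ
      { 0F → begin
        x 0F                                       ≈⟨ p ⟩
        emb a R.+ emb b R.* Π
          ≈⟨ R.+-cong (R.+-identityʳ _) (R.+-identityˡ _) ⟨
        (emb a R.+ R.0#) R.+ (R.0# R.+ emb b R.* Π)
          ≈⟨ R.+-cong (R.+-cong (R.*-identityˡ _) (vanish (R.trans (X-P₀ (Q gen)) (R.trans (R.*-congˡ (R.zeroˡ Π)) (R.zeroʳ _)))))
                      (R.+-cong (vanish (R.trans (X-P₀ gen) (R.zeroʳ _))) (R.trans (R.*-congʳ (R.*-identityˡ Π)) (Π-emb b))) ⟨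
        _                                          ∎
      ; 1F → begin
        x 1F                                       ≈⟨ q ⟩
        emb c R.+ emb d R.* Π                      ≈⟨ R.+-comm _ _ ⟩
        emb d R.* Π R.+ emb c                      ≈⟨ R.+-cong (R.+-identityˡ _) (R.+-identityʳ _) ⟨
        (R.0# R.+ emb d R.* Π) R.+ (emb c R.+ R.0#)
          ≈⟨ R.+-cong (R.+-cong (R.zeroˡ _) (R.trans (R.*-congʳ (R.trans (X-P₁ (Q gen)) (R.*-identityˡ Π))) (Π-emb d)))
                      (R.+-cong (R.trans (R.*-congʳ (X-P₁ gen)) (R.*-identityˡ _)) (vanish (R.zeroˡ Π))) ⟨
        _                                          ∎ }
      where
      vanish : ∀ {x y} → x R.≈ R.0# → x R.* y R.≈ R.0#
      vanish p = R.trans (R.*-congʳ p) (R.zeroˡ _)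

    universal : ∀ (L : Bimod) → On.Balanced L → ∀ w → On.Homogeneous L s w → Admits L thick w →
                Σ[ f ∈ Hom X L ] Bimodule._≈ᴹ_ L (f ⟨$⟩ gen) w
    universal L balanced w hg _ = mkHom (λ x → w L.*ᵣ x 0F L.+ᴹ L.P w L.*ᵣ x 1F)
      (λ p → L.+ᴹ-cong (L.*ᵣ-congˡ (p 0F)) (L.*ᵣ-congˡ (p 1F)))
      (λ _ _ → L.≈ᴹ-trans (L.+ᴹ-cong (L.*ᵣ-distribˡ _ _ _) (L.*ᵣ-distribˡ _ _ _)) (L.medial _ _ _ _))
      (λ a x → L.≈ᴹ-trans (L.+ᴹ-cong (move (X-◃₀ a x) (hg a)) (move (X-◃₁ a x) (L.hg-P s hg a)))
        (L.≈ᴹ-sym (L.◃ₐ.homo _ _)))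
      (λ x → L.≈ᴹ-trans (L.+ᴹ-cong (move (X-P₀ x) PPw) (L.*ᵣ-congˡ (X-P₁ x)))
        (L.≈ᴹ-trans (L.+ᴹ-comm _ _) (L.≈ᴹ-trans (L.+ᴹ-congʳ (L.*ₗ-*ᵣ-assoc _ _ _)) (L.≈ᴹ-sym (L.P.homo _ _)))))
      (λ α x → L.≈ᴹ-trans (L.+ᴹ-cong (L.≈ᴹ-sym (L.*ᵣ-assoc _ _ _)) (L.≈ᴹ-sym (L.*ᵣ-assoc _ _ _))) (L.≈ᴹ-sym (L.*ᵣ-distribʳ _ _ _))) ,
      L.≈ᴹ-trans (L.+ᴹ-cong (L.*ᵣ-identityʳ w) (L.*ᵣ-zeroʳ _)) (L.+ᴹ-identityʳ w)
      where
      module L = On L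
      PPw : L.P (L.P w) L.≈ᴹ w L.· π
      PPw = On.WhenBalanced.PP-balanced L balanced w
      move : ∀ {α v v′ y z β} → y R.≈ β R.* z → α L.*ₗ v L.≈ᴹ v′ L.*ᵣ β → v′ L.*ᵣ y L.≈ᴹ α L.*ₗ (v L.*ᵣ z)
      move {α} {v} {v′} p q = L.≈ᴹ-trans (L.*ᵣ-congˡ p) (L.≈ᴹ-trans (L.≈ᴹ-sym (L.*ᵣ-assoc v′ _ _))
        (L.≈ᴹ-trans (L.*ᵣ-congʳ (L.≈ᴹ-sym q)) (L.*ₗ-*ᵣ-assoc α v _)))

    model : Model s thick X
    model = record
      { balanced    = λ {f} σf x → λ
          { 0F → R.trans (X-◃₀ f x) (R.trans (R.*-congʳ (emb.⟦⟧-cong (twist-fixed s σf))) (fixed-central σf _))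
          ; 1F → R.trans (X-◃₁ f x) (R.trans (R.*-congʳ (emb.⟦⟧-cong (twist-fixed (flip s) σf))) (fixed-central σf _)) }
      ; torsionFree = columns-torsionFree φ φ-hom
      ; separatedᴹ  = columns-separated φ φ-hom
      ; gen         = gen
      ; gen-hg      = λ a → λ
          { 0F → R.trans (X-◃₀ a gen) (R.trans (R.*-identityʳ _) (R.sym (R.*-identityˡ _)))
          ; 1F → R.trans (X-◃₁ a gen) (R.trans (R.zeroʳ _) (R.sym (R.zeroˡ _))) }
      ; gen∉Rad     = λ (y , z , p) → 1-unit (nonUnit-resp (R.sym (p 0F))
          (nonUnit-+ (nonUnit-resp (R.sym (X-P₀ y)) (nonUnit-π* _)) (nonUnit-*Π _)))
      ; gen-kind    = λ (z , p) → 1-unit (nonUnit-resp (R.trans (R.sym (p 1F)) (X-P₁ gen)) (nonUnit-*Π _))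
      ; span        = span
      ; universal   = universal
      }

-- Matrices

module DivisionMatrices {ℓ} (em : ExcludedMiddle ℓ) (R : Ring ℓ ℓ) where
  open Ring R hiding (zero)
  open Matrices R using (scalar)
  open SemiringSum semiring
  open RingProperties R
  open SetoidReasoning setoid

  module _ (1≉0 : ¬ 1# ≈ 0#) (inverse : ∀ x → ¬ x ≈ 0# → ∃[ y ] x * y ≈ 1#) where

    -- Eliminating the first column of A with a pivot A k 0 leaves a product
    -- of smaller matrices that is still the identity.
    identity-factor⇒≤ : ∀ m n (C : Fin m → Fin n → Carrier) (A : Fin n → Fin m → Carrier) →
      (∀ i j → ∑[ l < n ] (C i l * A l j) ≈ scalar 1# i j) → m ℕ.≤ n
    identity-factor⇒≤ zero n C A CA≈1 = ℕ.z≤n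
    identity-factor⇒≤ (suc m) n C A CA≈1 with em {∃[ k ] ¬ A k zero ≈ 0#}
    ... | no none = contradiction (begin
      1#                                ≈⟨ CA≈1 zero zero ⟨
      ∑[ l < n ] (C zero l * A l zero)
        ≈⟨ sum-cong-≋ (λ l → trans (*-congˡ (decidable-stable em λ ≉0 → none (l , ≉0))) (zeroʳ _)) ⟩
      ∑[ l < n ] 0#                     ≈⟨ sum-replicate-zero n ⟩
      0#                                ∎) 1≉0
    identity-factor⇒≤ (suc m) (suc n) C A CA≈1 | yes (k , Ak0≉0) =
      ℕ.s≤s (identity-factor⇒≤ m n (λ i l → C (suc i) (punchIn k l)) (λ l j → A′ (punchIn k l) (suc j)) C′A′≈1)
      where
      w = proj₁ (inverse (A k zero) Ak0≉0)
      Ak0w≈1 = proj₂ (inverse (A k zero) Ak0≉0)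
      A′ : Fin (suc n) → Fin (suc m) → Carrier
      A′ l j = A l j - A l zero * (w * A k j)
      A′k≈0 : ∀ j → A′ k j ≈ 0#
      A′k≈0 j = trans (+-congˡ (-‿cong (trans (sym (*-assoc _ _ _)) (trans (*-congʳ Ak0w≈1) (*-identityˡ _))))) (-‿inverseʳ _)
      term : ∀ i l j → C i l * A′ l j ≈ C i l * A l j + C i l * A l zero * (- (w * A k j))
      term i l j = trans (distribˡ _ _ _) (+-congˡ (trans (*-congˡ (-‿distribʳ-* _ _)) (sym (*-assoc _ _ _))))
      C′A′≈1 : ∀ i j → ∑[ l < n ] (C (suc i) (punchIn k l) * A′ (punchIn k l) (suc j)) ≈ scalar 1# i j
      C′A′≈1 i j = begin
        ∑[ l < n ] (C i′ (punchIn k l) * A′ (punchIn k l) j′)       ≈⟨ +-identityˡ _ ⟨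
        0# + ∑[ l < n ] (C i′ (punchIn k l) * A′ (punchIn k l) j′)  ≈⟨ +-congʳ (trans (*-congˡ (A′k≈0 j′)) (zeroʳ _)) ⟨
        C i′ k * A′ k j′ + ∑[ l < n ] (C i′ (punchIn k l) * A′ (punchIn k l) j′)
          ≈⟨ sum-remove (λ l → C i′ l * A′ l j′) ⟨
        ∑[ l < suc n ] (C i′ l * A′ l j′)                           ≈⟨ sum-cong-≋ (λ l → term i′ l j′) ⟩
        ∑[ l < suc n ] (C i′ l * A l j′ + C i′ l * A l zero * r)    ≈⟨ ∑-distrib-+ (λ l → C i′ l * A l j′) (λ l → C i′ l * A l zero * r) ⟩
        ∑[ l < suc n ] (C i′ l * A l j′) + ∑[ l < suc n ] (C i′ l * A l zero * r)
          ≈⟨ +-cong (CA≈1 i′ j′) (sym (*-distribʳ-sum r (λ l → C i′ l * A l zero))) ⟩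
        scalar 1# i j + ∑[ l < suc n ] (C i′ l * A l zero) * r      ≈⟨ +-congˡ (trans (*-congʳ (CA≈1 i′ zero)) (zeroˡ r)) ⟩
        scalar 1# i j + 0#                                          ≈⟨ +-identityʳ _ ⟩
        scalar 1# i j                                               ∎
        where
        i′ = suc i
        j′ = suc j
        r = - (w * A k j′)

module MatrixModules {ℓ} (R : Ring ℓ ℓ) where
  open Ring R hiding (zero)
  open Homs R
  open Matrices R
  open SemiringSum semiring
  open SetoidReasoning setoid

  infixr 7 _∙_
  _∙_ : ∀ {m n} → (Fin m → Fin n → Carrier) → (Fin n → Carrier) → Fin m → Carrier
  _∙_ {n = n} G x i = ∑[ k < n ] (G i k * x k)

  ∙-congʳ : ∀ {m n} (G : Fin m → Fin n → Carrier) {x y} → (∀ k → x k ≈ y k) → ∀ i → (G ∙ x) i ≈ (G ∙ y) i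
  ∙-congʳ G p i = sum-cong-≋ λ k → *-congˡ (p k)

  ∙-congˡ : ∀ {m n} {G H : Fin m → Fin n → Carrier} → (∀ i k → G i k ≈ H i k) → ∀ x i → (G ∙ x) i ≈ (H ∙ x) i
  ∙-congˡ p x i = sum-cong-≋ λ k → *-congʳ (p i k)

  ∙-assoc : ∀ {l m n} (G : Fin l → Fin m → Carrier) (H : Fin m → Fin n → Carrier) x i →
            ((λ i k → (G ∙ λ j → H j k) i) ∙ x) i ≈ (G ∙ (H ∙ x)) i
  ∙-assoc {l} {m} {n} G H x i = begin
    ∑[ k < n ] (∑[ j < m ] (G i j * H j k) * x k)
      ≈⟨ sum-cong-≋ (λ k → *-distribʳ-sum (x k) (λ j → G i j * H j k)) ⟩
    ∑[ k < n ] ∑[ j < m ] (G i j * H j k * x k)   ≈⟨ ∑-comm (λ k j → G i j * H j k * x k) ⟩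
    ∑[ j < m ] ∑[ k < n ] (G i j * H j k * x k)
      ≈⟨ sum-cong-≋ (λ j → trans (sum-cong-≋ λ k → *-assoc (G i j) (H j k) (x k)) (sym (*-distribˡ-sum (G i j) (λ k → H j k * x k)))) ⟩
    ∑[ j < m ] (G i j * ∑[ k < n ] (H j k * x k)) ∎

  ∙-+ : ∀ {m n} (G : Fin m → Fin n → Carrier) x y i → (G ∙ (λ k → x k + y k)) i ≈ (G ∙ x) i + (G ∙ y) i
  ∙-+ G x y i = trans (sum-cong-≋ λ k → distribˡ (G i k) (x k) (y k)) (∑-distrib-+ (λ k → G i k * x k) (λ k → G i k * y k))

  ∙-*ᵣ : ∀ {m n} (G : Fin m → Fin n → Carrier) x α i → (G ∙ (λ k → x k * α)) i ≈ (G ∙ x) i * α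
  ∙-*ᵣ G x α i = trans (sum-cong-≋ λ k → sym (*-assoc (G i k) (x k) α)) (sym (*-distribʳ-sum α (λ k → G i k * x k)))

  scalar-∙ : ∀ {n} (x : Fin n → Carrier) i → (scalar 1# ∙ x) i ≈ x i
  scalar-∙ x i = trans (sum-scalar 1# x i) (*-identityˡ _)

  basis : ∀ {n} → Fin n → Fin n → Carrier
  basis k i = scalar 1# i k

  ∙-basis : ∀ {m n} (G : Fin m → Fin n → Carrier) i k → (G ∙ basis k) i ≈ G i k
  ∙-basis {n = n} G i k = go n (G i) k
    where
    go : ∀ n (g : Fin n → Carrier) k → ∑[ l < n ] (g l * scalar 1# l k) ≈ g k
    go (suc n) g zero    = trans (+-cong (*-identityʳ _)
      (trans (sum-cong-≋ {n} λ l → zeroʳ (g (suc l))) (sum-replicate-zero n))) (+-identityʳ _)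
    go (suc n) g (suc k) = trans (+-cong (zeroʳ _) (go n (g ∘ suc) k)) (+-identityˡ _)

  record Coordinates {n} (ψ : Carrier → Matrix n) (M : Bimod) : Set ℓ where
    private
      module M = Bimodule M
    field
      to        : (Fin n → Carrier) → M.Carrierᴹ
      from      : M.Carrierᴹ → Fin n → Carrier
      to-cong   : ∀ {x y} → (∀ i → x i ≈ y i) → to x M.≈ᴹ to y
      from-cong : ∀ {x y} → x M.≈ᴹ y → ∀ i → from x i ≈ from y i
      from∘to   : ∀ x i → from (to x) i ≈ x i
      to∘from   : ∀ x → to (from x) M.≈ᴹ x
      to-+      : ∀ x y → to (λ i → x i + y i) M.≈ᴹ to x M.+ᴹ to y
      to-*ᵣ     : ∀ x α → to (λ i → x i * α) M.≈ᴹ to x M.*ᵣ α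
      to-∙      : ∀ α x → to (ψ α ∙ x) M.≈ᴹ α M.*ₗ to x

    from-+ : ∀ x y i → from (x M.+ᴹ y) i ≈ from x i + from y i
    from-+ x y i = trans (from-cong (M.≈ᴹ-trans (M.+ᴹ-cong (M.≈ᴹ-sym (to∘from x)) (M.≈ᴹ-sym (to∘from y))) (M.≈ᴹ-sym (to-+ _ _))) i) (from∘to _ i)

    from-*ᵣ : ∀ x α i → from (x M.*ᵣ α) i ≈ from x i * α
    from-*ᵣ x α i = trans (from-cong (M.≈ᴹ-trans (M.*ᵣ-congʳ (M.≈ᴹ-sym (to∘from x))) (M.≈ᴹ-sym (to-*ᵣ _ α))) i) (from∘to _ i)

    from-∙ : ∀ α x i → from (α M.*ₗ x) i ≈ (ψ α ∙ from x) i
    from-∙ α x i = trans (from-cong (M.≈ᴹ-trans (M.*ₗ-congˡ (M.≈ᴹ-sym (to∘from x))) (M.≈ᴹ-sym (to-∙ α _))) i) (from∘to _ i)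

  coordinates⇒iso : ∀ {n} {ψ : Carrier → Matrix n} {M N} → Coordinates ψ M → Coordinates ψ N → Iso M N
  coordinates⇒iso {ψ = ψ} c d = record
    { to = hom c d ; from = hom d c ; from∘to = inverse c d ; to∘from = inverse d c }
    where
    hom : ∀ {M N} → Coordinates ψ M → Coordinates ψ N → Hom M N
    hom {N = N} c d = record
      { fun = λ x → d.to (c.from x)
      ; cong = λ p → d.to-cong (c.from-cong p)
      ; +-homo = λ x y → N.≈ᴹ-trans (d.to-cong (c.from-+ x y)) (d.to-+ _ _)
      ; *ₗ-homo = λ α x → N.≈ᴹ-trans (d.to-cong (c.from-∙ α x)) (d.to-∙ α _)
      ; *ᵣ-homo = λ α x → N.≈ᴹ-trans (d.to-cong (c.from-*ᵣ x α)) (d.to-*ᵣ _ α) }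
      where
      module c = Coordinates c
      module d = Coordinates d
      module N = Bimodule N
    inverse : ∀ {M N} (c : Coordinates ψ M) (d : Coordinates ψ N) → ∀ x →
              Bimodule._≈ᴹ_ M (Coordinates.to c (Coordinates.from d (Coordinates.to d (Coordinates.from c x)))) x
    inverse {M} c d x = Bimodule.≈ᴹ-trans M (Coordinates.to-cong c (Coordinates.from∘to d _)) (Coordinates.to∘from c x)

  coordinates-∘-iso : ∀ {n} {ψ : Carrier → Matrix n} {M N} → Coordinates ψ M → Iso M N → Coordinates ψ N
  coordinates-∘-iso {N = N} c f = record
    { to = λ x → f.to ⟨$⟩ c.to x
    ; from = λ y → c.from (f.from ⟨$⟩ y)
    ; to-cong = λ p → Hom.cong f.to (c.to-cong p)
    ; from-cong = λ p → c.from-cong (Hom.cong f.from p)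
    ; from∘to = λ x i → trans (c.from-cong (f.from∘to _) i) (c.from∘to x i)
    ; to∘from = λ y → N.≈ᴹ-trans (Hom.cong f.to (c.to∘from _)) (f.to∘from y)
    ; to-+ = λ x y → N.≈ᴹ-trans (Hom.cong f.to (c.to-+ x y)) (Hom.+-homo f.to _ _)
    ; to-*ᵣ = λ x α → N.≈ᴹ-trans (Hom.cong f.to (c.to-*ᵣ x α)) (Hom.*ᵣ-homo f.to α _)
    ; to-∙ = λ α x → N.≈ᴹ-trans (Hom.cong f.to (c.to-∙ α x)) (Hom.*ₗ-homo f.to α _) }
    where
    module c = Coordinates c
    module f = Iso f
    module N = Bimodule N

  columns-coordinates : ∀ {n} (φ : Carrier → Matrix n) (φ-hom : IsRingHomomorphism rawRing (matrixRawRing n) φ) →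
                        Coordinates φ (Columns.columns R φ φ-hom)
  columns-coordinates φ φ-hom = record
    { to = λ x → x ; from = λ x → x ; to-cong = λ p → p ; from-cong = λ p → p
    ; from∘to = λ _ _ → refl ; to∘from = λ _ _ → refl
    ; to-+ = λ _ _ _ → refl ; to-*ᵣ = λ _ _ _ → refl ; to-∙ = λ _ _ _ → refl }

  empty-coordinates : (ψ : Carrier → Matrix 0) → Coordinates ψ 𝟘
  empty-coordinates ψ = record
    { to = λ _ → _ ; from = λ _ () ; to-cong = λ _ → _ ; from-cong = λ _ ()
    ; from∘to = λ _ () ; to∘from = λ _ → _ ; to-+ = λ _ _ → _ ; to-*ᵣ = λ _ _ → _ ; to-∙ = λ _ _ → _ }

  sum-split : ∀ m {n} (f : Fin (m ℕ.+ n) → Carrier) → sum f ≈ ∑[ i < m ] f (i ↑ˡ n) + ∑[ j < n ] f (m ↑ʳ j)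
  sum-split zero    f = sym (+-identityˡ _)
  sum-split (suc m) f = trans (+-congˡ (sum-split m (f ∘ suc))) (sym (+-assoc _ _ _))

  module _ {m n} (A : Matrix m) (B : Matrix n) where
    private
      zero-sum : ∀ k {y : Fin k → Carrier} (g : Fin k → Carrier) → (∀ l → g l ≈ 0#) → ∑[ l < k ] (g l * y l) ≈ 0#
      zero-sum k g p = trans (sum-cong-≋ {k} λ l → trans (*-congʳ (p l)) (zeroˡ _)) (sum-replicate-zero k)

      ll : ∀ i k → blockDiagonal A B (i ↑ˡ n) (k ↑ˡ n) ≡ A i k
      ll i k rewrite splitAt-↑ˡ m i n | splitAt-↑ˡ m k n = ≡.refl
      lr : ∀ i k → blockDiagonal A B (i ↑ˡ n) (m ↑ʳ k) ≡ 0#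
      lr i k rewrite splitAt-↑ˡ m i n | splitAt-↑ʳ m n k = ≡.refl
      rl : ∀ i k → blockDiagonal A B (m ↑ʳ i) (k ↑ˡ n) ≡ 0#
      rl i k rewrite splitAt-↑ʳ m n i | splitAt-↑ˡ m k n = ≡.refl
      rr : ∀ i k → blockDiagonal A B (m ↑ʳ i) (m ↑ʳ k) ≡ B i k
      rr i k rewrite splitAt-↑ʳ m n i | splitAt-↑ʳ m n k = ≡.refl

    blockDiagonal-∙ˡ : ∀ x i → (blockDiagonal A B ∙ x) (i ↑ˡ n) ≈ (A ∙ (x ∘ (_↑ˡ n))) i
    blockDiagonal-∙ˡ x i = trans (sum-split m _) (trans (+-cong
      (sum-cong-≋ {m} λ k → *-congʳ (reflexive (ll i k))) (zero-sum n _ λ k → reflexive (lr i k))) (+-identityʳ _))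

    blockDiagonal-∙ʳ : ∀ x i → (blockDiagonal A B ∙ x) (m ↑ʳ i) ≈ (B ∙ (x ∘ (m ↑ʳ_))) i
    blockDiagonal-∙ʳ x i = trans (sum-split m _) (trans (+-cong
      (zero-sum m _ λ k → reflexive (rl i k)) (sum-cong-≋ {n} λ k → *-congʳ (reflexive (rr i k)))) (+-identityˡ _))

  blockDiagonal-coordinates : ∀ {m n} {φ : Carrier → Matrix m} {ψ : Carrier → Matrix n} {M N} →
    Coordinates φ M → Coordinates ψ N → Coordinates (λ α → blockDiagonal (φ α) (ψ α)) (M ⊕ N)
  blockDiagonal-coordinates {m} {n} {φ} {ψ} {M} {N} c d = record
    { to = λ x → c.to (x ∘ (_↑ˡ n)) , d.to (x ∘ (m ↑ʳ_))
    ; from = join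
    ; to-cong = λ p → c.to-cong (λ i → p (i ↑ˡ n)) , d.to-cong (λ i → p (m ↑ʳ i))
    ; from-cong = λ (p , q) i → join-cong p q i
    ; from∘to = from∘to
    ; to∘from = λ (x , y) → M.≈ᴹ-trans (c.to-cong (λ i → reflexive (joinˡ (x , y) i))) (c.to∘from x) ,
                             N.≈ᴹ-trans (d.to-cong (λ i → reflexive (joinʳ (x , y) i))) (d.to∘from y)
    ; to-+ = λ x y → c.to-+ _ _ , d.to-+ _ _
    ; to-*ᵣ = λ x α → c.to-*ᵣ _ α , d.to-*ᵣ _ α
    ; to-∙ = λ α x → M.≈ᴹ-trans (c.to-cong (blockDiagonal-∙ˡ (φ α) (ψ α) x)) (c.to-∙ α _) ,
                     N.≈ᴹ-trans (d.to-cong (blockDiagonal-∙ʳ (φ α) (ψ α) x)) (d.to-∙ α _) }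
    where
    module c = Coordinates c
    module d = Coordinates d
    module M = Bimodule M
    module N = Bimodule N
    join : ∣ M ⊕ N ∣ → Fin (m ℕ.+ n) → Carrier
    join (x , y) i = [ c.from x , d.from y ]′ (splitAt m i)
    joinˡ : ∀ z i → join z (i ↑ˡ n) ≡ c.from (proj₁ z) i
    joinˡ z i rewrite splitAt-↑ˡ m i n = ≡.refl
    joinʳ : ∀ z i → join z (m ↑ʳ i) ≡ d.from (proj₂ z) i
    joinʳ z i rewrite splitAt-↑ʳ m n i = ≡.refl
    join-cong : ∀ {x x′ y y′} → x M.≈ᴹ x′ → y N.≈ᴹ y′ → ∀ i → join (x , y) i ≈ join (x′ , y′) i
    join-cong p q i with splitAt m i
    ... | inj₁ i′ = c.from-cong p i′
    ... | inj₂ i′ = d.from-cong q i′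
    from∘to : ∀ x i → join (c.to (x ∘ (_↑ˡ n)) , d.to (x ∘ (m ↑ʳ_))) i ≈ x i
    from∘to x i with splitAt m i in eq
    ... | inj₁ i′ = trans (c.from∘to _ i′) (reflexive (≡.cong x (splitAt⁻¹-↑ˡ {m} {n} {i} eq)))
    ... | inj₂ i′ = trans (d.from∘to _ i′) (reflexive (≡.cong x (splitAt⁻¹-↑ʳ {m} {n} {i} eq)))

  module _ {m n} {ψ : Carrier → Matrix m} {φ : Carrier → Matrix n} {M} (d : Coordinates ψ M) (c : Coordinates φ M) where
    private
      module c = Coordinates c
      module d = Coordinates d
      module M = Bimodule M

    transition : Fin m → Fin n → Carrier
    transition i k = d.from (c.to (basis k)) i

    private
      f : (Fin n → Carrier) → Fin m → Carrier
      f x = d.from (c.to x)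

      f-0 : ∀ i → f (λ _ → 0#) i ≈ 0#
      f-0 i = trans (d.from-cong (c.to-cong λ _ → sym (zeroˡ 0#)) i)
        (trans (d.from-cong (c.to-*ᵣ _ 0#) i) (trans (d.from-*ᵣ _ 0# i) (zeroʳ _)))

      f-sum : ∀ k (y : Fin k → Fin n → Carrier) i → f (λ l → ∑[ j < k ] y j l) i ≈ ∑[ j < k ] f (y j) i
      f-sum zero    y i = f-0 i
      f-sum (suc k) y i = trans (d.from-cong (c.to-+ _ _) i) (trans (d.from-+ _ _ i) (+-congˡ (f-sum k (y ∘ suc) i)))

    transition-∙ : ∀ x i → d.from (c.to x) i ≈ (transition ∙ x) i
    transition-∙ x i = begin
      f x i                                          ≈⟨ d.from-cong (c.to-cong λ l → sym (scalar-∙ x l)) i ⟩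
      f (λ l → ∑[ k < n ] (basis k l * x k)) i       ≈⟨ f-sum n (λ k l → basis k l * x k) i ⟩
      ∑[ k < n ] f (λ l → basis k l * x k) i
        ≈⟨ sum-cong-≋ {n} (λ k → trans (d.from-cong (c.to-*ᵣ _ (x k)) i) (d.from-*ᵣ _ (x k) i)) ⟩
      (transition ∙ x) i                             ∎

  module _ {m n} {ψ : Carrier → Matrix m} {φ : Carrier → Matrix n} {M} (d : Coordinates ψ M) (c : Coordinates φ M) where
    private
      module c = Coordinates c
      module d = Coordinates d
      module M = Bimodule M

    transition-inverse : ∀ i k → ∑[ l < n ] (transition d c i l * transition c d l k) ≈ scalar 1# i k
    transition-inverse i k = begin
      (transition d c ∙ λ l → transition c d l k) i  ≈⟨ transition-∙ d c _ i ⟨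
      d.from (c.to (c.from (d.to (basis k)))) i      ≈⟨ d.from-cong (c.to∘from _) i ⟩
      d.from (d.to (basis k)) i                      ≈⟨ d.from∘to _ i ⟩
      scalar 1# i k                                  ∎

    transition-conjugates : ∀ α i k →
      ∑[ l < n ] (∑[ j < n ] (transition d c i j * φ α j l) * transition c d l k) ≈ ψ α i k
    transition-conjugates α i k = begin
      ∑[ l < n ] (∑[ j < n ] (transition d c i j * φ α j l) * transition c d l k)
        ≈⟨ ∙-assoc (transition d c) (φ α) (λ l → transition c d l k) i ⟩
      (transition d c ∙ (φ α ∙ λ l → transition c d l k)) i     ≈⟨ transition-∙ d c _ i ⟨
      d.from (c.to (φ α ∙ c.from (d.to (basis k)))) i           ≈⟨ d.from-cong (c.to-∙ α _) i ⟩
      d.from (α M.*ₗ c.to (c.from (d.to (basis k)))) i          ≈⟨ d.from-cong (M.*ₗ-congˡ (c.to∘from _)) i ⟩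
      d.from (α M.*ₗ d.to (basis k)) i                          ≈⟨ d.from-∙ α _ i ⟩
      (ψ α ∙ d.from (d.to (basis k))) i                         ≈⟨ ∙-congʳ (ψ α) (d.from∘to (basis k)) i ⟩
      (ψ α ∙ basis k) i                                         ≈⟨ ∙-basis (ψ α) i k ⟩
      ψ α i k                                                   ∎

  conjugate-coordinates : ∀ {n} {φ ψ : Carrier → Matrix n} {M} → Coordinates φ M →
    (g h : Matrix n) → let open RawRing (matrixRawRing n) renaming (_≈_ to _≋_; _*_ to _⊠_; 1# to I) in
    g ⊠ h ≋ I → h ⊠ g ≋ I → (∀ α → (g ⊠ φ α) ⊠ h ≋ ψ α) → Coordinates ψ M
  conjugate-coordinates {n} {φ} {ψ} {M} c g h gh≈1 hg≈1 conj = record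
    { to = λ x → c.to (h ∙ x)
    ; from = λ y → g ∙ c.from y
    ; to-cong = λ p → c.to-cong (∙-congʳ h p)
    ; from-cong = λ p → ∙-congʳ g (c.from-cong p)
    ; from∘to = λ x i → trans (∙-congʳ g (c.from∘to _) i) (undo g h gh≈1 x i)
    ; to∘from = λ y → M.≈ᴹ-trans (c.to-cong (undo h g hg≈1 (c.from y))) (c.to∘from y)
    ; to-+ = λ x y → M.≈ᴹ-trans (c.to-cong (∙-+ h x y)) (c.to-+ _ _)
    ; to-*ᵣ = λ x α → M.≈ᴹ-trans (c.to-cong (∙-*ᵣ h x α)) (c.to-*ᵣ _ α)
    ; to-∙ = λ α x → M.≈ᴹ-trans (c.to-cong (intertwine α x)) (c.to-∙ α _) }
    where
    module c = Coordinates c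
    module M = Bimodule M
    undo : ∀ (a b : Matrix n) → (∀ i k → (a ∙ (λ j → b j k)) i ≈ scalar 1# i k) → ∀ x i → (a ∙ (b ∙ x)) i ≈ x i
    undo a b p x i = trans (sym (∙-assoc a b x i)) (trans (∙-congˡ p x i) (scalar-∙ x i))
    intertwine : ∀ α x i → (h ∙ (ψ α ∙ x)) i ≈ (φ α ∙ (h ∙ x)) i
    intertwine α x i = begin
      (h ∙ (ψ α ∙ x)) i                     ≈⟨ ∙-congʳ h (∙-congˡ (λ i k → sym (conj α i k)) x) i ⟩
      (h ∙ ((λ i k → ((λ i k → (g ∙ λ j → φ α j k) i) ∙ λ j → h j k) i) ∙ x)) i
        ≈⟨ ∙-congʳ h (∙-assoc (λ i k → (g ∙ λ j → φ α j k) i) h x) i ⟩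
      (h ∙ ((λ i k → (g ∙ λ j → φ α j k) i) ∙ (h ∙ x))) i   ≈⟨ ∙-congʳ h (∙-assoc g (φ α) (h ∙ x)) i ⟩
      (h ∙ (g ∙ (φ α ∙ (h ∙ x)))) i         ≈⟨ undo h g hg≈1 _ i ⟩
      (φ α ∙ (h ∙ x)) i                     ∎

-- Bilattices over the maximal order

module QuaternionOrder {ℓ} (em : ExcludedMiddle ℓ)
  {F : LocalField ℓ} {B : QuaternionDivisionAlgebra F}
  {O_B : Pred (QuaternionDivisionAlgebra.Carrier B) ℓ} (O_B-maximal : IsMaximalOrder B O_B)
  {K : UnramifiedQuadraticExtension F} (pres : Presentation B O_B K) where
  open Bilattices O_B-maximal pres

  private
    module B = QuaternionDivisionAlgebra B
    module K = UnramifiedQuadraticExtension K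
    module P = Presentation pres
    module 𝒪B = Ring 𝒪B
    module 𝒪K = CommutativeRing 𝒪K
    module V = ValuationRing K.localField
    module σ = IsRingIsomorphism K.σ-isRingIsomorphism
    module j = IsRingMonomorphism P.j-isRingMonomorphism
    module fromK = IsRingHomomorphism fromK-isRingHomomorphism

    v-πᴷ : K.v (proj₁ πᴷ) ≡ _
    v-πᴷ = ≡.trans (K.v-ι P.π) P.π-uniformizer

    involution : Involution 𝒪K
    involution = record { σ = σᴷ ; σ-hom = σᴷ-isRingHomomorphism ; σσ = Cyclic.σ-involutive }

    dvr : FiniteResidueDVR 𝒪K involution
    dvr = record
      { π         = πᴷ
      ; σπ        = K.σ-ι P.π
      ; local     = V.valuation-local πᴷ v-πᴷ
      ; π-nonunit = V.valuation-nonunit πᴷ v-πᴷ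
      ; separated = V.valuation-separated πᴷ v-πᴷ
      ; residues  = V.valuation-residues πᴷ v-πᴷ
      }

    nontrivial : ¬ (∀ x → σᴷ x 𝒪K.≈ x)
    nontrivial trivial = K.σ-nontrivial σx≈x
      where
      σx≈x : ∀ x → K.σ x K.≈ x
      σx≈x x with ≤⁺-dec ℤₚ._≤?_ [ + 0 ] (K.v x)
      ... | yes x∈ = trivial (x , x∈)
      ... | no  x∉ = begin
        K.σ x                            ≈⟨ K.*-identityʳ _ ⟨
        K.σ x K.* K.1#                   ≈⟨ K.*-congˡ (K.trans (K.*-comm y x) xy≈1) ⟨
        K.σ x K.* (y K.* x)              ≈⟨ K.*-assoc _ _ _ ⟨
        K.σ x K.* y K.* x                ≈⟨ K.*-congʳ (K.*-congˡ (trivial (y , inverse-in-O K.localField x y xy≈1 x∉))) ⟨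
        K.σ x K.* K.σ y K.* x            ≈⟨ K.*-congʳ (K.trans (K.sym (σ.*-homo x y)) (K.trans (σ.⟦⟧-cong xy≈1) σ.1#-homo)) ⟩
        K.1# K.* x                       ≈⟨ K.*-identityˡ x ⟩
        x                                ∎
        where
        open SetoidReasoning K.setoid
        module O = IsSubring (O-isSubring K.localField)
        xy = K.inverse x λ x≈0 → x∉ (O.resp (K.sym x≈0) O.0∈)
        y = proj₁ xy
        xy≈1 = proj₂ xy

    splitting = NontrivialInvolution.unit-difference em 𝒪K involution dvr nontrivial

  order : CyclicOrder ℓ
  order = record
    { A             = 𝒪K
    ; R             = 𝒪B
    ; emb           = fromK
    ; emb-hom       = fromK-isRingHomomorphism
    ; σ             = σᴷ
    ; σ-hom         = σᴷ-isRingHomomorphism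
    ; σσ            = Cyclic.σ-involutive
    ; π             = πᴷ
    ; σπ            = K.σ-ι P.π
    ; Π             = Π
    ; Π²            = B.trans P.Π²≈π (B.sym (P.j-ι P.π))
    ; Πa            = Πa≈σaΠ
    ; spanning      = spanning
    ; independent   = λ {a} {b} {a′} {b′} → Cyclic.combine-injective {a} {b} {a′} {b′}
    ; local         = V.valuation-local πᴷ v-πᴷ
    ; π-nonunit     = V.valuation-nonunit πᴷ v-πᴷ
    ; π-regular     = λ (a , _) p → π-cancel a K.0# (K.trans (K.*-comm _ a) (K.trans p (K.sym (K.zeroʳ _))))
    ; separated     = V.valuation-separated πᴷ v-πᴷ
    ; θ             = proj₁ splitting
    ; u             = proj₁ (proj₂ splitting)
    ; θ-σθ-unit     = proj₂ (proj₂ splitting)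
    ; fixed+fixed*θ = SplitInvolution.fixed-coordinates 𝒪K involution (proj₁ splitting) (proj₁ (proj₂ splitting)) (proj₂ (proj₂ splitting))
    }

  open Homs 𝒪B using (Bimod)
  open Modelled order using (Model)

  index : Degree → Kind → Fin 4
  index even thin  = 0F
  index odd  thin  = 1F
  index even thick = 2F
  index odd  thick = 3F

  X : Degree → Kind → Bimod
  X s κ = indecomposables (index s κ)

  private
    Π-combine : Π 𝒪B.≈ Cyclic.combine 𝒪K.0# 𝒪K.1#
    Π-combine = B.sym (B.trans (B.+-cong fromK.0#-homo (B.trans (B.*-congʳ fromK.1#-homo) (B.*-identityˡ _))) (B.+-identityˡ _))

    τ-emb : ∀ a → τ (fromK a) 𝒪B.≈ fromK (σᴷ a)
    τ-emb a = begin
      Π⁻¹ B.* P.j (proj₁ a) B.* P.Π                ≈⟨ B.*-assoc _ _ _ ⟩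
      Π⁻¹ B.* (P.j (proj₁ a) B.* P.Π)              ≈⟨ B.*-congˡ (Graded.aΠ order a) ⟩
      Π⁻¹ B.* (P.Π B.* P.j (K.σ (proj₁ a)))        ≈⟨ B.*-assoc _ _ _ ⟨
      Π⁻¹ B.* P.Π B.* P.j (K.σ (proj₁ a))          ≈⟨ B.*-congʳ Π⁻¹Π≈1 ⟩
      B.1# B.* P.j (K.σ (proj₁ a))                 ≈⟨ B.*-identityˡ _ ⟩
      P.j (K.σ (proj₁ a))                          ∎
      where open SetoidReasoning B.setoid

    τ-Π : τ Π 𝒪B.≈ Π
    τ-Π = B.trans (B.*-congʳ Π⁻¹Π≈1) (B.*-identityˡ _)

    open Matrices 𝒪B using (matrix₂)

    module _ {s} (φ : Representation 2)
      (φ≈ : ∀ {α a b} → α 𝒪B.≈ Cyclic.combine a b → ∀ i k →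
            φ α i k 𝒪B.≈ matrix₂ (fromK (Graded.twist order s a)) (fromK (Graded.twist order s b 𝒪K.* πᴷ))
                                 (fromK (Graded.twist order (flip s) b)) (fromK (Graded.twist order (flip s) a)) i k) where
      open Graded order using (twist)
      twist-0 : ∀ s → fromK (twist s 𝒪K.0#) 𝒪B.≈ 𝒪B.0#
      twist-0 even = fromK.0#-homo
      twist-0 odd  = B.trans (j.⟦⟧-cong (IsRingHomomorphism.0#-homo σᴷ-isRingHomomorphism)) fromK.0#-homo
      twist-1 : ∀ s → twist s 𝒪K.1# 𝒪K.≈ 𝒪K.1#
      twist-1 even = K.refl
      twist-1 odd  = IsRingHomomorphism.1#-homo σᴷ-isRingHomomorphism

      entries : 𝒪K.Carrier → 𝒪K.Carrier → Fin 2 → Fin 2 → 𝒪B.Carrier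
      entries a b = matrix₂ (fromK (twist s a)) (fromK (twist s b 𝒪K.* πᴷ))
                            (fromK (twist (flip s) b)) (fromK (twist (flip s) a))

      block-emb : ∀ a i k → φ (fromK a) i k 𝒪B.≈
                  matrix₂ (fromK (twist s a)) 𝒪B.0# 𝒪B.0# (fromK (twist (flip s) a)) i k
      block-emb a i k = B.trans (φ≈ (B.sym (Cyclic.combine-a-0 a)) i k) (simplify i k)
        where
        simplify : ∀ i k → entries a 𝒪K.0# i k 𝒪B.≈
                   matrix₂ (fromK (twist s a)) 𝒪B.0# 𝒪B.0# (fromK (twist (flip s) a)) i k
        simplify 0F 0F = B.refl
        simplify 0F 1F = B.trans (fromK.*-homo (twist s 𝒪K.0#) πᴷ) (B.trans (B.*-congʳ (twist-0 s)) (B.zeroˡ _))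
        simplify 1F 0F = twist-0 (flip s)
        simplify 1F 1F = B.refl

      block-Π : ∀ i k → φ Π i k 𝒪B.≈ matrix₂ 𝒪B.0# (fromK πᴷ) 𝒪B.1# 𝒪B.0# i k
      block-Π i k = B.trans (φ≈ Π-combine i k) (simplify i k)
        where
        simplify : ∀ i k → entries 𝒪K.0# 𝒪K.1# i k 𝒪B.≈ matrix₂ 𝒪B.0# (fromK πᴷ) 𝒪B.1# 𝒪B.0# i k
        simplify 0F 0F = twist-0 s
        simplify 0F 1F = j.⟦⟧-cong (K.trans (K.*-congʳ (twist-1 s)) (K.*-identityˡ _))
        simplify 1F 0F = B.trans (j.⟦⟧-cong (twist-1 (flip s))) fromK.1#-homo
        simplify 1F 1F = twist-0 (flip s)

    φ₁≈ : ∀ {α a b} → α 𝒪B.≈ Cyclic.combine a b → ∀ i k →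
          φ₁ α i k 𝒪B.≈ matrix₂ (fromK a) (fromK (b 𝒪K.* πᴷ)) (fromK (σᴷ b)) (fromK (σᴷ a)) i k
    φ₁≈ {α} {a} {b} p 0F 0F = j.⟦⟧-cong (Block₁.block≈ {α} {a} {b} p 0F 0F)
    φ₁≈ {α} {a} {b} p 0F 1F = j.⟦⟧-cong (Block₁.block≈ {α} {a} {b} p 0F 1F)
    φ₁≈ {α} {a} {b} p 1F 0F = j.⟦⟧-cong (Block₁.block≈ {α} {a} {b} p 1F 0F)
    φ₁≈ {α} {a} {b} p 1F 1F = j.⟦⟧-cong (Block₁.block≈ {α} {a} {b} p 1F 1F)

    φ₂≈ : ∀ {α a b} → α 𝒪B.≈ Cyclic.combine a b → ∀ i k →
          φ₂ α i k 𝒪B.≈ matrix₂ (fromK (σᴷ a)) (fromK (σᴷ b 𝒪K.* πᴷ)) (fromK b) (fromK a) i k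
    φ₂≈ {α} {a} {b} p 0F 0F = j.⟦⟧-cong (Block₂.block≈ {α} {a} {b} p 0F 0F)
    φ₂≈ {α} {a} {b} p 0F 1F = j.⟦⟧-cong (Block₂.block≈ {α} {a} {b} p 0F 1F)
    φ₂≈ {α} {a} {b} p 1F 0F = j.⟦⟧-cong (Block₂.block≈ {α} {a} {b} p 1F 0F)
    φ₂≈ {α} {a} {b} p 1F 1F = j.⟦⟧-cong (Block₂.block≈ {α} {a} {b} p 1F 1F)

  φ₁-emb : ∀ a i k → φ₁ (fromK a) i k 𝒪B.≈ matrix₂ (fromK a) 𝒪B.0# 𝒪B.0# (fromK (σᴷ a)) i k
  φ₁-emb = block-emb {even} φ₁ φ₁≈

  φ₂-emb : ∀ a i k → φ₂ (fromK a) i k 𝒪B.≈ matrix₂ (fromK (σᴷ a)) 𝒪B.0# 𝒪B.0# (fromK a) i k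
  φ₂-emb = block-emb {odd} φ₂ φ₂≈

  model : ∀ s κ → Model s κ (X s κ)
  model even thin  = ColumnModels.ThinModel.model order even idᴿ idᴿ-isRepresentation (λ _ → B.refl) B.refl
  model odd  thin  = ColumnModels.ThinModel.model order odd τᴿ τᴿ-isRepresentation τ-emb τ-Π
  model even thick = ColumnModels.ThickModel.model order even φ₁ φ₁-isRepresentation φ₁-emb (block-Π {even} φ₁ φ₁≈)
  model odd  thick = ColumnModels.ThickModel.model order odd φ₂ φ₂-isRepresentation φ₂-emb (block-Π {odd} φ₂ φ₂≈)

infixr 6 _⊹_
_⊹_ : ℕ⁴ → ℕ⁴ → ℕ⁴
⟨ a , b , c , d ⟩ ⊹ ⟨ a′ , b′ , c′ , d′ ⟩ = ⟨ a ℕ.+ a′ , b ℕ.+ b′ , c ℕ.+ c′ , d ℕ.+ d′ ⟩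

unit : Type → ℕ⁴
unit (even , thin)  = ⟨ 1 , 0 , 0 , 0 ⟩
unit (odd  , thin)  = ⟨ 0 , 1 , 0 , 0 ⟩
unit (even , thick) = ⟨ 0 , 0 , 1 , 0 ⟩
unit (odd  , thick) = ⟨ 0 , 0 , 0 , 1 ⟩

count : List Type → ℕ⁴
count []       = ⟨ 0 , 0 , 0 , 0 ⟩
count (t ∷ ts) = unit t ⊹ count ts

⊹-swap : ∀ p q r → p ⊹ (q ⊹ r) ≡ q ⊹ (p ⊹ r)
⊹-swap ⟨ a , b , c , d ⟩ ⟨ a′ , b′ , c′ , d′ ⟩ ⟨ a″ , b″ , c″ , d″ ⟩
  rewrite x∙yz≈y∙xz a a′ a″ | x∙yz≈y∙xz b b′ b″ | x∙yz≈y∙xz c c′ c″ | x∙yz≈y∙xz d d′ d″ = ≡.refl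

count-↭ : ∀ {ts ts′} → ts ↭ ts′ → count ts ≡ count ts′
count-↭ ↭.refl          = ≡.refl
count-↭ (↭.prep t p)    = ≡.cong (unit t ⊹_) (count-↭ p)
count-↭ (↭.swap t t′ p) = ≡.trans (⊹-swap (unit t) (unit t′) _) (≡.cong (λ q → unit t′ ⊹ (unit t ⊹ q)) (count-↭ p))
count-↭ (↭.trans p p′)  = ≡.trans (count-↭ p) (count-↭ p′)

types : ℕ⁴ → List Type
types ⟨ suc r₁ , r₂ , t₁ , t₂ ⟩       = (even , thin) ∷ types ⟨ r₁ , r₂ , t₁ , t₂ ⟩
types ⟨ 0 , suc r₂ , t₁ , t₂ ⟩        = (odd , thin) ∷ types ⟨ 0 , r₂ , t₁ , t₂ ⟩
types ⟨ 0 , 0 , suc t₁ , t₂ ⟩         = (even , thick) ∷ types ⟨ 0 , 0 , t₁ , t₂ ⟩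
types ⟨ 0 , 0 , 0 , suc t₂ ⟩          = (odd , thick) ∷ types ⟨ 0 , 0 , 0 , t₂ ⟩
types ⟨ 0 , 0 , 0 , 0 ⟩               = []

count-types : ∀ q → count (types q) ≡ q
count-types ⟨ suc r₁ , r₂ , t₁ , t₂ ⟩ = ≡.cong (unit (even , thin) ⊹_) (count-types ⟨ r₁ , r₂ , t₁ , t₂ ⟩)
count-types ⟨ 0 , suc r₂ , t₁ , t₂ ⟩  = ≡.cong (unit (odd , thin) ⊹_) (count-types ⟨ 0 , r₂ , t₁ , t₂ ⟩)
count-types ⟨ 0 , 0 , suc t₁ , t₂ ⟩   = ≡.cong (unit (even , thick) ⊹_) (count-types ⟨ 0 , 0 , t₁ , t₂ ⟩)
count-types ⟨ 0 , 0 , 0 , suc t₂ ⟩    = ≡.cong (unit (odd , thick) ⊹_) (count-types ⟨ 0 , 0 , 0 , t₂ ⟩)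
count-types ⟨ 0 , 0 , 0 , 0 ⟩         = ≡.refl

module BilatticeClassification {ℓ} (em : ExcludedMiddle ℓ)
  {F : LocalField ℓ} {B : QuaternionDivisionAlgebra F}
  {O_B : Pred (QuaternionDivisionAlgebra.Carrier B) ℓ} (O_B-maximal : IsMaximalOrder B O_B)
  {K : UnramifiedQuadraticExtension F} (pres : Presentation B O_B K) where
  open Bilattices O_B-maximal pres
  open QuaternionOrder em O_B-maximal pres using (order; X; model; index)
  open Homs 𝒪B hiding (_⊕_)
  open Graded order using (module On)
  open Modelled order using (module Model)
  open Classification em order X model using (Std; module Existence; unique)
  open MatrixModules 𝒪B

  private
    module F = LocalField F
    module B = QuaternionDivisionAlgebra B
    module K = UnramifiedQuadraticExtension K
    module P = Presentation pres
    module 𝒪B = Ring 𝒪B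
    module 𝒪K = CommutativeRing 𝒪K
    module ι = IsRingHomomorphism B.ι-isRingHomomorphism
    module j = IsRingMonomorphism P.j-isRingMonomorphism
    module X s κ = Model (model s κ)
    open Matrices 𝒪B using (scalar; sum-scalar)
    module Σ𝒪B = SemiringSum 𝒪B.semiring

  iso⇒≅ : ∀ {L M} → Iso L M → L ≅ M
  iso⇒≅ f = _ , Iso.isBimoduleIsomorphism f

  ≅⇒iso : ∀ {L M} → L ≅ M → Iso L M
  ≅⇒iso (_ , f) = isBimoduleIsomorphism⇒iso f

  module _ {n} (φ : Representation n) (φ-rep : IsRepresentation φ)
    (linear : ∀ a (a∈O : a ∈ F.O) i k → φ (fromF a a∈O) i k 𝒪B.≈ scalar (fromF a a∈O) i k) where
    private
      C : 𝒪B-Bimodule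
      C = Columns.columns 𝒪B φ φ-rep
      module C = Bimodule C

      fromF-*ₗ : ∀ a a∈O x i → (fromF a a∈O C.*ₗ x) i 𝒪B.≈ fromF a a∈O 𝒪B.* x i
      fromF-*ₗ a a∈O x i = 𝒪B.trans {i = (φ (fromF a a∈O) ∙ x) i} {j = (scalar (fromF a a∈O) ∙ x) i} {k = fromF a a∈O 𝒪B.* x i}
        (∙-congˡ {G = φ (fromF a a∈O)} {H = scalar (fromF a a∈O)} (linear a a∈O) x i)
        (sum-scalar (fromF a a∈O) x i)

      generated-sum : ∀ m (y : Fin m → C.Carrierᴹ) → (∀ k → Generated C basis (y k)) →
                      Generated C basis (λ i → Σ𝒪B.sum (λ k → y k i))
      generated-sum zero    y h = zero
      generated-sum (suc m) y h = add (h zero) (generated-sum m (y ∘ suc) (h ∘ suc))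

    columns-isBilattice : IsBilattice C
    columns-isBilattice = record
      { finitelyGenerated = n , basis , λ x →
          resp {x = λ i → Σ𝒪B.sum (λ k → basis k i 𝒪B.* x k)} (scalar-∙ x)
            (generated-sum n (λ k i → basis k i 𝒪B.* x k) λ k → right (x k) (gen k))
      ; torsionFree = λ a a∈O x a≉0 p i → cancel {a} {proj₁ (x i)} a≉0 (B.trans (B.sym (fromF-*ₗ a a∈O x i)) (p i))
      ; actionsAgree = λ a a∈O x i → B.trans (fromF-*ₗ a a∈O x i) (B.ι-central a _)
      }
      where
      cancel : ∀ {a x} → ¬ a F.≈ F.0# → B.ι a B.* x B.≈ B.0# → x B.≈ B.0#
      cancel {a} {x} a≉0 p = begin
        x                         ≈⟨ B.*-identityˡ x ⟨
        B.1# B.* x                ≈⟨ B.*-congʳ (B.trans (ι.⟦⟧-cong (F.trans (F.*-comm b a) ab≈1)) ι.1#-homo) ⟨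
        B.ι (b F.* a) B.* x       ≈⟨ B.*-congʳ (ι.*-homo b a) ⟩
        B.ι b B.* B.ι a B.* x     ≈⟨ B.*-assoc _ _ _ ⟩
        B.ι b B.* (B.ι a B.* x)   ≈⟨ B.*-congˡ p ⟩
        B.ι b B.* B.0#            ≈⟨ B.zeroʳ _ ⟩
        B.0#                      ∎
        where
        open SetoidReasoning B.setoid
        b = proj₁ (F.inverse a a≉0)
        ab≈1 = proj₂ (F.inverse a a≉0)

  retract-isBilattice : ∀ {L M} (f : Hom L M) (g : Hom M L) →
    (∀ x → Bimodule._≈ᴹ_ M (f ⟨$⟩ (g ⟨$⟩ x)) x) → IsBilattice L → IsBilattice M
  retract-isBilattice {L} {M} f g fg bilattice = record
    { finitelyGenerated = let n , h , gens = finitelyGenerated in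
        n , (λ i → f ⟨$⟩ h i) , λ x → resp (fg x) (image (gens (g ⟨$⟩ x)))
    ; torsionFree = λ a a∈O x a≉0 p → M.≈ᴹ-trans (M.≈ᴹ-sym (fg x)) (M.≈ᴹ-trans (f.cong
        (torsionFree a a∈O _ a≉0 (L.≈ᴹ-trans (L.≈ᴹ-sym (g.*ₗ-homo _ x)) (L.≈ᴹ-trans (g.cong p) g.0-homo)))) f.0-homo)
    ; actionsAgree = λ a a∈O x → M.≈ᴹ-trans (M.*ₗ-congˡ (M.≈ᴹ-sym (fg x))) (M.≈ᴹ-trans (M.≈ᴹ-sym (f.*ₗ-homo _ _))
        (M.≈ᴹ-trans (f.cong (actionsAgree a a∈O _)) (M.≈ᴹ-trans (f.*ᵣ-homo _ _) (M.*ᵣ-congʳ (fg x)))))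
    }
    where
    open IsBilattice bilattice
    module L = Bimodule L
    module M = Bimodule M
    module f = Hom f
    module g = Hom g
    image : ∀ {n} {h : Fin n → ∣ L ∣} {x} → Generated L h x → Generated M (λ i → f ⟨$⟩ h i) (f ⟨$⟩ x)
    image (gen i)     = gen i
    image (resp p x)  = resp (f.cong p) (image x)
    image zero        = resp (M.≈ᴹ-sym f.0-homo) zero
    image (add x y)   = resp (M.≈ᴹ-sym (f.+-homo _ _)) (add (image x) (image y))
    image (left α x)  = resp (M.≈ᴹ-sym (f.*ₗ-homo α _)) (left α (image x))
    image (right α x) = resp (M.≈ᴹ-sym (f.*ᵣ-homo α _)) (right α (image x))

  module _ {L : 𝒪B-Bimodule} (bilattice : IsBilattice L) where
    private
      open IsBilattice bilattice
      module L = On L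

    bilattice-balanced : L.Balanced
    bilattice-balanced {x , x∈} σx≈x y with FixedField.fixed⇒∈F em K σx≈x
    ... | f , x≈ιf = L.≈ᴹ-trans (L.*ₗ-congʳ emb≈) (L.≈ᴹ-trans (actionsAgree f f∈O y) (L.*ᵣ-congˡ (B.sym emb≈)))
      where
      f∈O : f ∈ F.O
      f∈O = ≡.subst (_ ≤⁺_) (≡.trans (K.v-cong x≈ιf) (K.v-ι f)) x∈
      emb≈ : P.j x B.≈ B.ι f
      emb≈ = B.trans (j.⟦⟧-cong x≈ιf) (P.j-ι f)

    bilattice-torsionFree : L.π-TorsionFree
    bilattice-torsionFree {x} p = torsionFree P.π π∈O x π≉0
      (L.≈ᴹ-trans (actionsAgree P.π π∈O x) (L.≈ᴹ-trans (L.*ᵣ-congˡ (B.sym (P.j-ι P.π))) p))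
      where
      π∈O : P.π ∈ F.O
      π∈O = ≡.subst (_ ≤⁺_) (K.v-ι P.π) (proj₂ πᴷ)

    generated-induction : ∀ {n} {g : Fin n → L.Carrierᴹ} {N} → L.Closed N → N L.0ᴹ → (∀ i → N (g i)) → ∀ {x} → Generated L g x → N x
    generated-induction {g = g} {N} closed n₀ n = go
      where
      module N = L.Closed closed
      go : ∀ {x} → Generated L g x → N x
      go (gen i)     = n i
      go (resp p x)  = N.resp p (go x)
      go zero        = n₀
      go (add x y)   = N.add (go x) (go y)
      go (left α x)  = N.left α (go x)
      go (right α x) = N.right α (go x)

    bilattice-decomposition : ∃[ ts ] Iso (Std ts) L
    bilattice-decomposition = let n , g , generated = finitelyGenerated in
      Existence.existence L bilattice-balanced bilattice-torsionFree n g
        λ closed n₀ ng x → generated-induction closed n₀ ng (generated x)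

  standard-∷ : ∀ s κ q → Iso (standardBilattice (unit (s , κ) ⊹ q)) (X s κ ⊕ standardBilattice q)
  standard-∷ even thin ⟨ r₁ , r₂ , t₁ , t₂ ⟩ = ⊕-assoc 𝕆 (𝕆 ⊕^ r₁) (ℙ ⊕^ r₂ ⊕ 𝕃₁ ⊕^ t₁ ⊕ 𝕃₂ ⊕^ t₂)
  standard-∷ odd thin ⟨ r₁ , r₂ , t₁ , t₂ ⟩ = ≅-trans
    (⊕-cong (≅-refl {𝕆 ⊕^ r₁}) (⊕-assoc ℙ (ℙ ⊕^ r₂) (𝕃₁ ⊕^ t₁ ⊕ 𝕃₂ ⊕^ t₂)))
    (⊕-swap (𝕆 ⊕^ r₁) ℙ (ℙ ⊕^ r₂ ⊕ 𝕃₁ ⊕^ t₁ ⊕ 𝕃₂ ⊕^ t₂))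
  standard-∷ even thick ⟨ r₁ , r₂ , t₁ , t₂ ⟩ = ≅-trans
    (⊕-cong (≅-refl {𝕆 ⊕^ r₁}) (≅-trans
      (⊕-cong (≅-refl {ℙ ⊕^ r₂}) (⊕-assoc 𝕃₁ (𝕃₁ ⊕^ t₁) (𝕃₂ ⊕^ t₂)))
      (⊕-swap (ℙ ⊕^ r₂) 𝕃₁ (𝕃₁ ⊕^ t₁ ⊕ 𝕃₂ ⊕^ t₂))))
    (⊕-swap (𝕆 ⊕^ r₁) 𝕃₁ (ℙ ⊕^ r₂ ⊕ 𝕃₁ ⊕^ t₁ ⊕ 𝕃₂ ⊕^ t₂))
  standard-∷ odd thick ⟨ r₁ , r₂ , t₁ , t₂ ⟩ = ≅-trans
    (⊕-cong (≅-refl {𝕆 ⊕^ r₁}) (≅-trans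
      (⊕-cong (≅-refl {ℙ ⊕^ r₂}) (⊕-swap (𝕃₁ ⊕^ t₁) 𝕃₂ (𝕃₂ ⊕^ t₂)))
      (⊕-swap (ℙ ⊕^ r₂) 𝕃₂ (𝕃₁ ⊕^ t₁ ⊕ 𝕃₂ ⊕^ t₂))))
    (⊕-swap (𝕆 ⊕^ r₁) 𝕃₂ (ℙ ⊕^ r₂ ⊕ 𝕃₁ ⊕^ t₁ ⊕ 𝕃₂ ⊕^ t₂))

  Std≅standard : ∀ ts → Iso (Std ts) (standardBilattice (count ts))
  Std≅standard [] = ≅-sym (≅-trans (⊕-identityˡ (𝟘 ⊕ 𝟘 ⊕ 𝟘)) (≅-trans (⊕-identityˡ (𝟘 ⊕ 𝟘)) (⊕-identityˡ 𝟘)))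
  Std≅standard ((s , κ) ∷ ts) = ≅-trans (⊕-cong (≅-refl {X s κ}) (Std≅standard ts)) (≅-sym (standard-∷ s κ (count ts)))

  standard≅Std : ∀ q → Iso (standardBilattice q) (Std (types q))
  standard≅Std q = ≡.subst (λ q′ → Iso (standardBilattice q′) (Std (types q))) (count-types q) (≅-sym (Std≅standard (types q)))

  standard-unique : ∀ q q′ → Iso (standardBilattice q) (standardBilattice q′) → q ≡ q′
  standard-unique q q′ f = ≡.trans (≡.sym (count-types q)) (≡.trans (count-↭ (unique (types q) (types q′)
    (≅-trans (≅-sym (standard≅Std q)) (≅-trans f (standard≅Std q′))))) (count-types q′))

  decomposition : ∀ L → IsBilattice L → ∃! _≡_ λ q → L ≅ standardBilattice q
  decomposition L bilattice = let ts , f = bilattice-decomposition bilattice in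
    count ts , iso⇒≅ (≅-trans (≅-sym f) (Std≅standard ts)) ,
    λ {q} g → standard-unique (count ts) q (≅-trans (≅-sym (Std≅standard ts)) (≅-trans f (≅⇒iso g)))

  IsZero-≅ : ∀ {L M} → Iso L M → IsZero L → IsZero M
  IsZero-≅ {L} {M} f z x = M.≈ᴹ-trans (M.≈ᴹ-sym (Iso.to∘from f x))
    (M.≈ᴹ-trans (Hom.cong (Iso.to f) (z _)) (Hom.0-homo (Iso.to f)))
    where module M = Bimodule M

  ⊕-zeroʳ : ∀ {M N} → IsZero N → Iso (M ⊕ N) M
  ⊕-zeroʳ {M} {N} z = record
    { to = fstH ; from = inlH {M} {N}
    ; from∘to = λ (x , y) → Bimodule.≈ᴹ-refl M , Bimodule.≈ᴹ-sym N (z y)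
    ; to∘from = λ _ → Bimodule.≈ᴹ-refl M }

  Std-++ : ∀ ts ts′ → Iso (Std (ts ++ ts′)) (Std ts ⊕ Std ts′)
  Std-++ []             ts′ = ≅-sym (⊕-identityˡ (Std ts′))
  Std-++ ((s , κ) ∷ ts) ts′ = ≅-trans (⊕-cong (≅-refl {X s κ}) (Std-++ ts ts′)) (≅-sym (⊕-assoc (X s κ) (Std ts) (Std ts′)))

  X-nonzero : ∀ s κ → ¬ IsZero (X s κ)
  X-nonzero s κ z = X.gen∉Rad s κ (Graded.On.rad-resp order (X s κ) (M.≈ᴹ-sym (z _)) (M.rad-resp M.P.zero-homo (M.rad-P M.0ᴹ)))
    where module M = On (X s κ)

  indecomposable : ∀ s κ → IsBilattice (X s κ) → IsIndecomposable (X s κ)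
  indecomposable s κ bilattice = X-nonzero s κ , λ M N f → summands M N (≅⇒iso f)
    where
    summands : ∀ M N → Iso (X s κ) (M ⊕ N) → IsZero M ⊎ IsZero N
    summands M N f = split (proj₁ m) (proj₁ n) (proj₂ m) (proj₂ n)
      where
      m = bilattice-decomposition (retract-isBilattice (fstH {M} {N} ∘H Iso.to f) (Iso.from f ∘H inlH {M} {N})
            (λ x → proj₁ (Iso.to∘from f _)) bilattice)
      n = bilattice-decomposition (retract-isBilattice (sndH {M} {N} ∘H Iso.to f) (Iso.from f ∘H inrH {M} {N})
            (λ x → proj₂ (Iso.to∘from f _)) bilattice)
      split : ∀ ts ts′ → Iso (Std ts) M → Iso (Std ts′) N → IsZero M ⊎ IsZero N
      split [] ts′ g h = inj₁ (IsZero-≅ g λ _ → _)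
      split (t ∷ ts) [] g h = inj₂ (IsZero-≅ h λ _ → _)
      split (t ∷ ts) (t′ ∷ ts′) g h = contradiction
        (≡.trans (≡.sym (ℕₚ.+-suc (length ts) (length ts′))) (≡.trans (≡.sym (length-++ ts)) (ℕₚ.suc-injective (↭-length
          (unique (t ∷ ts ++ t′ ∷ ts′) ((s , κ) ∷ []) (≅-trans (Std-++ (t ∷ ts) (t′ ∷ ts′))
            (≅-trans (⊕-cong g h) (≅-trans (≅-sym f) (≅-sym (⊕-identityʳ (X s κ)))))))))))
        λ ()

  X-distinct : ∀ {s κ s′ κ′} → Iso (X s κ) (X s′ κ′) → (s , κ) ≡ (s′ , κ′)
  X-distinct {s} {κ} {s′} {κ′} f = ∷-injectiveˡ (↭-singleton-inv (unique ((s , κ) ∷ []) ((s′ , κ′) ∷ [])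
    (≅-trans (⊕-identityʳ (X s κ)) (≅-trans f (≅-sym (⊕-identityʳ (X s′ κ′)))))))

  indecomposable-is-X : ∀ L → IsBilattice L → IsIndecomposable L → ∃[ s ] ∃[ κ ] Iso L (X s κ)
  indecomposable-is-X L bilattice (L≉0 , indec) = identify (proj₁ d) (proj₂ d)
    where
    d = bilattice-decomposition bilattice
    identify : ∀ ts → Iso (Std ts) L → ∃[ s ] ∃[ κ ] Iso L (X s κ)
    identify [] f = contradiction (IsZero-≅ f λ _ → _) L≉0
    identify ((s , κ) ∷ ts) f = s , κ , ≅-trans (≅-sym f)
      (⊕-zeroʳ ([ (λ z → contradiction z (X-nonzero s κ)) , (λ z → z) ]′ (indec (X s κ) (Std ts) (iso⇒≅ (≅-sym f)))))

  private
    scalar₁-linear : ∀ (f : 𝒪B.Carrier → 𝒪B.Carrier) → (∀ a a∈O → f (fromF a a∈O) 𝒪B.≈ fromF a a∈O) →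
      ∀ a (a∈O : a ∈ F.O) (i k : Fin 1) → scalar (f (fromF a a∈O)) i k 𝒪B.≈ scalar (fromF a a∈O) i k
    scalar₁-linear f p a a∈O 0F 0F = p a a∈O

    τ-linear : ∀ a a∈O → τ (fromF a a∈O) 𝒪B.≈ fromF a a∈O
    τ-linear a a∈O = begin
      Π⁻¹ B.* B.ι a B.* P.Π      ≈⟨ B.*-congʳ (B.ι-central a Π⁻¹) ⟨
      B.ι a B.* Π⁻¹ B.* P.Π      ≈⟨ B.*-assoc _ _ _ ⟩
      B.ι a B.* (Π⁻¹ B.* P.Π)    ≈⟨ B.*-congˡ Π⁻¹Π≈1 ⟩
      B.ι a B.* B.1#             ≈⟨ B.*-identityʳ _ ⟩
      B.ι a                      ∎
      where open SetoidReasoning B.setoid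

    module _ {s} (φ : Representation 2)
      (φ-emb : ∀ a i k → φ (fromK a) i k 𝒪B.≈ Matrices.matrix₂ 𝒪B (fromK (Graded.twist order s a)) 𝒪B.0# 𝒪B.0#
                                                (fromK (Graded.twist order (flip s) a)) i k)
      (φ-cong : ∀ {α β} → α 𝒪B.≈ β → ∀ i k → φ α i k 𝒪B.≈ φ β i k) where
      thick-linear : ∀ a (a∈O : a ∈ F.O) i k → φ (fromF a a∈O) i k 𝒪B.≈ scalar (fromF a a∈O) i k
      thick-linear a a∈O i k = B.trans (φ-cong {fromF a a∈O} {fromK a′} (B.sym (P.j-ι a)) i k) (B.trans (φ-emb a′ i k) (entry i k))
        where
        a′ : 𝒪K.Carrier
        a′ = K.ι a , ≡.subst (_ ≤⁺_) (≡.sym (K.v-ι a)) a∈O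
        twisted : ∀ s → fromK (Graded.twist order s a′) 𝒪B.≈ fromF a a∈O
        twisted even = P.j-ι a
        twisted odd  = B.trans (j.⟦⟧-cong (K.σ-ι a)) (P.j-ι a)
        entry : ∀ i k → Matrices.matrix₂ 𝒪B (fromK (Graded.twist order s a′)) 𝒪B.0# 𝒪B.0#
                          (fromK (Graded.twist order (flip s) a′)) i k 𝒪B.≈ scalar (fromF a a∈O) i k
        entry 0F 0F = twisted s
        entry 0F 1F = B.refl
        entry 1F 0F = B.refl
        entry 1F 1F = twisted (flip s)

  X-isBilattice : ∀ s κ → IsBilattice (X s κ)
  X-isBilattice even thin  = columns-isBilattice idᴿ idᴿ-isRepresentation (scalar₁-linear (λ α → α) λ _ _ → B.refl)
  X-isBilattice odd  thin  = columns-isBilattice τᴿ τᴿ-isRepresentation (scalar₁-linear τ τ-linear)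
  X-isBilattice even thick = columns-isBilattice φ₁ φ₁-isRepresentation
    (thick-linear {even} φ₁ (QuaternionOrder.φ₁-emb em O_B-maximal pres) (IsRingHomomorphism.⟦⟧-cong φ₁-isRepresentation))
  X-isBilattice odd  thick = columns-isBilattice φ₂ φ₂-isRepresentation
    (thick-linear {odd} φ₂ (QuaternionOrder.φ₂-emb em O_B-maximal pres) (IsRingHomomorphism.⟦⟧-cong φ₂-isRepresentation))

  indecomposable-type : Fin 4 → Type
  indecomposable-type 0F = even , thin
  indecomposable-type 1F = odd , thin
  indecomposable-type 2F = even , thick
  indecomposable-type 3F = odd , thick

  private
    typed : Type → 𝒪B-Bimodule
    typed (s , κ) = X s κ

    index-type : ∀ i → (let s , κ = indecomposable-type i in index s κ) ≡ i
    index-type 0F = ≡.refl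
    index-type 1F = ≡.refl
    index-type 2F = ≡.refl
    index-type 3F = ≡.refl

    typed-type : ∀ i → typed (indecomposable-type i) ≡ indecomposables i
    typed-type i = ≡.cong indecomposables (index-type i)

  indecomposables-bilattices : ∀ i → IsBilattice (indecomposables i) × IsIndecomposable (indecomposables i)
  indecomposables-bilattices i = ≡.subst (λ L → IsBilattice L × IsIndecomposable L) (typed-type i)
    (let s , κ = indecomposable-type i in X-isBilattice s κ , indecomposable s κ (X-isBilattice s κ))

  indecomposables-distinct : ∀ i k → indecomposables i ≅ indecomposables k → i ≡ k
  indecomposables-distinct i k f = ≡.trans (≡.sym (index-type i)) (≡.trans
    (≡.cong (λ (s , κ) → index s κ) (X-distinct
      (≡.subst₂ Iso (≡.sym (typed-type i)) (≡.sym (typed-type k)) (≅⇒iso f)))) (index-type k))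

  indecomposables-complete : ∀ L → IsBilattice L → IsIndecomposable L → ∃[ i ] L ≅ indecomposables i
  indecomposables-complete L bilattice indec = let s , κ , f = indecomposable-is-X L bilattice indec in
    index s κ , iso⇒≅ f

  ⊕^-cong : ∀ {L M} → Iso L M → ∀ r → Iso (L ⊕^ r) (M ⊕^ r)
  ⊕^-cong f zero    = ≅-refl
  ⊕^-cong f (suc r) = ⊕-cong f (⊕^-cong f r)

  𝕆≅natural : Iso 𝕆 𝒪B-natural
  𝕆≅natural = record
    { to = record { fun = λ x → x 0F ; cong = λ p → p 0F ; +-homo = λ _ _ → B.refl
                  ; *ₗ-homo = λ _ _ → B.+-identityʳ _ ; *ᵣ-homo = λ _ _ → B.refl }
    ; from = record { fun = λ y _ → y ; cong = λ p _ → p ; +-homo = λ _ _ _ → B.refl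
                    ; *ₗ-homo = λ { _ _ 0F → B.sym (B.+-identityʳ _) } ; *ᵣ-homo = λ _ _ _ → B.refl }
    ; from∘to = λ { _ 0F → B.refl }
    ; to∘from = λ _ → B.refl }

  ℙ≅𝔓 : Iso ℙ 𝔓
  ℙ≅𝔓 = bijective⇒iso multiplyΠ
    (λ {x} {y} p → λ { 0F → B.trans (B.sym (cancelΠ (proj₁ (x 0F)))) (B.trans (B.*-congˡ p) (cancelΠ (proj₁ (y 0F)))) })
    λ (x , y , x≈Πy) → (λ _ → y) , B.sym x≈Πy
    where
    open SetoidReasoning B.setoid
    cancelΠ : ∀ x → Π⁻¹ B.* (P.Π B.* x) B.≈ x
    cancelΠ x = B.trans (B.sym (B.*-assoc _ _ _)) (B.trans (B.*-congʳ Π⁻¹Π≈1) (B.*-identityˡ x))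
    Πτ : ∀ α x → P.Π B.* (Π⁻¹ B.* α B.* P.Π B.* x B.+ B.0#) B.≈ α B.* (P.Π B.* x)
    Πτ α x = begin
      P.Π B.* (Π⁻¹ B.* α B.* P.Π B.* x B.+ B.0#)   ≈⟨ B.*-congˡ (B.+-identityʳ _) ⟩
      P.Π B.* (Π⁻¹ B.* α B.* P.Π B.* x)            ≈⟨ B.*-congˡ (B.trans (B.*-assoc _ _ _) (B.*-assoc _ _ _)) ⟩
      P.Π B.* (Π⁻¹ B.* (α B.* (P.Π B.* x)))        ≈⟨ B.*-assoc _ _ _ ⟨
      P.Π B.* Π⁻¹ B.* (α B.* (P.Π B.* x))          ≈⟨ B.*-congʳ ΠΠ⁻¹≈1 ⟩
      B.1# B.* (α B.* (P.Π B.* x))                 ≈⟨ B.*-identityˡ _ ⟩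
      α B.* (P.Π B.* x)                            ∎
    multiplyΠ : Hom ℙ 𝔓
    multiplyΠ = record
      { fun = λ x → Π 𝒪B.* x 0F , x 0F , B.refl
      ; cong = λ p → B.*-congˡ (p 0F)
      ; +-homo = λ _ _ → B.distribˡ _ _ _
      ; *ₗ-homo = λ α x → Πτ (proj₁ α) (proj₁ (x 0F))
      ; *ᵣ-homo = λ _ _ → B.sym (B.*-assoc _ _ _) }

  standard≅natural : ∀ q → Iso (standardBilattice q) (naturalBilattice q)
  standard≅natural ⟨ r₁ , r₂ , t₁ , t₂ ⟩ =
    ⊕-cong (⊕^-cong 𝕆≅natural r₁) (⊕-cong (⊕^-cong ℙ≅𝔓 r₂) (≅-refl {𝕃₁ ⊕^ t₁ ⊕ 𝕃₂ ⊕^ t₂}))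

  ⊕^-coordinates : ∀ {n} {φ : Representation n} {M} → Coordinates φ M → ∀ r → Coordinates (φ ⊕^ᴿ r) (M ⊕^ r)
  ⊕^-coordinates {φ = φ} c zero    = empty-coordinates (φ ⊕^ᴿ 0)
  ⊕^-coordinates         c (suc r) = blockDiagonal-coordinates c (⊕^-coordinates c r)

  standard-coordinates : ∀ q → Coordinates (standard q) (standardBilattice q)
  standard-coordinates ⟨ r₁ , r₂ , t₁ , t₂ ⟩ = blockDiagonal-coordinates
    (⊕^-coordinates (columns-coordinates idᴿ idᴿ-isRepresentation) r₁) (blockDiagonal-coordinates
    (⊕^-coordinates (columns-coordinates τᴿ τᴿ-isRepresentation) r₂) (blockDiagonal-coordinates
    (⊕^-coordinates (columns-coordinates φ₁ φ₁-isRepresentation) t₁)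
    (⊕^-coordinates (columns-coordinates φ₂ φ₂-isRepresentation) t₂)))

  private
    module DB = DivisionMatrices em B.ring
    open SemiringSum 𝒪B.semiring using () renaming (sum to sum𝒪)
    open SemiringSum B.semiring using () renaming (sum to sumB)

    sum-proj : ∀ n (x : Fin n → 𝒪B.Carrier) → sumB (λ i → proj₁ (x i)) B.≈ proj₁ (sum𝒪 x)
    sum-proj zero    x = B.refl
    sum-proj (suc n) x = B.+-congˡ (sum-proj n (x ∘ suc))

    scalar-proj : ∀ {n} (i k : Fin n) → proj₁ (scalar 𝒪B.1# i k) B.≈ Matrices.scalar B.ring B.1# i k
    scalar-proj zero    zero    = B.refl
    scalar-proj zero    (suc _) = B.refl
    scalar-proj (suc _) zero    = B.refl
    scalar-proj (suc i) (suc k) = scalar-proj i k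

  rank-≤ : ∀ {m n} {ψ : Representation m} {φ : Representation n} {M} → Coordinates ψ M → Coordinates φ M → m ℕ.≤ n
  rank-≤ {m} {n} d c = DB.identity-factor⇒≤ B.1≉0 (λ x x≉0 → let y , xy≈1 , _ = B.division x x≉0 in y , xy≈1) m n
    (λ i l → proj₁ (transition d c i l)) (λ l k → proj₁ (transition c d l k))
    λ i k → B.trans (sum-proj n (λ l → transition d c i l 𝒪B.* transition c d l k))
      (B.trans (transition-inverse d c i k) (scalar-proj i k))

  coordinates⇒∼ : ∀ {m n} {ψ : Representation m} {φ : Representation n} {M} → Coordinates ψ M → Coordinates φ M → φ ∼ ψ
  coordinates⇒∼ d c = conjugate (ℕₚ.≤-antisym (rank-≤ d c) (rank-≤ c d)) d c
    where
    conjugate : ∀ {m n} {ψ : Representation m} {φ : Representation n} {M} → m ≡ n → Coordinates ψ M → Coordinates φ M → φ ∼ ψ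
    conjugate ≡.refl d c = ≡.refl , transition d c , transition c d ,
      transition-inverse d c , transition-inverse c d , transition-conjugates d c

  ∼⇒coordinates : ∀ {m n} {ψ : Representation m} {φ : Representation n} {M} → φ ∼ ψ → Coordinates φ M → Coordinates ψ M
  ∼⇒coordinates (≡.refl , g , h , gh , hg , conj) c = conjugate-coordinates c g h gh hg conj

  embedding-classification : ∀ n (φ : Representation n) → IsEmbedding φ → ∃! _≡_ λ q → φ ∼ standard q
  embedding-classification n φ embedding = let q , f , q-unique = decomposition C C-isBilattice in
    q , coordinates⇒∼ (coordinates-∘-iso (standard-coordinates q) (≅-sym (≅⇒iso f))) φ-coordinates ,
    λ {q′} φ∼q′ → q-unique (iso⇒≅ (coordinates⇒iso (∼⇒coordinates φ∼q′ φ-coordinates) (standard-coordinates q′)))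
    where
    open IsEmbedding embedding
    φ-rep = IsRingMonomorphism.isRingHomomorphism isRingMonomorphism
    C = Columns.columns 𝒪B φ φ-rep
    φ-coordinates = columns-coordinates φ φ-rep
    C-isBilattice = columns-isBilattice φ φ-rep O_F-linear

theorem2p0p2 : ∀ {ℓ} → ExcludedMiddle ℓ →
    (F : LocalField ℓ) (B : QuaternionDivisionAlgebra F)
    (O_B : Pred (QuaternionDivisionAlgebra.Carrier B) ℓ) (O_B-maximal : IsMaximalOrder B O_B)
    (K : UnramifiedQuadraticExtension F) (pres : Presentation B O_B K) →
    let open Bilattices O_B-maximal pres in
    (∀ n (φ : Representation n) → IsEmbedding φ → ∃! _≡_ λ q → φ ∼ standard q)
    × (∀ i → IsBilattice (indecomposables i) × IsIndecomposable (indecomposables i))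
    × (∀ i k → indecomposables i ≅ indecomposables k → i ≡ k)
    × (∀ L → IsBilattice L → IsIndecomposable L → ∃[ i ] L ≅ indecomposables i)
    × (∀ L → IsBilattice L → ∃! _≡_ λ q → L ≅ standardBilattice q)
    × (∀ q → standardBilattice q ≅ naturalBilattice q)
theorem2p0p2 em F B O_B O_B-maximal K pres =
  embedding-classification , indecomposables-bilattices , indecomposables-distinct ,
  indecomposables-complete , decomposition , λ q → iso⇒≅ (standard≅natural q)
  where open BilatticeClassification em O_B-maximal pres
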